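{- There exists a universal constant $C>0$ such that the following holds. Fix an integer $r\ge 2$ and an $r$-colouring of the edges of $K_n$ (with colours in $[r]$). For every colour $i\in[r]$, denote by $m_i$ the number of edges in colour $i$. Then, for every $i\in[r]$ and every tree $T$ on $n$ vertices with maximum degree $\Delta$, there is a copy of $T$ in $K_n$ with at least $$\frac{2m_i}{n}+C(n-1-\Delta)\left(\frac{m_i^*}{n^2}\right)^2$$ edges in colour $i$, where $m_i^*:=\min\left(m_i,\binom n2-m_i\right)$.
   Context: $[r]=\{1,\dots,r\}$. An $r$-colouring of the edges of a graph is an arbitrary map from its edge set to $[r]$. A copy of $T$ in $K_n$ is a subgraph of $K_n$ isomorphic to $T$. The constant $C$ does not depend on $r$, $n$, $T$, $\Delta$ or the colouring. -}

module Defs where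

open import Data.Bool.Base using (Bool; false; not; T)
open import Data.Fin.Base as Fin using (Fin; zero; suc; inject₁; fromℕ)
import Data.Fin.Properties as Fin
open import Data.Fin.Subset using (Subset; _∈_; ∣_∣)
open import Data.Integer.Base as ℤ using (ℤ; +_)
open import Data.List.Base using (List; allFin; cartesianProduct; filter; length; map; mapMaybe)
open import Data.List.Extrema.Nat using (max)
open import Data.Maybe.Base as Maybe using (Maybe)
open import Data.Nat.Base as ℕ using (ℕ; NonZero)
open import Data.Nat.Combinatorics using (_C_)
open import Data.Nat.Properties using (m^n≢0)
open import Data.Product.Base using (∃; _×_; _,_; proj₁)
open import Data.Rational.Base as ℚ using (ℚ; _/_)
open import Data.Vec.Base using (tabulate)
open import Function.Base using (_∘_)
open import Function.Bundles using (_↔_; Inverse)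
open import Function.Definitions using (Injective)
open import Relation.Binary.Construct.Closure.ReflexiveTransitive using (Star)
open import Relation.Binary.PropositionalEquality using (_≡_; _≢_; refl; sym; cong)
open import Relation.Nullary using (¬_; Dec; does; yes; no)
open import Relation.Nullary.Decidable using (dec⇒maybe; dec-true; _×-dec_; T?)
open import Relation.Nullary.Negation using (contradiction)

record Graph (V : Set) : Set where
  field
    adj       : V → V → Bool
    adj-sym   : ∀ u v → adj u v ≡ adj v u
    adj-irrefl : ∀ v → adj v v ≡ false

  Adj : V → V → Set
  Adj u v = T (adj u v)

open Graph public

record _≅_ {V W : Set} (G : Graph V) (H : Graph W) : Set where
  field
    bijection : V ↔ W
    preserves : ∀ u v → adj G u v ≡ adj H (Inverse.to bijection u) (Inverse.to bijection v)

complete : (n : ℕ) → Graph (Fin n)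
complete n = record
  { adj        = λ u v → not (does (u Fin.≟ v))
  ; adj-sym    = λ u v → cong not (does-sym u v)
  ; adj-irrefl = λ v → cong not (dec-true (v Fin.≟ v) refl)
  }
  where
  does-sym : ∀ u v → does (u Fin.≟ v) ≡ does (v Fin.≟ u)
  does-sym u v with u Fin.≟ v | v Fin.≟ u
  ... | yes _   | yes _   = refl
  ... | no  _   | no  _   = refl
  ... | yes u≡v | no  v≢u = contradiction (sym u≡v) v≢u
  ... | no  u≢v | yes v≡u = contradiction (sym v≡u) u≢v

-- An unordered edge {u , v} is represented by its unique ordering u < v;
-- both remaining components are proof-irrelevant, so edges are not duplicated.
Edge : ∀ {n} → Graph (Fin n) → Set
Edge G = ∃ λ u → ∃ λ v → u Fin.< v × Adj G u v

edges : ∀ {n} (G : Graph (Fin n)) → List (Edge G)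
edges {n} G = mapMaybe edge? (cartesianProduct (allFin n) (allFin n))
  where
  edge? : Fin n × Fin n → Maybe (Edge G)
  edge? (u , v) =
    Maybe.map (λ p → u , v , p) (dec⇒maybe ((u Fin.<? v) ×-dec T? (adj G u v)))

degree : ∀ {n} → Graph (Fin n) → Fin n → ℕ
degree G v = ∣ tabulate (adj G v) ∣

maxDegree : ∀ {n} → Graph (Fin n) → ℕ
maxDegree {n} G = max 0 (map (degree G) (allFin n))

-- A cycle on the m + 1 ≥ 3 distinct vertices vertex 0, …, vertex m.
record Cycle {V : Set} (G : Graph V) : Set where
  field
    m        : ℕ
    2≤m      : 2 ℕ.≤ m
    vertex   : Fin (ℕ.suc m) → V
    distinct : Injective _≡_ _≡_ vertex
    step     : ∀ (j : Fin m) → Adj G (vertex (inject₁ j)) (vertex (suc j))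
    close    : Adj G (vertex (fromℕ m)) (vertex zero)

record IsTree {V : Set} (G : Graph V) : Set where
  field
    nonempty  : V
    connected : ∀ u v → Star (Adj G) u v
    acyclic   : ¬ Cycle G

-- The edge set of a subgraph is held as a graph on the ambient vertex set,
-- none of whose edges meets the complement of `vertices`.
record Subgraph {n} (G : Graph (Fin n)) : Set where
  field
    vertices  : Subset n
    edgeSet   : Graph (Fin n)
    edgeSet⊆  : ∀ {u v} → Adj edgeSet u v → Adj G u v
    endpoints : ∀ {u v} → Adj edgeSet u v → u ∈ vertices

  asGraph : Graph (∃ λ v → v ∈ vertices)
  asGraph = record
    { adj        = λ u v → adj edgeSet (proj₁ u) (proj₁ v)
    ; adj-sym    = λ u v → adj-sym edgeSet (proj₁ u) (proj₁ v)
    ; adj-irrefl = λ v → adj-irrefl edgeSet (proj₁ v)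
    }

  inclusion : Edge edgeSet → Edge G
  inclusion (u , v , u<v , uv) = u , v , u<v , edgeSet⊆ uv

record Copy {W : Set} (T : Graph W) {n} (G : Graph (Fin n)) : Set where
  field
    subgraph   : Subgraph G
    isomorphic : Subgraph.asGraph subgraph ≅ T

Colouring : ∀ {n} → Graph (Fin n) → ℕ → Set
Colouring G r = Edge G → Fin r

edgesInColour : ∀ {n} (G : Graph (Fin n)) {r} → Colouring G r → Fin r → ℕ
edgesInColour G χ i = length (filter (λ e → χ e Fin.≟ i) (edges G))

copyEdgesInColour : ∀ {W : Set} {T : Graph W} {n} {G : Graph (Fin n)} {r} →
                    Colouring G r → Copy T G → Fin r → ℕ
copyEdgesInColour χ H i =
  edgesInColour (Subgraph.edgeSet S) (χ ∘ Subgraph.inclusion S) i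
  where S = Copy.subgraph H

infix 8 _⋆[_]
_⋆[_] : ℕ → ℕ → ℤ
m ⋆[ n ] = + m ℤ.⊓ (+ (n C 2) ℤ.- + m)

bound : ℚ → (n : ℕ) .{{_ : NonZero n}} (Δ m : ℕ) → ℚ
bound C n Δ m =
  (+ (2 ℕ.* m)) / n ℚ.+ C ℚ.* ((+ n ℤ.- + 1 ℤ.- + Δ) / 1) ℚ.* (q ℚ.* q)
  where
  q : ℚ
  q = _/_ (m ⋆[ n ]) (n ℕ.^ 2) {{m^n≢0 n 2}}

{-
Only the graph G of edges of colour i matters. Write e(π) for the number of edges of T that a bijection π sends into G.
The mean of e(π) over all permutations is 2 mᵢ / n.

Gain. Let x, y be non-adjacent vertices of T having private neighbours p and q. Precomposing π with the transposition (x y)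
changes e by a quantity D(π) that changes sign under (x y), and that moves by twice the alternating sum of G along the
4-cycle πx πq πy πp under (p q). Hence the mean of max(D, 0) is at least half the mean Q / n⁴ of that alternating sum
in absolute value. Gadgets (x, y) taken from an independent set of T do not interfere, so k of them gain
k Q / (2 n⁴) on average.

Gadgets. Pair up greedily the leaves of T and the two colour classes of its non-leaves. Non-leaves always have private
neighbours, because T has no 4-cycle, and leaves that stay unpaired share their neighbour; so k ≥ (n - 1 - Δ) / 6 for one
of the three families.

Discrepancy. Both Q and m* are invariant under complementation of G, so let G be the sparser graph. If m ≥ 250 n then
Q ≥ m² / 4000: either many edges join vertices of degree below 3n/4, and an edge yq together with a non-neighbour of each
end is unbalanced, or at least about m / 4n vertices have larger degree, and two of those together with non-adjacent
neighbours of small degree are unbalanced. If m < 250 n it suffices to beat the mean by any amount, as n e(π) - 2m is an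
integer. This fails only if Q = 0 and n divides 2m; but Q = 0 forces G or its complement to be empty or a star, and in a
star 2m = 2(n - 1).
-}

module Submission where

open import Defs
open import Data.Fin.Base using (Fin)
open import Data.Integer.Base using (+_)
open import Data.Nat.Base as ℕ using (ℕ; NonZero)
open import Data.Product.Base using (∃; _×_)
open import Data.Rational.Base as ℚ using (ℚ; 0ℚ; _/_)
open import Relation.Binary.PropositionalEquality using (_≡_)

open import Data.Bool.Base as Bool using (Bool; true; false; not; T)
import Data.Bool.Properties as Bool
open import Data.Fin.Base as Fin using (zero; suc; funToFin; finToFun)
open import Data.Fin.Permutation as Perm using (Permutation′; _⟨$⟩ʳ_; _⟨$⟩ˡ_; _∘ₚ_)
import Data.Fin.Permutation.Components as PC
import Data.Fin.Properties as Fin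
open import Data.Fin.Subset as Subset using (Subset)
import Data.Fin.Subset.Properties as Subset
open import Data.Integer.Base as ℤ using (ℤ; 0ℤ; 1ℤ; _+_; _*_; _-_; -_; _≤_; _<_; _⊔_; ∣_∣; +≤+)
import Data.Integer.Properties as ℤ
open import Data.Integer.Tactic.RingSolver using (solve-∀)
open import Data.List.Base
  using (List; []; _∷_; _++_; length; foldr; filter; map; mapMaybe; tabulate; allFin; cartesianProduct)
open import Data.List.Extrema.Nat using (xs≤max)
import Data.List.Membership.DecPropositional as DecMembership
open import Data.List.Membership.Propositional using (_∈_; find; lose)
open import Data.List.Membership.Propositional.Properties
  using (∈-filter⁺; ∈-filter⁻; ∈-allFin; ∈-∃++; ∈-++⁺ˡ; ∈-++⁺ʳ; ∈-++⁻; ∈-map⁺)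
import Data.List.Properties as List
open import Data.List.Relation.Binary.Permutation.Propositional
  using (_↭_; ↭-refl; ↭-prep; ↭-sym; ↭-trans; ↭⇒↭ₛ)
open import Data.List.Relation.Binary.Permutation.Propositional.Properties
  using (shift; ↭-length; ∈-resp-↭; ++⁺ˡ)
import Data.List.Relation.Binary.Permutation.Setoid.Properties as PermutationSetoid
open import Data.List.Relation.Unary.All as All using (All; []; _∷_)
import Data.List.Relation.Unary.All.Properties as All
open import Data.List.Relation.Unary.AllPairs using (AllPairs; []; _∷_)
open import Data.List.Relation.Unary.Any as Any using (here; there)
open import Data.List.Relation.Unary.Unique.Propositional using (Unique)
import Data.List.Relation.Unary.Unique.Propositional.Properties as Unique
open import Data.Maybe.Base as Maybe using (Maybe; just; nothing)
import Data.Nat.Combinatorics as ℕ using (_C_; nC1≡n; nCk+nC[k+1]≡[n+1]C[k+1])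
import Data.Nat.Divisibility as ℕ using (_∣_; divides; ∣⇒≤)
import Data.Nat.Properties as ℕ
open import Data.Nat.Tactic.RingSolver using () renaming (solve-∀ to ℕ-solve-∀)
open import Data.Product.Base using (proj₁; proj₂; _,_; ∃₂)
import Data.Rational.Properties as ℚ
open import Data.Rational.Unnormalised.Base as ℚᵘ using (mkℚᵘ; *≤*)
import Data.Rational.Unnormalised.Properties as ℚᵘ
open import Data.Sum.Base using (_⊎_; inj₁; inj₂)
import Data.Vec.Base as Vec
import Data.Vec.Properties as Vec
open import Data.Vec.Properties.WithK using ([]=-irrelevant)
open import Function.Base using (_∘_; id; case_of_)
open import Function.Bundles using (mk↔ₛ′)
open import Function.Definitions using (Injective)
open import Relation.Binary.Construct.Closure.ReflexiveTransitive using (Star; ε; _◅_)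
open import Relation.Binary.PropositionalEquality
  using (_≢_; refl; sym; trans; cong; cong₂; subst; subst₂; _≗_; module ≡-Reasoning)
import Relation.Binary.PropositionalEquality.Properties as ≡
open import Relation.Nullary using (¬_; Dec; does; yes; no)
open import Relation.Nullary.Decidable
  using (dec-true; dec-false; dec⇒maybe; T?; ¬?; _×-dec_; _→-dec_)
open import Relation.Nullary.Negation using (contradiction)

open import Algebra.Properties.Semiring.Sum ℤ.+-*-semiring
  using (sum-cong-≗; sum-replicate-zero; ∑-distrib-+; ∑-comm; sum-permute; *-distribˡ-sum; *-distribʳ-sum)
  renaming (sum to ∑)

-- Two regimes are unavoidable: a star has n - 1 edges and Q = 0, so no bound of Q from below by a
-- multiple of m² can hold at m = n - 1, and for m of that order integrality of e(π) is what
-- remains. The constant comes from balancing the regimes. With k ≥ (n - 1 - Δ) / 6 and Q ≥ m*² /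
-- 4000 the gain k Q / (2 n⁴) supports every C up to 1 / 48000; with m* ≤ 250 n, beating the mean by
-- 1 / n supports every C up to 1 / 62500. C = 1 / 100000 meets both.
--
-- Nothing is divided: a mean becomes a sum over permutations compared with a multiple of their
-- number `W n`, and powers of n stay as factors. The average is taken once, over e(π) plus all
-- positive gains; a single permutation reaches it, and the profitable swaps are then performed on
-- that permutation.

private
  variable
    n : ℕ
    V : Set

-- Sums of integers

⟦_⟧ : Bool → ℤ
⟦ true ⟧  = 1ℤ
⟦ false ⟧ = 0ℤ

δ : Fin n → Fin n → ℤ
δ u v = ⟦ does (u Fin.≟ v) ⟧

-- Nonlinear inequalities below are certified rather than derived: the difference of the two sides
-- is written as a sum of products of nonnegative terms, and the ring solver checks the identity.
≤-by : ∀ {a b d} → 0ℤ ≤ d → b - a ≡ d → a ≤ b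
≤-by 0≤d eq = ℤ.0≤i-j⇒j≤i (subst (0ℤ ≤_) (sym eq) 0≤d)

0≤+ : ∀ {a b} → 0ℤ ≤ a → 0ℤ ≤ b → 0ℤ ≤ a + b
0≤+ = ℤ.+-mono-≤

0≤* : ∀ {a b} → 0ℤ ≤ a → 0ℤ ≤ b → 0ℤ ≤ a * b
0≤* {a} {b} 0≤a 0≤b =
  subst (λ z → z ≤ a * b) (ℤ.*-zeroʳ a) (ℤ.*-monoˡ-≤-nonNeg a {{ℤ.nonNegative 0≤a}} 0≤b)

0≤ℕ : ∀ k → 0ℤ ≤ + k
0≤ℕ k = +≤+ ℕ.z≤n

0≤- : ∀ {a b} → a ≤ b → 0ℤ ≤ b - a
0≤- = ℤ.i≤j⇒0≤j-i

⟦⟧-nonneg : ∀ b → 0ℤ ≤ ⟦ b ⟧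
⟦⟧-nonneg true  = 0≤ℕ 1
⟦⟧-nonneg false = 0≤ℕ 0

⟦⟧≤1 : ∀ b → ⟦ b ⟧ ≤ 1ℤ
⟦⟧≤1 true  = ℤ.≤-refl
⟦⟧≤1 false = 0≤ℕ 1

*-mono-≤ : ∀ {a b c d} → 0ℤ ≤ a → 0ℤ ≤ d → a ≤ b → c ≤ d → a * c ≤ b * d
*-mono-≤ {a} {b} {c} {d} 0≤a 0≤d a≤b c≤d =
  ℤ.≤-trans (ℤ.*-monoˡ-≤-nonNeg a {{ℤ.nonNegative 0≤a}} c≤d)
            (ℤ.*-monoʳ-≤-nonNeg d {{ℤ.nonNegative 0≤d}} a≤b)

∑-mono : {f g : Fin n → ℤ} → (∀ i → f i ≤ g i) → ∑ f ≤ ∑ g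
∑-mono {ℕ.zero}  f≤g = ℤ.≤-refl
∑-mono {ℕ.suc n} f≤g = ℤ.+-mono-≤ (f≤g zero) (∑-mono (f≤g ∘ suc))

∑-zero : {f : Fin n → ℤ} → (∀ i → f i ≡ 0ℤ) → ∑ f ≡ 0ℤ
∑-zero {n} f≡0 = trans (sum-cong-≗ f≡0) (sum-replicate-zero n)

∑-nonneg : {f : Fin n → ℤ} → (∀ i → 0ℤ ≤ f i) → 0ℤ ≤ ∑ f
∑-nonneg {n} {f} 0≤f = subst (λ z → z ≤ ∑ f) (sum-replicate-zero n) (∑-mono 0≤f)

∑-const : ∀ c → ∑ {n} (λ _ → c) ≡ + n * c
∑-const {ℕ.zero}  c = refl
∑-const {ℕ.suc n} c =
  trans (cong₂ _+_ (refl {x = c}) (∑-const {n} c)) (trans (lem c (+ n)) (cong (_* c) (sym (ℤ.pos-+ 1 n))))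
  where
  lem : ∀ c k → c + k * c ≡ (1ℤ + k) * c
  lem = solve-∀

∑-neg : (f : Fin n → ℤ) → ∑ (λ i → - f i) ≡ - ∑ f
∑-neg {ℕ.zero}  f = refl
∑-neg {ℕ.suc n} f =
  trans (cong₂ _+_ (refl {x = - f zero}) (∑-neg (f ∘ suc))) (sym (ℤ.neg-distrib-+ (f zero) _))

∑-distrib-- : (f g : Fin n → ℤ) → ∑ (λ i → f i - g i) ≡ ∑ f - ∑ g
∑-distrib-- f g = trans (∑-distrib-+ f (-_ ∘ g)) (cong₂ _+_ (refl {x = ∑ f}) (∑-neg g))

δ-refl : (u : Fin n) → δ u u ≡ 1ℤ
δ-refl u = cong ⟦_⟧ (dec-true (u Fin.≟ u) refl)

δ-≢ : {u v : Fin n} → u ≢ v → δ u v ≡ 0ℤ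
δ-≢ {u = u} {v} u≢v = cong ⟦_⟧ (dec-false (u Fin.≟ v) u≢v)

∑-δ : ∀ x (f : Fin n → ℤ) → ∑ (λ w → δ x w * f w) ≡ f x
∑-δ {ℕ.suc n} zero f = trans
  (cong₂ _+_ (refl {x = 1ℤ * f zero}) (∑-zero {n} {λ i → δ zero (suc i) * f (suc i)} λ i → refl))
  (trans (ℤ.+-identityʳ (1ℤ * f zero)) (ℤ.*-identityˡ (f zero)))
∑-δ {ℕ.suc n} (suc x) f =
  trans (cong₂ _+_ (refl {x = 0ℤ})
                   (refl {x = ∑ (λ i → δ x i * f (suc i))}))
        (trans (ℤ.+-identityˡ _) (∑-δ x (f ∘ suc)))

∑∑-* : ∀ {m} (f : Fin n → ℤ) (g : Fin m → ℤ) → ∑ (λ i → ∑ λ j → f i * g j) ≡ ∑ f * ∑ g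
∑∑-* f g = trans (sum-cong-≗ λ i → sym (*-distribˡ-sum (f i) g)) (sym (*-distribʳ-sum (∑ g) f))

term≤∑ : ∀ {f : Fin n → ℤ} → (∀ i → 0ℤ ≤ f i) → ∀ i → f i ≤ ∑ f
term≤∑ {f = f} 0≤f i = subst (_≤ ∑ f) (∑-δ i f) (∑-mono bnd)
  where
  bnd : ∀ j → δ i j * f j ≤ f j
  bnd j = subst (δ i j * f j ≤_) (ℤ.*-identityˡ (f j))
    (ℤ.*-monoʳ-≤-nonNeg (f j) {{ℤ.nonNegative (0≤f j)}} (⟦⟧≤1 (does (i Fin.≟ j))))

-- Sums over all permutations

transpose-ˡ : (i j : Fin n) → PC.transpose i j i ≡ j
transpose-ˡ i j rewrite dec-true (i Fin.≟ i) refl = refl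

transpose-ʳ : (i j : Fin n) → PC.transpose i j j ≡ i
transpose-ʳ i j with j Fin.≟ i
... | yes j≡i = j≡i
... | no  _ rewrite dec-true (j Fin.≟ j) refl = refl

transpose-≢ : {i j k : Fin n} → k ≢ i → k ≢ j → PC.transpose i j k ≡ k
transpose-≢ {i = i} {j} {k} k≢i k≢j
  rewrite dec-false (k Fin.≟ i) k≢i | dec-false (k Fin.≟ j) k≢j = refl

perm-injective : (τ : Permutation′ n) → Injective _≡_ _≡_ (τ ⟨$⟩ʳ_)
perm-injective τ {u} {v} eq =
  trans (sym (Perm.inverseˡ τ)) (trans (cong (τ ⟨$⟩ˡ_) eq) (Perm.inverseˡ τ))

-- Pigeonhole: if `v` were missed, punching it out of the codomain would give an injection into a
-- set with one element fewer.
injective⇒surjective : {f : Fin n → Fin n} → Injective _≡_ _≡_ f → ∀ v → ∃ λ u → f u ≡ v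
injective⇒surjective {ℕ.suc n} {f} inj v with Fin.any? (λ u → f u Fin.≟ v)
... | yes hit  = hit
... | no  miss = contradiction (Fin.injective⇒≤ punched) (ℕ.<-irrefl refl)
  where
  v≢f : ∀ u → v ≢ f u
  v≢f u v≡fu = miss (u , sym v≡fu)
  punched : Injective _≡_ _≡_ (λ u → Fin.punchOut (v≢f u))
  punched eq = inj (Fin.punchOut-injective (v≢f _) (v≢f _) eq)

injective⇒permutation : {f : Fin n → Fin n} → Injective _≡_ _≡_ f → Permutation′ n
injective⇒permutation {f = f} inj = Perm.permutation f
  (λ v → proj₁ (injective⇒surjective inj v))
  (λ v → proj₂ (injective⇒surjective inj v))
  (λ u → inj (proj₂ (injective⇒surjective inj (f u))))

injective? : (f : Fin n → Fin n) → Dec (∀ u v → f u ≡ f v → u ≡ v)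
injective? f = Fin.all? λ u → Fin.all? λ v → (f u Fin.≟ f v) →-dec (u Fin.≟ v)

∑-injective : (f : Fin n → ℤ) {π : Fin n → Fin n} → Injective _≡_ _≡_ π → ∑ (λ u → f (π u)) ≡ ∑ f
∑-injective f inj = sym (sum-permute f (injective⇒permutation inj))

funToFin-cong : ∀ {m} {f g : Fin m → Fin n} → f ≗ g → funToFin f ≡ funToFin g
funToFin-cong {m = ℕ.zero}  f≗g = refl
funToFin-cong {m = ℕ.suc m} f≗g = cong₂ Fin.combine (f≗g zero) (funToFin-cong (f≗g ∘ suc))

⟦does⟧-* : {P : Set} (P? : Dec P) {s t : ℤ} → (P → s ≤ t) → ⟦ does P? ⟧ * s ≤ ⟦ does P? ⟧ * t
⟦does⟧-* (yes p) {s} {t} s≤t = subst₂ _≤_ (sym (ℤ.*-identityˡ s)) (sym (ℤ.*-identityˡ t)) (s≤t p)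
⟦does⟧-* (no _)          s≤t = ℤ.≤-refl

⟦does⟧-cong : {P Q : Set} (P? : Dec P) (Q? : Dec Q) → (P → Q) → (Q → P) → ⟦ does P? ⟧ ≡ ⟦ does Q? ⟧
⟦does⟧-cong (yes _) (yes _) f g = refl
⟦does⟧-cong (no _)  (no _)  f g = refl
⟦does⟧-cong (yes p) (no ¬q) f g = contradiction (f p) ¬q
⟦does⟧-cong (no ¬p) (yes q) f g = contradiction (g q) ¬p

-- Functions Fin n → Fin n are enumerated by Fin (n ^ n); the weight keeps the permutations.
weight : Fin (n ℕ.^ n) → ℤ
weight {n} k = ⟦ does (injective? {n} (finToFun k)) ⟧

∑Sym : ∀ n → ((Fin n → Fin n) → ℤ) → ℤ
∑Sym n F = ∑ λ (k : Fin (n ℕ.^ n)) → weight {n} k * F (finToFun k)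

-- Reindexing goes through `funToFin`, whose decoding agrees with the original function only
-- pointwise, so summands must respect `≗`.
Extensional : ((Fin n → Fin n) → ℤ) → Set
Extensional F = ∀ {π ρ} → π ≗ ρ → F π ≡ F ρ

weight-nonneg : (k : Fin (n ℕ.^ n)) → 0ℤ ≤ weight {n} k
weight-nonneg {n} k = ⟦⟧-nonneg (does (injective? {n} (finToFun k)))

weighted-≤ : ∀ (k : Fin (n ℕ.^ n)) {s t} → (Injective _≡_ _≡_ (finToFun {n} {n} k) → s ≤ t) →
             weight {n} k * s ≤ weight {n} k * t
weighted-≤ {n} k {s} {t} s≤t = ⟦does⟧-* (injective? {n} (finToFun k)) λ inj → s≤t (inj _ _)

∑Sym-mono : {F G : (Fin n → Fin n) → ℤ} →
            (∀ π → Injective _≡_ _≡_ π → F π ≤ G π) → ∑Sym n F ≤ ∑Sym n G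
∑Sym-mono {n} F≤G = ∑-mono λ k → weighted-≤ {n} k (F≤G (finToFun k))

∑Sym-cong : {F G : (Fin n → Fin n) → ℤ} →
            (∀ π → Injective _≡_ _≡_ π → F π ≡ G π) → ∑Sym n F ≡ ∑Sym n G
∑Sym-cong {n} {F} {G} F≡G = ℤ.≤-antisym
  (∑Sym-mono {n} {F} {G} λ π inj → ℤ.≤-reflexive (F≡G π inj))
  (∑Sym-mono {n} {G} {F} λ π inj → ℤ.≤-reflexive (sym (F≡G π inj)))

∑Sym-+ : (F G : (Fin n → Fin n) → ℤ) → ∑Sym n (λ π → F π + G π) ≡ ∑Sym n F + ∑Sym n G
∑Sym-+ {n} F G = trans
  (sum-cong-≗ λ k → ℤ.*-distribˡ-+ (weight {n} k) (F (finToFun k)) (G (finToFun k)))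
  (∑-distrib-+ (λ k → weight {n} k * F (finToFun k)) (λ k → weight {n} k * G (finToFun k)))

∑Sym-* : ∀ c (F : (Fin n → Fin n) → ℤ) → ∑Sym n (λ π → c * F π) ≡ c * ∑Sym n F
∑Sym-* {n} c F = trans
  (sum-cong-≗ λ k → swap c (weight {n} k) (F (finToFun k)))
  (sym (*-distribˡ-sum c λ k → weight {n} k * F (finToFun k)))
  where
  swap : ∀ c w x → w * (c * x) ≡ c * (w * x)
  swap = solve-∀

∑Sym-∑ : ∀ {m} (F : Fin m → (Fin n → Fin n) → ℤ) →
         ∑Sym n (λ π → ∑ λ i → F i π) ≡ ∑ λ i → ∑Sym n (F i)
∑Sym-∑ {n} F = trans
  (sum-cong-≗ λ k → *-distribˡ-sum (weight {n} k) (λ i → F i (finToFun k)))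
  (∑-comm λ k i → weight {n} k * F i (finToFun k))

-- Precomposition with `τ` permutes the codes of all functions, with inverse given by `τ` reversed,
-- and it preserves and reflects injectivity, so the weights match.
∑Sym-permute : {F : (Fin n → Fin n) → ℤ} → Extensional F → (τ : Permutation′ n) →
               ∑Sym n (λ π → F (λ u → π (τ ⟨$⟩ʳ u))) ≡ ∑Sym n F
∑Sym-permute {n} {F} ext τ = sym (trans
  (sum-permute (λ k → weight {n} k * F (finToFun k)) reindex)
  (sum-cong-≗ λ k → cong₂ _*_ (weight-∘ k) (ext (finToFun-funToFin∘ k))))
  where
  act : Permutation′ n → Fin (n ℕ.^ n) → Fin (n ℕ.^ n)
  act σ k = funToFin (λ u → finToFun {n} {n} k (σ ⟨$⟩ʳ u))
  act-inverse : ∀ σ ρ → (∀ u → σ ⟨$⟩ʳ (ρ ⟨$⟩ʳ u) ≡ u) → ∀ k → act ρ (act σ k) ≡ k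
  act-inverse σ ρ inv k = trans
    (funToFin-cong λ u → trans (Fin.finToFun-funToFin (λ u → finToFun {n} {n} k (σ ⟨$⟩ʳ u)) (ρ ⟨$⟩ʳ u))
                              (cong (finToFun k) (inv u)))
    (Fin.funToFin-finToFin {n} {n} k)
  reindex : Permutation′ (n ℕ.^ n)
  reindex = Perm.permutation (act τ) (act (Perm.flip τ))
    (act-inverse (Perm.flip τ) τ (λ u → Perm.inverseˡ τ))
    (act-inverse τ (Perm.flip τ) (λ u → Perm.inverseʳ τ))
  finToFun-funToFin∘ : ∀ k → finToFun {n} {n} (act τ k) ≗ λ u → finToFun {n} {n} k (τ ⟨$⟩ʳ u)
  finToFun-funToFin∘ k = Fin.finToFun-funToFin (λ u → finToFun {n} {n} k (τ ⟨$⟩ʳ u))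
  weight-∘ : ∀ k → weight {n} (act τ k) ≡ weight {n} k
  weight-∘ k = ⟦does⟧-cong (injective? {n} (finToFun (act τ k))) (injective? {n} (finToFun k))
    (λ inj u v eq → subst₂ _≡_ (Perm.inverseʳ τ) (Perm.inverseʳ τ)
      (cong (τ ⟨$⟩ʳ_) (inj (τ ⟨$⟩ˡ u) (τ ⟨$⟩ˡ v) (trans (pull u) (trans eq (sym (pull v)))))))
    (λ inj u v eq → perm-injective τ
      (inj _ _ (trans (sym (finToFun-funToFin∘ k u)) (trans eq (finToFun-funToFin∘ k v)))))
    where
    pull : ∀ u → finToFun {n} {n} (act τ k) (τ ⟨$⟩ˡ u) ≡ finToFun k u
    pull u = trans (finToFun-funToFin∘ k _) (cong (finToFun k) (Perm.inverseʳ τ))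

∑Sym-1-pos : ∀ n → 0ℤ < ∑Sym n (λ _ → 1ℤ)
∑Sym-1-pos n = ℤ.<-≤-trans (ℤ.+<+ (ℕ.s≤s ℕ.z≤n))
  (ℤ.≤-trans (ℤ.≤-reflexive (sym weight-id))
    (term≤∑ (λ k → 0≤* (weight-nonneg {n} k) (0≤ℕ 1)) (funToFin {n} {n} id)))
  where
  weight-id : weight {n} (funToFin {n} {n} id) * 1ℤ ≡ 1ℤ
  weight-id = cong (λ b → ⟦ b ⟧ * 1ℤ) (dec-true (injective? {n} (finToFun (funToFin {n} {n} id)))
    λ u v eq → trans (sym (Fin.finToFun-funToFin id u)) (trans eq (Fin.finToFun-funToFin id v)))

-- First-moment method, with the witness found by search over all codes. If no permutation reached
-- `c`, integrality would give `F π ≤ c - 1` throughout, and the total would fall short because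
-- there is at least one permutation.
average≤max : ∀ {F : (Fin n → Fin n) → ℤ} c → c * ∑Sym n (λ _ → 1ℤ) ≤ ∑Sym n F →
              ∃ λ π → Injective _≡_ _≡_ π × c ≤ F π
average≤max {n} {F} c avg
  with Fin.any? (λ k → injective? {n} (finToFun k) ×-dec (c ℤ.≤? F (finToFun k)))
... | yes (k , inj , c≤F) = finToFun k , inj _ _ , c≤F
... | no  none = contradiction (ℤ.≤-trans avg below) (ℤ.<⇒≱ strict)
  where
  W = ∑Sym n (λ _ → 1ℤ)
  below : ∑Sym n F ≤ (c - 1ℤ) * W
  below = ℤ.≤-trans
    (∑-mono λ k → weighted-≤ {n} k {t = (c - 1ℤ) * 1ℤ} λ inj → ≤-pred (ℤ.≰⇒> λ c≤F → none (k , (λ _ _ → inj) , c≤F)))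
    (ℤ.≤-reflexive (∑Sym-* {n} (c - 1ℤ) (λ _ → 1ℤ)))
    where
    ≤-pred : ∀ {a} → a < c → a ≤ (c - 1ℤ) * 1ℤ
    ≤-pred {a} a<c = ≤-by (0≤- (ℤ.i<j⇒suc[i]≤j a<c)) (lem c a)
      where
      lem : ∀ c a → (c - 1ℤ) * 1ℤ - a ≡ c - (1ℤ + a)
      lem = solve-∀
  strict : (c - 1ℤ) * W < c * W
  strict = ℤ.*-monoʳ-<-pos W {{ℤ.positive (∑Sym-1-pos n)}} (ℤ.≤-<-trans (ℤ.≤-reflexive (ℤ.+-comm c (- 1ℤ))) (subst (- 1ℤ + c <_) (ℤ.+-identityˡ c) (ℤ.+-monoˡ-< c ℤ.-<+)))

-- Averages over ordered pairs and quadruples of vertices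

∑² : (Fin n → Fin n → ℤ) → ℤ
∑² F = ∑ λ u → ∑ λ v → F u v

∑⁴ : (Fin n → Fin n → Fin n → Fin n → ℤ) → ℤ
∑⁴ F = ∑² λ x y → ∑² λ p q → F x y p q

∑²-cong : {F G : Fin n → Fin n → ℤ} → (∀ u v → F u v ≡ G u v) → ∑² F ≡ ∑² G
∑²-cong F≡G = sum-cong-≗ λ u → sum-cong-≗ (F≡G u)

∑²-mono : {F G : Fin n → Fin n → ℤ} → (∀ u v → F u v ≤ G u v) → ∑² F ≤ ∑² G
∑²-mono F≤G = ∑-mono λ u → ∑-mono (F≤G u)

∑²-nonneg : {F : Fin n → Fin n → ℤ} → (∀ u v → 0ℤ ≤ F u v) → 0ℤ ≤ ∑² F
∑²-nonneg 0≤F = ∑-nonneg λ u → ∑-nonneg (0≤F u)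

∑²-+ : (F G : Fin n → Fin n → ℤ) → ∑² (λ u v → F u v + G u v) ≡ ∑² F + ∑² G
∑²-+ F G = trans (sum-cong-≗ λ u → ∑-distrib-+ (F u) (G u)) (∑-distrib-+ (λ u → ∑ (F u)) (λ u → ∑ (G u)))

∑²-distrib-- : (F G : Fin n → Fin n → ℤ) → ∑² (λ u v → F u v - G u v) ≡ ∑² F - ∑² G
∑²-distrib-- F G = trans (sum-cong-≗ λ u → ∑-distrib-- (F u) (G u)) (∑-distrib-- (λ u → ∑ (F u)) (λ u → ∑ (G u)))

∑²-const : ∀ c → ∑² {n} (λ _ _ → c) ≡ + n * (+ n * c)
∑²-const {n} c = trans (sum-cong-≗ {n} λ _ → ∑-const {n} c) (∑-const {n} (+ n * c))

∑²-injective : (F : Fin n → Fin n → ℤ) {π : Fin n → Fin n} → Injective _≡_ _≡_ π →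
               ∑² (λ u v → F (π u) (π v)) ≡ ∑² F
∑²-injective F {π} inj = trans
  (sum-cong-≗ λ u → ∑-injective (F (π u)) inj)
  (∑-injective (λ u → ∑ (F u)) inj)

∑Sym-∑² : (F : Fin n → Fin n → (Fin n → Fin n) → ℤ) →
          ∑Sym n (λ π → ∑² λ u v → F u v π) ≡ ∑² λ u v → ∑Sym n (F u v)
∑Sym-∑² {n} F = trans
  (∑Sym-∑ {n} λ u π → ∑ λ v → F u v π)
  (sum-cong-≗ λ u → ∑Sym-∑ {n} (F u))

Distinct : (x y p q : Fin n) → Set
Distinct x y p q = x ≢ y × (x ≢ p × y ≢ p) × (x ≢ q × y ≢ q × p ≢ q)

distinct? : (x y p q : Fin n) → Dec (Distinct x y p q)
distinct? x y p q = x ≢? y ×-dec ((x ≢? p ×-dec y ≢? p) ×-dec (x ≢? q ×-dec (y ≢? q ×-dec p ≢? q)))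
  where
  _≢?_ : (u v : Fin _) → Dec (u ≢ v)
  u ≢? v = ¬? (u Fin.≟ v)

-- Corrects `τ` at one more point: the transposition exchanges its value at `p` with `p′`, so other
-- points whose values were already right and differ from `p′` stay right.
redirect : Permutation′ n → (p p′ : Fin n) → Permutation′ n
redirect τ p p′ = τ ∘ₚ Perm.transpose (τ ⟨$⟩ʳ p) p′

redirect-hit : ∀ (τ : Permutation′ n) p p′ → redirect τ p p′ ⟨$⟩ʳ p ≡ p′
redirect-hit τ p p′ = transpose-ˡ (τ ⟨$⟩ʳ p) p′

redirect-keep : ∀ (τ : Permutation′ n) {p p′ x x′} → x ≢ p → x′ ≢ p′ → τ ⟨$⟩ʳ x ≡ x′ →
                redirect τ p p′ ⟨$⟩ʳ x ≡ x′
redirect-keep τ x≢p x′≢p′ refl = transpose-≢ (x≢p ∘ perm-injective τ) x′≢p′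

2-transitive : {x y x′ y′ : Fin n} → x ≢ y → x′ ≢ y′ →
               ∃ λ (τ : Permutation′ n) → τ ⟨$⟩ʳ x ≡ x′ × τ ⟨$⟩ʳ y ≡ y′
2-transitive {x = x} {y} {x′} {y′} x≢y x′≢y′ =
  redirect τ y y′ , redirect-keep τ x≢y x′≢y′ (redirect-hit Perm.id x x′) , redirect-hit τ y y′
  where τ = redirect Perm.id x x′

4-transitive : {x y p q x′ y′ p′ q′ : Fin n} → Distinct x y p q → Distinct x′ y′ p′ q′ →
               ∃ λ (τ : Permutation′ n) →
                 (τ ⟨$⟩ʳ x ≡ x′ × τ ⟨$⟩ʳ y ≡ y′) × (τ ⟨$⟩ʳ p ≡ p′ × τ ⟨$⟩ʳ q ≡ q′)
4-transitive {x = x} {y} {p} {q} {x′} {y′} {p′} {q′}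
  (x≢y , (x≢p , y≢p) , (x≢q , y≢q , p≢q)) (x≢y′ , (x≢p′ , y≢p′) , (x≢q′ , y≢q′ , p≢q′))
  with 2-transitive x≢y x≢y′
... | τ , τx , τy =
  redirect τ′ q q′ ,
  (redirect-keep τ′ x≢q x≢q′ (redirect-keep τ x≢p x≢p′ τx) ,
   redirect-keep τ′ y≢q y≢q′ (redirect-keep τ y≢p y≢p′ τy)) ,
  (redirect-keep τ′ p≢q p≢q′ (redirect-hit τ p p′) , redirect-hit τ′ q q′)
  where τ′ = redirect τ p p′

-- The sum of `F` over all pairs is unchanged by any `π`. Summing it over permutations and
-- exchanging sums leaves one term per ordered pair, and all n (n - 1) off-diagonal terms agree by
-- 2-transitivity.
∑Sym-pair : ∀ (F : Fin n → Fin n → ℤ) → (∀ u → F u u ≡ 0ℤ) → ∀ {u v} → u ≢ v →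
            ∑² F * ∑Sym n (λ _ → 1ℤ) ≡ + n * (+ n - 1ℤ) * ∑Sym n (λ π → F (π u) (π v))
∑Sym-pair {n} F diag {u} {v} u≢v = begin
  ∑² F * W                               ≡⟨ ∑Sym-* {n} (∑² F) (λ _ → 1ℤ) ⟨
  ∑Sym n (λ _ → ∑² F * 1ℤ)               ≡⟨ ∑Sym-cong {n} (λ π inj → trans (ℤ.*-identityʳ (∑² F)) (sym (∑²-injective F inj))) ⟩
  ∑Sym n (λ π → ∑² λ a b → F (π a) (π b)) ≡⟨ ∑Sym-∑² (λ a b π → F (π a) (π b)) ⟩
  ∑² (λ a b → ∑Sym n (λ π → F (π a) (π b))) ≡⟨ ∑²-cong same ⟩
  ∑² {n} (λ a b → (1ℤ - δ a b) * φ)      ≡⟨ sum-cong-≗ {n} row ⟩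
  ∑ {n} (λ a → (+ n - 1ℤ) * φ)           ≡⟨ ∑-const {n} ((+ n - 1ℤ) * φ) ⟩
  + n * ((+ n - 1ℤ) * φ)                 ≡⟨ ℤ.*-assoc (+ n) (+ n - 1ℤ) φ ⟨
  + n * (+ n - 1ℤ) * φ                   ∎
  where
  open ≡-Reasoning
  W = ∑Sym n (λ _ → 1ℤ)
  φ = ∑Sym n (λ π → F (π u) (π v))
  same : ∀ a b → ∑Sym n (λ π → F (π a) (π b)) ≡ (1ℤ - δ a b) * φ
  same a b with a Fin.≟ b
  ... | yes refl = trans (∑Sym-cong {n} {λ π → F (π a) (π a)} {λ _ → 0ℤ * 0ℤ} λ π _ → diag (π a)) (∑Sym-* {n} 0ℤ (λ _ → 0ℤ))
  ... | no  a≢b with 2-transitive u≢v a≢b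
  ...   | τ , refl , refl = trans
    (∑Sym-permute {n} {λ π → F (π u) (π v)} (λ π≗ρ → cong₂ F (π≗ρ u) (π≗ρ v)) τ)
    (sym (ℤ.*-identityˡ φ))
  row : ∀ a → ∑ (λ b → (1ℤ - δ a b) * φ) ≡ (+ n - 1ℤ) * φ
  row a = begin
    ∑ (λ b → (1ℤ - δ a b) * φ)       ≡⟨ sum-cong-≗ (λ b → lem (δ a b) φ) ⟩
    ∑ (λ b → φ - δ a b * φ)          ≡⟨ ∑-distrib-- (λ _ → φ) (λ b → δ a b * φ) ⟩
    ∑ {n} (λ _ → φ) - ∑ (λ b → δ a b * φ) ≡⟨ cong₂ _-_ (∑-const {n} φ) (∑-δ a (λ _ → φ)) ⟩
    + n * φ - φ                      ≡⟨ lem′ (+ n) φ ⟩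
    (+ n - 1ℤ) * φ                   ∎
    where
    lem : ∀ d x → (1ℤ - d) * x ≡ x - d * x
    lem = solve-∀
    lem′ : ∀ k x → k * x - x ≡ (k - 1ℤ) * x
    lem′ = solve-∀

-- The same double count with 4-transitivity. Degenerate quadruples contribute nothing but are
-- charged the common value, which trades n (n - 1) (n - 2) (n - 3) for n⁴ and an equality for an
-- inequality.
∑Sym-quadruple : ∀ (F : Fin n → Fin n → Fin n → Fin n → ℤ) → (∀ x y p q → 0ℤ ≤ F x y p q) →
                 (∀ x y p q → ¬ Distinct x y p q → F x y p q ≡ 0ℤ) →
                 ∀ {x y p q} → Distinct x y p q →
                 ∑⁴ F * ∑Sym n (λ _ → 1ℤ) ≤
                 + n * (+ n * (+ n * (+ n * ∑Sym n (λ π → F (π x) (π y) (π p) (π q)))))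
∑Sym-quadruple {n} F 0≤F vanish {x} {y} {p} {q} dist = begin
  ∑⁴ F * W                    ≡⟨ ∑Sym-* {n} (∑⁴ F) (λ _ → 1ℤ) ⟨
  ∑Sym n (λ _ → ∑⁴ F * 1ℤ)    ≡⟨ ∑Sym-cong {n} (λ π inj → trans (ℤ.*-identityʳ (∑⁴ F)) (sym (moved inj))) ⟩
  ∑Sym n (λ π → ∑⁴ λ a b c d → F (π a) (π b) (π c) (π d))
    ≡⟨ ∑Sym-∑² (λ a b π → ∑² λ c d → F (π a) (π b) (π c) (π d)) ⟩
  ∑² (λ a b → ∑Sym n (λ π → ∑² λ c d → F (π a) (π b) (π c) (π d)))
    ≡⟨ ∑²-cong (λ a b → ∑Sym-∑² (λ c d π → F (π a) (π b) (π c) (π d))) ⟩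
  ∑⁴ (λ a b c d → ∑Sym n (λ π → F (π a) (π b) (π c) (π d)))
    ≤⟨ ∑²-mono {n} (λ a b → ∑²-mono {n} (bound′ a b)) ⟩
  ∑⁴ {n} (λ _ _ _ _ → φ)      ≡⟨ trans (∑²-cong {n} λ _ _ → ∑²-const {n} φ) (∑²-const {n} (+ n * (+ n * φ))) ⟩
  + n * (+ n * (+ n * (+ n * φ))) ∎
  where
  open ℤ.≤-Reasoning
  W = ∑Sym n (λ _ → 1ℤ)
  φ = ∑Sym n (λ π → F (π x) (π y) (π p) (π q))
  0≤φ : 0ℤ ≤ φ
  0≤φ = ∑-nonneg λ k → 0≤* (weight-nonneg {n} k) (0≤F _ _ _ _)
  moved : {π : Fin n → Fin n} → Injective _≡_ _≡_ π →
          ∑⁴ (λ a b c d → F (π a) (π b) (π c) (π d)) ≡ ∑⁴ F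
  moved {π} inj = trans (∑²-cong λ a b → ∑²-injective (F (π a) (π b)) inj)
                        (∑²-injective (λ a b → ∑² (F a b)) inj)
  bound′ : ∀ a b c d → ∑Sym n (λ π → F (π a) (π b) (π c) (π d)) ≤ φ
  bound′ a b c d with distinct? a b c d
  ... | yes dist′ with 4-transitive dist dist′
  ...   | τ , (refl , refl) , (refl , refl) = ℤ.≤-reflexive
    (∑Sym-permute {n} {λ π → F (π x) (π y) (π p) (π q)}
      (λ π≗ρ → trans (cong₂ (λ s t → F s t _ _) (π≗ρ x) (π≗ρ y)) (cong₂ (F _ _) (π≗ρ p) (π≗ρ q))) τ)
  bound′ a b c d | no ¬dist = ℤ.≤-trans (ℤ.≤-reflexive (trans
    (∑Sym-cong {n} {λ π → F (π a) (π b) (π c) (π d)} {λ _ → 0ℤ * 0ℤ}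
      λ π inj → vanish _ _ _ _ λ (e , (f , g) , (h , i , j)) →
        ¬dist (e ∘ cong π , (f ∘ cong π , g ∘ cong π) , (h ∘ cong π , i ∘ cong π , j ∘ cong π)))
    (∑Sym-* {n} 0ℤ (λ _ → 0ℤ)))) 0≤φ

-- Swapping two vertices

-- Composed with the transposition, `φ` is changed by `φ y - φ x` times the difference of the
-- indicators of `x` and `y`, so only two terms of the sum move.
∑-transpose : ∀ (x y : Fin n) (φ ψ : Fin n → ℤ) →
              ∑ (λ v → φ (PC.transpose x y v) * ψ v) ≡
              ∑ (λ v → φ v * ψ v) + (φ y - φ x) * (ψ x - ψ y)
∑-transpose x y φ ψ = begin
  ∑ (λ v → φ (PC.transpose x y v) * ψ v)
    ≡⟨ sum-cong-≗ (λ v → trans (cong (_* ψ v) (moved v)) (expand (φ v) (φ y - φ x) (δ x v) (δ y v) (ψ v))) ⟩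
  ∑ (λ v → φ v * ψ v + (φ y - φ x) * (δ x v * ψ v - δ y v * ψ v))
    ≡⟨ ∑-distrib-+ (λ v → φ v * ψ v) (λ v → (φ y - φ x) * (δ x v * ψ v - δ y v * ψ v)) ⟩
  ∑ (λ v → φ v * ψ v) + ∑ (λ v → (φ y - φ x) * (δ x v * ψ v - δ y v * ψ v))
    ≡⟨ cong₂ _+_ (refl {x = ∑ (λ v → φ v * ψ v)}) (begin
      ∑ (λ v → (φ y - φ x) * (δ x v * ψ v - δ y v * ψ v))
        ≡⟨ *-distribˡ-sum (φ y - φ x) (λ v → δ x v * ψ v - δ y v * ψ v) ⟨
      (φ y - φ x) * ∑ (λ v → δ x v * ψ v - δ y v * ψ v)
        ≡⟨ cong ((φ y - φ x) *_) (∑-distrib-- (λ v → δ x v * ψ v) (λ v → δ y v * ψ v)) ⟩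
      (φ y - φ x) * (∑ (λ v → δ x v * ψ v) - ∑ (λ v → δ y v * ψ v))
        ≡⟨ cong ((φ y - φ x) *_) (cong₂ _-_ (∑-δ x ψ) (∑-δ y ψ)) ⟩
      (φ y - φ x) * (ψ x - ψ y) ∎) ⟩
  ∑ (λ v → φ v * ψ v) + (φ y - φ x) * (ψ x - ψ y) ∎
  where
  open ≡-Reasoning
  expand : ∀ a b c d e → (a + b * (c - d)) * e ≡ a * e + b * (c * e - d * e)
  expand = solve-∀
  at-x : ∀ a b → b ≡ a + (b - a) * (1ℤ - 0ℤ)
  at-x = solve-∀
  at-y : ∀ a b → a ≡ b + (b - a) * (0ℤ - 1ℤ)
  at-y = solve-∀
  away : ∀ a b c → c ≡ c + (b - a) * (0ℤ - 0ℤ)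
  away = solve-∀
  none : ∀ a c → c ≡ c + (a - a) * (1ℤ - 1ℤ)
  none = solve-∀
  moved : ∀ v → φ (PC.transpose x y v) ≡ φ v + (φ y - φ x) * (δ x v - δ y v)
  moved v = go (v Fin.≟ x) (v Fin.≟ y)
    where
    go : Dec (v ≡ x) → Dec (v ≡ y) → φ (PC.transpose x y v) ≡ φ v + (φ y - φ x) * (δ x v - δ y v)
    go (yes refl) (yes refl) rewrite transpose-ˡ v v | δ-refl v = none (φ v) (φ v)
    go (yes refl) (no v≢y) rewrite transpose-ˡ v y | δ-refl v | δ-≢ (v≢y ∘ sym) = at-x (φ v) (φ y)
    go (no v≢x) (yes refl) rewrite transpose-ʳ x v | δ-refl v | δ-≢ (v≢x ∘ sym) = at-y (φ x) (φ v)
    go (no v≢x) (no v≢y)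
      rewrite transpose-≢ v≢x v≢y | δ-≢ (v≢x ∘ sym) | δ-≢ (v≢y ∘ sym) = away (φ x) (φ y) (φ v)

ι : Graph V → V → V → ℤ
ι G u v = ⟦ adj G u v ⟧

ι-sym : ∀ (G : Graph V) u v → ι G u v ≡ ι G v u
ι-sym G u v = cong ⟦_⟧ (adj-sym G u v)

ι-irrefl : ∀ (G : Graph V) v → ι G v v ≡ 0ℤ
ι-irrefl G v = cong ⟦_⟧ (adj-irrefl G v)

swapped : (Fin n → Fin n) → Fin n → Fin n → Fin n → Fin n
swapped π x y v = π (PC.transpose x y v)

swapped-injective : ∀ {π : Fin n → Fin n} x y → Injective _≡_ _≡_ π → Injective _≡_ _≡_ (swapped π x y)
swapped-injective x y inj eq = perm-injective (Perm.transpose x y) (inj eq)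

module _ (A G : Graph (Fin n)) where

  -- Ordered pairs are summed, so this is twice e(π).
  agreement : (Fin n → Fin n) → ℤ
  agreement π = ∑² λ u v → ι G (π u) (π v) * ι A u v

  contrast : (Fin n → Fin n) → (x y w : Fin n) → ℤ
  contrast π x y w = ι G (π y) (π w) - ι G (π x) (π w)

  -- This is D(π), arranged so that vertices adjacent to both `x` and `y`, or to neither, drop out.
  gain : (Fin n → Fin n) → (x y : Fin n) → ℤ
  gain π x y = ∑ λ w → contrast π x y w * (ι A x w - ι A y w)

  gain-cong : ∀ x y {π ρ} → π ≗ ρ → gain π x y ≡ gain ρ x y
  gain-cong x y π≗ρ = sum-cong-≗ λ w → cong (_* (ι A x w - ι A y w))
    (cong₂ _-_ (cong₂ (ι G) (π≗ρ y) (π≗ρ w)) (cong₂ (ι G) (π≗ρ x) (π≗ρ w)))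

  -- The transposition is undone in one coordinate at a time, and each coordinate contributes one
  -- `gain`. The cross term of doing both vanishes because `A` has neither loops nor the edge xy.
  agreement-swapped : ∀ π {x y} → ι A x y ≡ 0ℤ →
                      agreement (swapped π x y) ≡ agreement π + + 2 * gain π x y
  agreement-swapped π {x} {y} xy = begin
    ∑ (λ u → ∑ λ v → f (τ u) (τ v) * ι A u v)
      ≡⟨ sum-cong-≗ (λ u → ∑-transpose x y (f (τ u)) (ι A u)) ⟩
    ∑ (λ u → ∑ (λ v → f (τ u) v * ι A u v) + k (τ u) * b u)
      ≡⟨ ∑-distrib-+ (λ u → ∑ (λ v → f (τ u) v * ι A u v)) (λ u → k (τ u) * b u) ⟩
    ∑ (λ u → ∑ (λ v → f (τ u) v * ι A u v)) + ∑ (λ u → k (τ u) * b u)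
      ≡⟨ cong₂ _+_ firstHalf secondHalf ⟩
    (agreement π + gain π x y) + gain π x y
      ≡⟨ lem (agreement π) (gain π x y) ⟩
    agreement π + + 2 * gain π x y ∎
    where
    open ≡-Reasoning
    τ = PC.transpose x y
    f : Fin _ → Fin _ → ℤ
    f u v = ι G (π u) (π v)
    k b : Fin _ → ℤ
    k u = f u y - f u x
    b u = ι A u x - ι A u y
    lem : ∀ a c → (a + c) + c ≡ a + + 2 * c
    lem = solve-∀
    firstHalf : ∑ (λ u → ∑ (λ v → f (τ u) v * ι A u v)) ≡ agreement π + gain π x y
    firstHalf = begin
      ∑ (λ u → ∑ (λ v → f (τ u) v * ι A u v))
        ≡⟨ ∑-comm (λ u v → f (τ u) v * ι A u v) ⟩
      ∑ (λ v → ∑ (λ u → f (τ u) v * ι A u v))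
        ≡⟨ sum-cong-≗ (λ v → ∑-transpose x y (λ u → f u v) (λ u → ι A u v)) ⟩
      ∑ (λ v → ∑ (λ u → f u v * ι A u v) + contrast π x y v * (ι A x v - ι A y v))
        ≡⟨ ∑-distrib-+ (λ v → ∑ (λ u → f u v * ι A u v)) (λ v → contrast π x y v * (ι A x v - ι A y v)) ⟩
      ∑ (λ v → ∑ (λ u → f u v * ι A u v)) + gain π x y
        ≡⟨ cong (_+ gain π x y) (∑-comm (λ v u → f u v * ι A u v)) ⟩
      agreement π + gain π x y ∎
    bx : b x ≡ 0ℤ
    bx = cong₂ _-_ (ι-irrefl A x) xy
    by′ : b y ≡ 0ℤ
    by′ = cong₂ _-_ (trans (ι-sym A y x) xy) (ι-irrefl A y)
    kill : ∀ c → c * (0ℤ - 0ℤ) ≡ 0ℤ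
    kill = solve-∀
    secondHalf : ∑ (λ u → k (τ u) * b u) ≡ gain π x y
    secondHalf = begin
      ∑ (λ u → k (τ u) * b u)
        ≡⟨ ∑-transpose x y k b ⟩
      ∑ (λ u → k u * b u) + (k y - k x) * (b x - b y)
        ≡⟨ cong₂ _+_ (sum-cong-≗ λ u → cong₂ _*_
             (cong₂ _-_ (ι-sym G (π u) (π y)) (ι-sym G (π u) (π x)))
             (cong₂ _-_ (ι-sym A u x) (ι-sym A u y)))
             (trans (cong₂ (λ s t → (k y - k x) * (s - t)) bx by′) (kill (k y - k x))) ⟩
      gain π x y + 0ℤ
        ≡⟨ ℤ.+-identityʳ (gain π x y) ⟩
      gain π x y ∎

  -- As (p q) fixes `x` and `y`, it acts only on the summation variable `w`.
  gain-elsewhere : ∀ π {x y p q} → x ≢ p → x ≢ q → y ≢ p → y ≢ q →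
                   gain (swapped π p q) x y ≡
                   gain π x y + (contrast π x y q - contrast π x y p) *
                                ((ι A x p - ι A y p) - (ι A x q - ι A y q))
  gain-elsewhere π {x} {y} {p} {q} x≢p x≢q y≢p y≢q = trans
    (sum-cong-≗ λ w → cong₂ (λ s t → (ι G (π s) (π (PC.transpose p q w)) - ι G (π t) (π (PC.transpose p q w)))
                                      * (ι A x w - ι A y w))
                            (transpose-≢ y≢p y≢q) (transpose-≢ x≢p x≢q))
    (∑-transpose p q (contrast π x y) (λ w → ι A x w - ι A y w))

  -- Swapping `x` and `y` negates the contrast. What remains is a transposition of the summation
  -- variable, harmless because the weight `α` vanishes at both `x` and `y`.
  gain-swapped : ∀ π {x y} → ι A x y ≡ 0ℤ → gain (swapped π x y) x y ≡ - gain π x y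
  gain-swapped π {x} {y} xy = begin
    gain (swapped π x y) x y
      ≡⟨ sum-cong-≗ (λ w → trans
           (cong₂ (λ s t → (ι G (π s) (π (τ w)) - ι G (π t) (π (τ w))) * α w)
                  (transpose-ʳ x y) (transpose-ˡ x y))
           (flip (ι G (π x) (π (τ w))) (ι G (π y) (π (τ w))) (α w))) ⟩
    ∑ (λ w → - (contrast π x y (τ w) * α w))
      ≡⟨ ∑-neg (λ w → contrast π x y (τ w) * α w) ⟩
    - ∑ (λ w → contrast π x y (τ w) * α w)
      ≡⟨ cong -_ (∑-transpose x y (contrast π x y) α) ⟩
    - (gain π x y + c * (α x - α y))
      ≡⟨ cong -_ (cong₂ (λ s t → gain π x y + c * (s - t))
           (cong₂ _-_ (ι-irrefl A x) (trans (ι-sym A y x) xy)) (cong₂ _-_ xy (ι-irrefl A y))) ⟩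
    - (gain π x y + c * (0ℤ - 0ℤ))
      ≡⟨ cong -_ (kill (gain π x y) c) ⟩
    - gain π x y ∎
    where
    open ≡-Reasoning
    τ = PC.transpose x y
    α : Fin _ → ℤ
    α w = ι A x w - ι A y w
    c = contrast π x y y - contrast π x y x
    flip : ∀ a b d → (a - b) * d ≡ - ((b - a) * d)
    flip = solve-∀
    kill : ∀ a d → a + d * (0ℤ - 0ℤ) ≡ a
    kill = solve-∀

abs-split : ∀ i → (i ⊔ 0ℤ) + ((- i) ⊔ 0ℤ) ≡ + ∣ i ∣
abs-split (+ ℕ.zero)    = refl
abs-split (+ ℕ.suc k)   = ℤ.+-identityʳ (+ ℕ.suc k)
abs-split ℤ.-[1+ k ]    = ℤ.+-identityˡ (+ ℕ.suc k)

abs-shift : ∀ i t → + 2 * + ∣ t ∣ ≤ + ∣ i ∣ + + ∣ i + + 2 * t ∣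
abs-shift i t = begin
  + 2 * + ∣ t ∣               ≡⟨ ℤ.pos-* 2 ∣ t ∣ ⟨
  + (2 ℕ.* ∣ t ∣)             ≡⟨ cong +_ (ℤ.abs-* (+ 2) t) ⟨
  + ∣ + 2 * t ∣               ≡⟨ cong (λ z → + ∣ z ∣) (lem i t) ⟩
  + ∣ (i + + 2 * t) - i ∣     ≤⟨ +≤+ (ℤ.∣i-j∣≤∣i∣+∣j∣ (i + + 2 * t) i) ⟩
  + (∣ i + + 2 * t ∣ ℕ.+ ∣ i ∣) ≡⟨ cong +_ (ℕ.+-comm ∣ i + + 2 * t ∣ ∣ i ∣) ⟩
  + (∣ i ∣ ℕ.+ ∣ i + + 2 * t ∣) ≡⟨ ℤ.pos-+ ∣ i ∣ ∣ i + + 2 * t ∣ ⟩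
  + ∣ i ∣ + + ∣ i + + 2 * t ∣ ∎
  where
  open ℤ.≤-Reasoning
  lem : ∀ a b → + 2 * b ≡ (a + + 2 * b) - a
  lem = solve-∀

-- Gadgets and their independent swaps

NonAdj : Graph V → V → V → Set
NonAdj G u v = adj G u v ≡ false

nonAdj-sym : ∀ (G : Graph V) {u v} → NonAdj G u v → NonAdj G v u
nonAdj-sym G {u} {v} uv = trans (adj-sym G v u) uv

record Gadget (A : Graph V) : Set where
  field
    x y p q : V
    x≢y : x ≢ y
    xy : NonAdj A x y
    xp : adj A x p ≡ true
    yq : adj A y q ≡ true
    yp : NonAdj A y p
    xq : NonAdj A x q

  distinct : x ≢ p × x ≢ q × y ≢ p × y ≢ q × p ≢ q
  distinct = separates (adj-irrefl A x) xp , separates (nonAdj-sym A xy) yq , separates xy xp ,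
             separates (adj-irrefl A y) yq , λ p≡q → clash (trans (cong (adj A y) p≡q) yq) yp
    where
    clash : ∀ {b : Bool} → b ≡ true → ¬ b ≡ false
    clash refl ()
    separates : ∀ {u v w} → NonAdj A u v → adj A u w ≡ true → v ≢ w
    separates uv uw refl = clash uw uv

Apart : Graph V → V → V → Set
Apart A u v = u ≢ v × NonAdj A u v

-- Swapping the gadget g does not touch the neighbourhoods that the gadget h looks at.
Separated : {A : Graph V} → Gadget A → Gadget A → Set
Separated {A = A} g h = (Apart A (x h) (x g) × Apart A (x h) (y g)) × (Apart A (y h) (x g) × Apart A (y h) (y g))
  where open Gadget

module _ (A G : Graph (Fin n)) where

  open Gadget

  upside : Gadget A → (Fin n → Fin n) → ℤ
  upside g π = gain A G π (x g) (y g) ⊔ 0ℤ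

  upsides : List (Gadget A) → (Fin n → Fin n) → ℤ
  upsides gs π = foldr (λ g s → upside g π + s) 0ℤ gs

  -- In `gain-elsewhere`, applied to the transposition of the ends of `g`, the correction carries a
  -- factor built from adjacencies in `A` between ends of `h` and ends of `g`, all of them zero by
  -- separation.
  upsides-swapped : ∀ g gs π → All (Separated g) gs →
                    upsides gs (swapped π (x g) (y g)) ≡ upsides gs π
  upsides-swapped g []       π []         = refl
  upsides-swapped g (h ∷ gs) π ((((xx , xx′) , (xy , xy′)) , ((yx , yx′) , (yy , yy′))) ∷ rest) =
    cong₂ (λ s t → s ⊔ 0ℤ + t) unaffected (upsides-swapped g gs π rest)
    where
    kill : ∀ a c → a + c * ((0ℤ - 0ℤ) - (0ℤ - 0ℤ)) ≡ a
    kill = solve-∀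
    unaffected : gain A G (swapped π (x g) (y g)) (x h) (y h) ≡ gain A G π (x h) (y h)
    unaffected = trans
      (gain-elsewhere A G π xx xy yx yy)
      (trans (cong₂ (λ s t → gain A G π (x h) (y h) + (contrast A G π (x h) (y h) (y g) - contrast A G π (x h) (y h) (x g)) * (s - t))
               (cong₂ (λ b c → ⟦ b ⟧ - ⟦ c ⟧) xx′ yx′) (cong₂ (λ b c → ⟦ b ⟧ - ⟦ c ⟧) xy′ yy′))
             (kill (gain A G π (x h) (y h)) (contrast A G π (x h) (y h) (y g) - contrast A G π (x h) (y h) (x g))))

  -- Greedy: `g` is swapped if its gain is nonnegative and left alone otherwise. Either way the
  -- upsides of the remaining gadgets keep their values, so the gains add up.
  improve : ∀ gs → AllPairs Separated gs → ∀ π → Injective _≡_ _≡_ π →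
            ∃ λ ρ → Injective _≡_ _≡_ ρ × agreement A G π + + 2 * upsides gs π ≤ agreement A G ρ
  improve []       []         π inj = π , inj , ℤ.≤-reflexive (ℤ.+-identityʳ (agreement A G π))
  improve (g ∷ gs) (sep ∷ ap) π inj with ℤ.≤-total 0ℤ (gain A G π (x g) (y g))
  ... | inj₁ 0≤d with improve gs ap (swapped π (x g) (y g)) (swapped-injective (x g) (y g) inj)
  ...   | ρ , ρ-inj , le = ρ , ρ-inj , (begin
    a + + 2 * (d ⊔ 0ℤ + upsides gs π)   ≡⟨ cong (λ z → a + + 2 * (z + upsides gs π)) (ℤ.i≥j⇒i⊔j≡i 0≤d) ⟩
    a + + 2 * (d + upsides gs π)        ≡⟨ lem a d (upsides gs π) ⟩
    (a + + 2 * d) + + 2 * upsides gs π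
      ≡⟨ cong₂ (λ s t → s + + 2 * t) (sym (agreement-swapped A G π (cong ⟦_⟧ (xy g)))) (sym (upsides-swapped g gs π sep)) ⟩
    agreement A G (swapped π (x g) (y g)) + + 2 * upsides gs (swapped π (x g) (y g)) ≤⟨ le ⟩
    agreement A G ρ ∎)
    where
    open ℤ.≤-Reasoning
    a = agreement A G π
    d = gain A G π (x g) (y g)
    lem : ∀ a d u → a + + 2 * (d + u) ≡ (a + + 2 * d) + + 2 * u
    lem = solve-∀
  improve (g ∷ gs) (sep ∷ ap) π inj | inj₂ d≤0 with improve gs ap π inj
  ... | ρ , ρ-inj , le = ρ , ρ-inj , subst (λ z → agreement A G π + + 2 * z ≤ agreement A G ρ)
    (sym (trans (cong (_+ upsides gs π) (ℤ.i≤j⇒i⊔j≡j d≤0)) (ℤ.+-identityˡ (upsides gs π)))) le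

-- The alternating sum of `G` along the 4-cycle y q x p, in absolute value. Degenerate quadruples
-- are set to zero, as `∑Sym-quadruple` demands.
discrepancy : Graph (Fin n) → (x y p q : Fin n) → ℤ
discrepancy G x y p q = ⟦ does (distinct? x y p q) ⟧ * + ∣ (ι G y q - ι G x q) - (ι G y p - ι G x p) ∣

discrepancy-nonneg : ∀ (G : Graph (Fin n)) x y p q → 0ℤ ≤ discrepancy G x y p q
discrepancy-nonneg G x y p q = 0≤* (⟦⟧-nonneg (does (distinct? x y p q))) (0≤ℕ _)

totalDiscrepancy : Graph (Fin n) → ℤ
totalDiscrepancy G = ∑⁴ (discrepancy G)

-- Average gain and average agreement

W : ℕ → ℤ
W n = ∑Sym n (λ _ → 1ℤ)

module _ (A G : Graph (Fin n)) where

  open Gadget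

  upside-average : ∀ (g : Gadget A) →
    totalDiscrepancy G * W n ≤ + n * (+ n * (+ n * (+ n * (+ 2 * ∑Sym n (upside A G g)))))
  upside-average g = ℤ.≤-trans
    (∑Sym-quadruple (discrepancy G) (discrepancy-nonneg G) vanish
      (x≢y g , (x≢p , y≢p) , (x≢q , y≢q , p≢q)))
    (n*-mono (n*-mono (n*-mono (n*-mono bound′))))
    where
    n*-mono : ∀ {a b} → a ≤ b → + n * a ≤ + n * b
    n*-mono = ℤ.*-monoˡ-≤-nonNeg (+ n)
    x≢p = proj₁ (distinct g)
    x≢q = proj₁ (proj₂ (distinct g))
    y≢p = proj₁ (proj₂ (proj₂ (distinct g)))
    y≢q = proj₁ (proj₂ (proj₂ (proj₂ (distinct g))))
    p≢q = proj₂ (proj₂ (proj₂ (proj₂ (distinct g))))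
    vanish : ∀ a b c d → ¬ Distinct a b c d → discrepancy G a b c d ≡ 0ℤ
    vanish a b c d ¬dist =
      cong (λ t → ⟦ t ⟧ * + ∣ (ι G b d - ι G a d) - (ι G b c - ι G a c) ∣) (dec-false (distinct? a b c d) ¬dist)
    D D′ t : (Fin n → Fin n) → ℤ
    D  π = gain A G π (x g) (y g)
    D′ π = gain A G (swapped π (p g) (q g)) (x g) (y g)
    t  π = contrast A G π (x g) (y g) (q g) - contrast A G π (x g) (y g) (p g)
    -- The neighbours are private: the weight in `gain` is 1 at `p` and -1 at `q`, whence the factor
    -- 2.
    D′-D : ∀ π → D′ π ≡ D π + + 2 * t π
    D′-D π = trans (gain-elsewhere A G π x≢p x≢q y≢p y≢q) (trans
      (cong₂ (λ b c → D π + t π * (b - c))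
        (cong₂ (λ b c → ⟦ b ⟧ - ⟦ c ⟧) (xp g) (yp g)) (cong₂ (λ b c → ⟦ b ⟧ - ⟦ c ⟧) (xq g) (yq g)))
      (cong (λ z → D π + z) (ℤ.*-comm (t π) (+ 2))))
    abs-D-ext : Extensional (λ π → + ∣ D π ∣)
    abs-D-ext π≗ρ = cong (λ z → + ∣ z ∣) (gain-cong A G (x g) (y g) π≗ρ)
    upside-ext : Extensional (upside A G g)
    upside-ext π≗ρ = cong (_⊔ 0ℤ) (gain-cong A G (x g) (y g) π≗ρ)
    double : ∀ a → a + a ≡ + 2 * a
    double = solve-∀
    -- `D` is odd under (x y), so its positive and negative parts have equal sums.
    abs≡2upside : ∑Sym n (λ π → + ∣ D π ∣) ≡ + 2 * ∑Sym n (upside A G g)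
    abs≡2upside = begin
      ∑Sym n (λ π → + ∣ D π ∣)
        ≡⟨ ∑Sym-cong {n} (λ π _ → trans (sym (abs-split (D π)))
             (cong (λ z → (D π ⊔ 0ℤ) + (z ⊔ 0ℤ)) (sym (gain-swapped A G π (cong ⟦_⟧ (xy g)))))) ⟩
      ∑Sym n (λ π → upside A G g π + upside A G g (swapped π (x g) (y g)))
        ≡⟨ ∑Sym-+ {n} (upside A G g) (λ π → upside A G g (swapped π (x g) (y g))) ⟩
      S + ∑Sym n (λ π → upside A G g (swapped π (x g) (y g)))
        ≡⟨ cong (λ z → S + z) (∑Sym-permute {n} {upside A G g} upside-ext (Perm.transpose (x g) (y g))) ⟩
      S + S
        ≡⟨ double S ⟩
      + 2 * S ∎
      where
      open ≡-Reasoning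
      S = ∑Sym n (upside A G g)
    -- Reindexing by (p q) shows that the absolute values of `D` and `D′` have equal sums, while
    -- pointwise they add up to at least |D′ - D| = 2 |t|.
    2t≤2abs : + 2 * ∑Sym n (λ π → + ∣ t π ∣) ≤ + 2 * ∑Sym n (λ π → + ∣ D π ∣)
    2t≤2abs = begin
      + 2 * ∑Sym n (λ π → + ∣ t π ∣)
        ≡⟨ ∑Sym-* {n} (+ 2) (λ π → + ∣ t π ∣) ⟨
      ∑Sym n (λ π → + 2 * + ∣ t π ∣)
        ≤⟨ ∑Sym-mono {n} (λ π _ → subst (λ z → + 2 * + ∣ t π ∣ ≤ + ∣ D π ∣ + + ∣ z ∣) (sym (D′-D π)) (abs-shift (D π) (t π))) ⟩
      ∑Sym n (λ π → + ∣ D π ∣ + + ∣ D′ π ∣)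
        ≡⟨ ∑Sym-+ {n} (λ π → + ∣ D π ∣) (λ π → + ∣ D′ π ∣) ⟩
      S + ∑Sym n (λ π → + ∣ D′ π ∣)
        ≡⟨ cong (λ z → S + z) (∑Sym-permute {n} {λ π → + ∣ D π ∣} abs-D-ext (Perm.transpose (p g) (q g))) ⟩
      S + S
        ≡⟨ double S ⟩
      + 2 * S ∎
      where
      open ℤ.≤-Reasoning
      S = ∑Sym n (λ π → + ∣ D π ∣)
    bound′ : ∑Sym n (λ π → discrepancy G (π (x g)) (π (y g)) (π (p g)) (π (q g))) ≤ + 2 * ∑Sym n (upside A G g)
    bound′ = begin
      ∑Sym n (λ π → discrepancy G (π (x g)) (π (y g)) (π (p g)) (π (q g)))
        ≤⟨ ∑Sym-mono {n} (λ π _ → ℤ.≤-trans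
             (ℤ.*-monoʳ-≤-nonNeg (+ ∣ t π ∣) (⟦⟧≤1 (does (distinct? (π (x g)) (π (y g)) (π (p g)) (π (q g))))))
             (ℤ.≤-reflexive (ℤ.*-identityˡ (+ ∣ t π ∣)))) ⟩
      ∑Sym n (λ π → + ∣ t π ∣)
        ≤⟨ ℤ.*-cancelˡ-≤-pos _ _ (+ 2) 2t≤2abs ⟩
      ∑Sym n (λ π → + ∣ D π ∣)
        ≡⟨ abs≡2upside ⟩
      + 2 * ∑Sym n (upside A G g) ∎
      where open ℤ.≤-Reasoning

degreeSum : Graph (Fin n) → ℤ
degreeSum G = ∑² (ι G)

degreeSum-nonneg : (G : Graph (Fin n)) → 0ℤ ≤ degreeSum G
degreeSum-nonneg G = ∑²-nonneg λ u v → ⟦⟧-nonneg (adj G u v)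

module _ (A G : Graph (Fin n)) where

  private
    N = + n

  agreement-average : ∑Sym n (agreement A G) * (N * (N - 1ℤ)) ≡ degreeSum A * (degreeSum G * W n)
  agreement-average = begin
    ∑Sym n (agreement A G) * c
      ≡⟨ cong (_* c) (∑Sym-∑² (λ u v π → ι G (π u) (π v) * ι A u v)) ⟩
    ∑² (λ u v → ∑Sym n (λ π → ι G (π u) (π v) * ι A u v)) * c
      ≡⟨ *-distribʳ-sum c (λ u → ∑ λ v → ∑Sym n (λ π → ι G (π u) (π v) * ι A u v)) ⟩
    ∑ (λ u → ∑ (λ v → ∑Sym n (λ π → ι G (π u) (π v) * ι A u v)) * c)
      ≡⟨ sum-cong-≗ (λ u → *-distribʳ-sum c (λ v → ∑Sym n (λ π → ι G (π u) (π v) * ι A u v))) ⟩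
    ∑² (λ u v → ∑Sym n (λ π → ι G (π u) (π v) * ι A u v) * c)
      ≡⟨ ∑²-cong pair ⟩
    ∑² (λ u v → ι A u v * MW)
      ≡⟨ sum-cong-≗ (λ u → *-distribʳ-sum MW (ι A u)) ⟨
    ∑ (λ u → ∑ (ι A u) * MW)
      ≡⟨ *-distribʳ-sum MW (λ u → ∑ (ι A u)) ⟨
    degreeSum A * MW ∎
    where
    open ≡-Reasoning
    c = N * (N - 1ℤ)
    MW = degreeSum G * W n
    assoc′ : ∀ a s k → (a * s) * k ≡ a * (k * s)
    assoc′ = solve-∀
    pair : ∀ u v → ∑Sym n (λ π → ι G (π u) (π v) * ι A u v) * c ≡ ι A u v * MW
    pair u v = begin
      ∑Sym n (λ π → ι G (π u) (π v) * ι A u v) * c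
        ≡⟨ cong (_* c) (∑Sym-cong {n} λ π _ → ℤ.*-comm (ι G (π u) (π v)) (ι A u v)) ⟩
      ∑Sym n (λ π → ι A u v * ι G (π u) (π v)) * c
        ≡⟨ cong (_* c) (∑Sym-* {n} (ι A u v) (λ π → ι G (π u) (π v))) ⟩
      (ι A u v * ∑Sym n (λ π → ι G (π u) (π v))) * c
        ≡⟨ assoc′ (ι A u v) (∑Sym n (λ π → ι G (π u) (π v))) c ⟩
      ι A u v * (c * ∑Sym n (λ π → ι G (π u) (π v)))
        ≡⟨ offDiagonal (u Fin.≟ v) ⟩
      ι A u v * MW ∎
      where
      offDiagonal : Dec (u ≡ v) → ι A u v * (c * ∑Sym n (λ π → ι G (π u) (π v))) ≡ ι A u v * MW
      offDiagonal (yes refl) rewrite adj-irrefl A u = refl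
      offDiagonal (no u≢v) = cong (ι A u v *_) (sym (∑Sym-pair (ι G) (ι-irrefl G) u≢v))

  upsides-average : ∀ gs → + length gs * totalDiscrepancy G * W n ≤
                    N * (N * (N * (N * (+ 2 * ∑Sym n (upsides A G gs)))))
  upsides-average [] = ℤ.≤-reflexive (sym (trans
    (cong (λ z → N * (N * (N * (N * (+ 2 * z))))) (∑Sym-* {n} 0ℤ (λ _ → 0ℤ))) (zeros N)))
    where
    zeros : ∀ N → N * (N * (N * (N * (+ 2 * 0ℤ)))) ≡ 0ℤ
    zeros = solve-∀
  upsides-average (g ∷ gs) = begin
    + (1 ℕ.+ length gs) * Q * W n
      ≡⟨ cong (λ z → z * Q * W n) (ℤ.pos-+ 1 (length gs)) ⟩
    (1ℤ + + length gs) * Q * W n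
      ≡⟨ lem (+ length gs) Q (W n) ⟩
    Q * W n + + length gs * Q * W n
      ≤⟨ ℤ.+-mono-≤ (upside-average A G g) (upsides-average gs) ⟩
    N * (N * (N * (N * (+ 2 * s)))) + N * (N * (N * (N * (+ 2 * t))))
      ≡⟨ lem′ N s t ⟩
    N * (N * (N * (N * (+ 2 * (s + t)))))
      ≡⟨ cong (λ z → N * (N * (N * (N * (+ 2 * z))))) (∑Sym-+ {n} (upside A G g) (upsides A G gs)) ⟨
    N * (N * (N * (N * (+ 2 * ∑Sym n (upsides A G (g ∷ gs)))))) ∎
    where
    open ℤ.≤-Reasoning
    Q = totalDiscrepancy G
    s = ∑Sym n (upside A G g)
    t = ∑Sym n (upsides A G gs)
    lem : ∀ k q w → (1ℤ + k) * q * w ≡ q * w + k * q * w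
    lem = solve-∀
    lem′ : ∀ N s t → N * (N * (N * (N * (+ 2 * s)))) + N * (N * (N * (N * (+ 2 * t)))) ≡
                     N * (N * (N * (N * (+ 2 * (s + t)))))
    lem′ = solve-∀

degreeSum-trivial : (G : Graph (Fin n)) → ¬ 2 ℕ.≤ n → degreeSum G ≡ 0ℤ
degreeSum-trivial {ℕ.zero}  G _ = refl
degreeSum-trivial {ℕ.suc ℕ.zero} G _ = cong (λ b → ⟦ b ⟧ + 0ℤ + 0ℤ) (adj-irrefl G zero)
degreeSum-trivial {ℕ.suc (ℕ.suc n)} G small = contradiction (ℕ.s≤s (ℕ.s≤s ℕ.z≤n)) small

agreement-average-≥ : ∀ (A G : Graph (Fin n)) → + 2 * (+ n - 1ℤ) ≤ degreeSum A →
                      + 2 * degreeSum G * W n ≤ + n * ∑Sym n (agreement A G)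
agreement-average-≥ {n} A G many with 2 ℕ.≤? n
-- The factor n - 1 that is cancelled below is positive only for n ≥ 2; smaller graphs have no
-- edges.
... | no small = ℤ.≤-trans
  (ℤ.≤-reflexive (trans (cong (λ m → + 2 * m * W n) (degreeSum-trivial G small)) (ℤ.*-zeroˡ (W n))))
  (0≤* (0≤ℕ n) (∑-nonneg λ k → 0≤* (weight-nonneg {n} k) (∑²-nonneg λ u v →
    0≤* (⟦⟧-nonneg (adj G (finToFun k u) (finToFun k v))) (⟦⟧-nonneg (adj A u v)))))
... | yes 2≤n = ℤ.*-cancelˡ-≤-pos _ _ N-1 {{ℤ.positive 0<N-1}} (begin
  N-1 * (+ 2 * degreeSum G * W n)
    ≡⟨ lem N-1 (degreeSum G) (W n) ⟩
  (+ 2 * N-1) * (degreeSum G * W n)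
    ≤⟨ ℤ.*-monoʳ-≤-nonNeg (degreeSum G * W n) {{ℤ.nonNegative 0≤MW}} many ⟩
  degreeSum A * (degreeSum G * W n)
    ≡⟨ agreement-average A G ⟨
  ∑Sym n (agreement A G) * (+ n * N-1)
    ≡⟨ lem′ (∑Sym n (agreement A G)) (+ n) N-1 ⟩
  N-1 * (+ n * ∑Sym n (agreement A G)) ∎)
  where
  open ℤ.≤-Reasoning
  N-1 = + n - 1ℤ
  0<N-1 : 0ℤ < N-1
  0<N-1 = ℤ.<-≤-trans (ℤ.+<+ (ℕ.s≤s ℕ.z≤n)) (ℤ.+-monoˡ-≤ (- 1ℤ) (+≤+ 2≤n))
  0≤MW : 0ℤ ≤ degreeSum G * W n
  0≤MW = 0≤* (degreeSum-nonneg G) (ℤ.<⇒≤ (∑Sym-1-pos n))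
  lem : ∀ k m w → k * (+ 2 * m * w) ≡ (+ 2 * k) * (m * w)
  lem = solve-∀
  lem′ : ∀ s m k → s * (m * k) ≡ k * (m * s)
  lem′ = solve-∀

fourfold-mono : ∀ k {a b} → a ≤ b → + k * (+ k * (+ k * (+ k * a))) ≤ + k * (+ k * (+ k * (+ k * b)))
fourfold-mono k {a} {b} a≤b = *-mono (*-mono (*-mono (*-mono a≤b)))
  where
  *-mono : ∀ {c d} → c ≤ d → + k * c ≤ + k * d
  *-mono = ℤ.*-monoˡ-≤-nonNeg (+ k)

combine-averages : ∀ k m q w s t → + 2 * m * w ≤ + k * s → q * w ≤ + k * (+ k * (+ k * (+ k * (+ 2 * t)))) →
                   (+ 2 * m * (+ k * + k * + k) + q) * w ≤ + k * (+ k * (+ k * (+ k * (s + + 2 * t))))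
combine-averages k m q w s t low high =
  ≤-by (0≤+ (0≤* (0≤ℕ k) (0≤* (0≤ℕ k) (0≤* (0≤ℕ k) (0≤- low)))) (0≤- high)) (lem (+ k) m q w s t)
  where
  lem : ∀ N m q w s t → N * (N * (N * (N * (s + + 2 * t)))) - (+ 2 * m * (N * N * N) + q) * w ≡
        N * (N * (N * (N * s - + 2 * m * w))) + (N * (N * (N * (N * (+ 2 * t)))) - q * w)
  lem = solve-∀

∑Sym-fourfold : ∀ (a b : (Fin n → Fin n) → ℤ) c →
                ∑Sym n (λ π → c * (c * (c * (c * (a π + + 2 * b π))))) ≡
                c * (c * (c * (c * (∑Sym n a + + 2 * ∑Sym n b))))
∑Sym-fourfold {n} a b c = begin
  ∑Sym n (λ π → c * (c * (c * (c * s π)))) ≡⟨ ∑Sym-* {n} c (λ π → c * (c * (c * s π))) ⟩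
  c * ∑Sym n (λ π → c * (c * (c * s π)))   ≡⟨ cong (c *_) (∑Sym-* {n} c (λ π → c * (c * s π))) ⟩
  c * (c * ∑Sym n (λ π → c * (c * s π)))   ≡⟨ cong (λ z → c * (c * z)) (∑Sym-* {n} c (λ π → c * s π)) ⟩
  c * (c * (c * ∑Sym n (λ π → c * s π)))   ≡⟨ cong (λ z → c * (c * (c * z))) (∑Sym-* {n} c s) ⟩
  c * (c * (c * (c * ∑Sym n s)))
    ≡⟨ cong (λ z → c * (c * (c * (c * z)))) (∑Sym-+ {n} a (λ π → + 2 * b π)) ⟩
  c * (c * (c * (c * (∑Sym n a + ∑Sym n (λ π → + 2 * b π)))))
    ≡⟨ cong (λ z → c * (c * (c * (c * (∑Sym n a + z))))) (∑Sym-* {n} (+ 2) b) ⟩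
  c * (c * (c * (c * (∑Sym n a + + 2 * ∑Sym n b)))) ∎
  where
  open ≡-Reasoning
  s : (Fin n → Fin n) → ℤ
  s π = a π + + 2 * b π

good-embedding : ∀ (A G : Graph (Fin n)) → + 2 * (+ n - 1ℤ) ≤ degreeSum A →
                 ∀ gs → AllPairs (Separated {A = A}) gs →
                 ∃ λ ρ → Injective _≡_ _≡_ ρ ×
                   + 2 * degreeSum G * (+ n * + n * + n) + + length gs * totalDiscrepancy G ≤
                   + n * (+ n * (+ n * (+ n * agreement A G ρ)))
good-embedding {n} A G many gs ap = finish (average≤max {n} {F} c avg)
  where
  c : ℤ
  c = + 2 * degreeSum G * (+ n * + n * + n) + + length gs * totalDiscrepancy G
  F : (Fin n → Fin n) → ℤ
  F π = + n * (+ n * (+ n * (+ n * (agreement A G π + + 2 * upsides A G gs π))))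
  avg : c * ∑Sym n (λ _ → 1ℤ) ≤ ∑Sym n F
  avg = subst (c * W n ≤_) (sym (∑Sym-fourfold {n} (agreement A G) (upsides A G gs) (+ n)))
    (combine-averages n (degreeSum G) (+ length gs * totalDiscrepancy G) (W n)
      (∑Sym n (agreement A G)) (∑Sym n (upsides A G gs))
      (agreement-average-≥ A G many) (upsides-average A G gs))
  finish : (∃ λ π → Injective _≡_ _≡_ π × c ≤ F π) →
           ∃ λ ρ → Injective _≡_ _≡_ ρ × c ≤ + n * (+ n * (+ n * (+ n * agreement A G ρ)))
  finish (π , inj , c≤F) = let ρ , ρ-inj , le = improve A G gs ap π inj in
    ρ , ρ-inj , ℤ.≤-trans c≤F
      (fourfold-mono n {agreement A G π + + 2 * upsides A G gs π} {agreement A G ρ} le)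

-- Trees

T⇒≡true : ∀ {b} → T b → b ≡ true
T⇒≡true {true} _ = refl

≡true⇒T : ∀ {b} → b ≡ true → T b
≡true⇒T refl = _

crossing : ∀ (A : Graph V) (S : V → Bool) {u v} → Star (Adj A) u v → S u ≡ true → S v ≡ false →
           ∃₂ λ a b → S a ≡ true × S b ≡ false × adj A a b ≡ true
crossing A S ε su sv = contradiction (trans (sym su) sv) λ ()
crossing A S (_◅_ {j = w} uw path) su sv with S w in sw
... | true  = crossing A S path sw sv
... | false = _ , w , su , sw , T⇒≡true uw

closed⇒everything : ∀ (A : Graph V) (P : V → Set) → (∀ {u v} → adj A u v ≡ true → P u → P v) →
                    ∀ {u v} → Star (Adj A) u v → P u → P v
closed⇒everything A P step ε            pu = pu
closed⇒everything A P step (uw ◅ path) pu = closed⇒everything A P step path (step (T⇒≡true uw) pu)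

module _ (A : Graph (Fin n)) where

  inner : (Fin n → Bool) → ℤ
  inner S = ∑² λ u v → ⟦ S u ⟧ * ⟦ S v ⟧ * ι A u v

  insert : (Fin n → Bool) → Fin n → Fin n → Bool
  insert S b v = S v Bool.∨ does (b Fin.≟ v)

  insert-⟦⟧ : ∀ S {b} → S b ≡ false → ∀ v → ⟦ insert S b v ⟧ ≡ ⟦ S v ⟧ + δ b v
  insert-⟦⟧ S {b} sb v with b Fin.≟ v
  ... | yes refl rewrite sb = refl
  ... | no  _ with S v
  ...   | true  = refl
  ...   | false = refl

  insert-size : ∀ S {b} → S b ≡ false → ∑ (λ v → ⟦ insert S b v ⟧) ≡ ∑ (λ v → ⟦ S v ⟧) + 1ℤ
  insert-size S {b} sb = trans (sum-cong-≗ (insert-⟦⟧ S sb)) (trans (∑-distrib-+ (λ v → ⟦ S v ⟧) (δ b))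
    (cong (λ z → ∑ (λ v → ⟦ S v ⟧) + z) (trans (sum-cong-≗ λ v → sym (ℤ.*-identityʳ (δ b v))) (∑-δ b (λ _ → 1ℤ)))))

  insert-inner : ∀ S {a b} → S a ≡ true → S b ≡ false → adj A a b ≡ true →
                 inner S + + 2 ≤ inner (insert S b)
  insert-inner S {a} {b} sa sb ab = begin
    inner S + + 2
      ≤⟨ ℤ.+-monoʳ-≤ (inner S) (ℤ.+-mono-≤ new new) ⟩
    inner S + (∑ g + ∑ g)
      ≡⟨ cong (λ z → inner S + z) (cong₂ _+_ row column) ⟩
    inner S + (∑² (λ u v → δ b u * (s v * ι A v u)) + ∑² (λ u v → δ b v * (s u * ι A u v)))
      ≡⟨ split ⟨
    ∑² (λ u v → s u * s v * ι A u v + (δ b u * (s v * ι A v u) + δ b v * (s u * ι A u v)))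
      ≤⟨ ∑²-mono pointwise ⟩
    inner (insert S b) ∎
    where
    open ℤ.≤-Reasoning
    s g : Fin n → ℤ
    s v = ⟦ S v ⟧
    g v = s v * ι A v b
    new : 1ℤ ≤ ∑ g
    new = subst (_≤ ∑ g) (cong₂ (λ c d → ⟦ c ⟧ * ⟦ d ⟧) sa ab)
      (term≤∑ (λ v → 0≤* (⟦⟧-nonneg (S v)) (⟦⟧-nonneg (adj A v b))) a)
    row : ∑ g ≡ ∑² (λ u v → δ b u * (s v * ι A v u))
    row = sym (trans (sum-cong-≗ λ u → sym (*-distribˡ-sum (δ b u) (λ v → s v * ι A v u)))
                     (∑-δ b (λ u → ∑ λ v → s v * ι A v u)))
    column : ∑ g ≡ ∑² (λ u v → δ b v * (s u * ι A u v))
    column = sym (sum-cong-≗ λ u → ∑-δ b (λ v → s u * ι A u v))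
    split : ∑² (λ u v → s u * s v * ι A u v + (δ b u * (s v * ι A v u) + δ b v * (s u * ι A u v))) ≡
            inner S + (∑² (λ u v → δ b u * (s v * ι A v u)) + ∑² (λ u v → δ b v * (s u * ι A u v)))
    split = trans (∑²-+ (λ u v → s u * s v * ι A u v) (λ u v → δ b u * (s v * ι A v u) + δ b v * (s u * ι A u v)))
      (cong (λ z → inner S + z) (∑²-+ (λ u v → δ b u * (s v * ι A v u)) (λ u v → δ b v * (s u * ι A u v))))
    expand : ∀ s d t e x y → (s + d) * (t + e) * x - (s * t * x + (d * (t * y) + e * (s * x))) ≡
             d * e * x + d * t * (x - y)
    expand = solve-∀
    tidy : ∀ c d t y → c + d * t * (y - y) ≡ c
    tidy = solve-∀
    pointwise : ∀ u v → s u * s v * ι A u v + (δ b u * (s v * ι A v u) + δ b v * (s u * ι A u v)) ≤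
                ⟦ insert S b u ⟧ * ⟦ insert S b v ⟧ * ι A u v
    pointwise u v rewrite insert-⟦⟧ S sb u | insert-⟦⟧ S sb v =
      ≤-by (0≤* (0≤* (⟦⟧-nonneg (does (b Fin.≟ u))) (⟦⟧-nonneg (does (b Fin.≟ v)))) (⟦⟧-nonneg (adj A u v)))
        (trans (expand (s u) (δ b u) (s v) (δ b v) (ι A u v) (ι A v u))
          (trans (cong (λ z → δ b u * δ b v * ι A u v + δ b u * s v * (ι A u v - z)) (ι-sym A v u))
            (tidy (δ b u * δ b v * ι A u v) (δ b u) (s v) (ι A u v))))

  -- Connectedness supplies an edge leaving the current set as long as a vertex is missing. Each
  -- added vertex thus brings at least one edge, counted in both orders by `inner`. The resulting n
  -- - 1 edges are what the average agreement requires.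
  grow : (∀ u v → Star (Adj A) u v) → Fin n → ∀ k → ℕ.suc k ℕ.≤ n →
         ∃ λ (S : Fin n → Bool) → (∃ λ r → S r ≡ true) × ∑ (λ v → ⟦ S v ⟧) ≡ + k + 1ℤ × + 2 * + k ≤ inner S
  grow connected root ℕ.zero _ =
    (λ v → does (root Fin.≟ v)) ,
    (root , dec-true (root Fin.≟ root) refl) ,
    trans (sum-cong-≗ λ v → sym (ℤ.*-identityʳ (δ root v))) (∑-δ root (λ _ → 1ℤ)) ,
    ∑²-nonneg λ u v → 0≤* (0≤* (⟦⟧-nonneg (does (root Fin.≟ u))) (⟦⟧-nonneg (does (root Fin.≟ v)))) (⟦⟧-nonneg (adj A u v))
  grow connected root (ℕ.suc k) 2+k≤n with grow connected root k (ℕ.<⇒≤ 2+k≤n)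
  ... | S , (r , sr) , size , many with Fin.any? (λ v → S v Bool.≟ false)
  ...   | no  full = contradiction 2+k≤n (ℕ.<⇒≱ (ℕ.≤-reflexive (cong ℕ.suc (ℤ.+-injective n≡k+1))))
    where
    S≡true : ∀ v → S v ≡ true
    S≡true v with S v in sv
    ... | true  = refl
    ... | false = contradiction (v , sv) full
    n≡k+1 : + n ≡ + (ℕ.suc k)
    n≡k+1 = begin
      + n                        ≡⟨ ℤ.*-identityʳ (+ n) ⟨
      + n * 1ℤ                   ≡⟨ ∑-const {n} 1ℤ ⟨
      ∑ {n} (λ _ → 1ℤ)           ≡⟨ sum-cong-≗ (λ v → cong ⟦_⟧ (S≡true v)) ⟨
      ∑ (λ v → ⟦ S v ⟧)          ≡⟨ size ⟩
      + k + 1ℤ                   ≡⟨ ℤ.+-comm (+ k) 1ℤ ⟩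
      1ℤ + + k                   ∎
      where open ≡-Reasoning
  ...   | yes (w , sw) with crossing A S (connected r w) sr sw
  ...     | a , b , sa , sb , ab =
    insert S b ,
    (r , cong (Bool._∨ does (b Fin.≟ r)) sr) ,
    trans (insert-size S sb) (trans (cong (_+ 1ℤ) size) (cong (_+ 1ℤ) (ℤ.+-comm (+ k) 1ℤ))) ,
    ℤ.≤-trans (ℤ.≤-reflexive (lem (+ k))) (ℤ.≤-trans (ℤ.+-monoˡ-≤ (+ 2) many) (insert-inner S sa sb ab))
    where
    lem : ∀ k → + 2 * (1ℤ + k) ≡ + 2 * k + + 2
    lem = solve-∀

  connected-degreeSum : IsTree A → + 2 * (+ n - 1ℤ) ≤ degreeSum A
  connected-degreeSum tree with grow connected nonempty (ℕ.pred n) (ℕ.≤-reflexive (ℕ.suc-pred n {{Fin.nonZeroIndex nonempty}}))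
    where open IsTree tree
  ... | S , _ , _ , many = ℤ.≤-trans (ℤ.≤-reflexive (cong (+ 2 *_) pred-n)) (ℤ.≤-trans many (∑²-mono λ u v →
    ℤ.≤-trans (ℤ.*-monoʳ-≤-nonNeg (ι A u v) {{ℤ.nonNegative (⟦⟧-nonneg (adj A u v))}}
                (*-mono-≤ {c = ⟦ S v ⟧} (⟦⟧-nonneg (S u)) (0≤ℕ 1) (⟦⟧≤1 (S u)) (⟦⟧≤1 (S v))))
              (ℤ.≤-reflexive (ℤ.*-identityˡ (ι A u v)))))
    where
    open IsTree tree
    pred-n : + n - 1ℤ ≡ + ℕ.pred n
    pred-n = trans (cong (λ m → + m - 1ℤ) (sym (ℕ.suc-pred n {{Fin.nonZeroIndex nonempty}}))) (lem (+ ℕ.pred n))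
      where
      lem : ∀ k → (1ℤ + k) - 1ℤ ≡ k
      lem = solve-∀

≢true⇒false : ∀ {b} → b ≢ true → b ≡ false
≢true⇒false {true}  b≢true = contradiction refl b≢true
≢true⇒false {false} _      = refl

-- Long paths and two-colourings of acyclic graphs

module _ (A : Graph (Fin n)) where

  open DecMembership (Fin._≟_ {n}) using (_∈?_)

  adj⇒≢ : ∀ {u v} → adj A u v ≡ true → u ≢ v
  adj⇒≢ {u} uv refl = contradiction (trans (sym uv) (adj-irrefl A u)) λ ()

  adj-flip : ∀ {u v} → adj A u v ≡ true → adj A v u ≡ true
  adj-flip {u} {v} uv = trans (adj-sym A v u) uv

  -- With all vertices in `xs` this says that `v` is not a leaf; with smaller `xs` it guides the
  -- removal of vertices in `twoColouring`.
  Branching : List (Fin n) → Fin n → Set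
  Branching xs v = ∃₂ λ p q → p ≢ q × (p ∈ xs × q ∈ xs) × (adj A v p ≡ true × adj A v q ≡ true)

  branching? : ∀ xs v → Dec (Branching xs v)
  branching? xs v = Fin.any? λ p → Fin.any? λ q →
    ¬? (p Fin.≟ q) ×-dec ((p ∈? xs ×-dec q ∈? xs) ×-dec ((adj A v p Bool.≟ true) ×-dec (adj A v q Bool.≟ true)))

  -- Paths grow at `vertex zero`, so the predecessor of the growing end is `vertex (suc zero)`.
  record Path (xs : List (Fin n)) (l : ℕ) : Set where
    field
      vertex   : Fin (ℕ.suc l) → Fin n
      distinct : Injective _≡_ _≡_ vertex
      step     : ∀ (j : Fin l) → Adj A (vertex (Fin.inject₁ j)) (vertex (suc j))
      inside   : ∀ j → vertex j ∈ xs

  closePath : ∀ {xs l} (P : Path xs l) (i : Fin (ℕ.suc l)) → 2 ℕ.≤ Fin.toℕ i →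
              Adj A (Path.vertex P i) (Path.vertex P zero) → Cycle A
  closePath {l = l} P i 2≤i back = record
    { m        = Fin.toℕ i
    ; 2≤m      = 2≤i
    ; vertex   = λ j → vertex (Fin.inject≤ j i<)
    ; distinct = λ eq → Fin.inject≤-injective i< i< _ _ (distinct eq)
    ; step     = λ j → subst (λ k → Adj A (vertex k) (vertex (Fin.inject≤ (suc j) i<)))
                   (Fin.toℕ-injective (trans (Fin.toℕ-inject₁ (Fin.inject≤ j i≤))
                     (trans (Fin.toℕ-inject≤ j i≤) (sym (trans (Fin.toℕ-inject≤ (Fin.inject₁ j) i<) (Fin.toℕ-inject₁ j))))))
                   (step (Fin.inject≤ j i≤))
    ; close    = subst (λ k → Adj A (vertex k) (vertex zero))
                   (Fin.toℕ-injective (sym (trans (Fin.toℕ-inject≤ (Fin.fromℕ (Fin.toℕ i)) i<) (Fin.toℕ-fromℕ (Fin.toℕ i)))))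
                   back
    }
    where
    open Path P
    i< : Fin.toℕ i ℕ.< ℕ.suc l
    i< = Fin.toℕ<n i
    i≤ : Fin.toℕ i ℕ.≤ l
    i≤ = ℕ.s≤s⁻¹ i<

  extendPath : ∀ {xs l} (P : Path xs l) {w} → w ∈ xs → adj A (Path.vertex P zero) w ≡ true →
               (∀ j → Path.vertex P j ≢ w) → Path xs (ℕ.suc l)
  extendPath {xs} {l} P {w} w∈xs vw fresh = record
    { vertex   = vertex′
    ; distinct = distinct′
    ; step     = step′
    ; inside   = λ { zero → w∈xs ; (suc j) → inside j }
    }
    where
    open Path P
    vertex′ : Fin (ℕ.suc (ℕ.suc l)) → Fin n
    vertex′ zero    = w
    vertex′ (suc j) = vertex j
    distinct′ : Injective _≡_ _≡_ vertex′
    distinct′ {zero}  {zero}  _  = refl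
    distinct′ {zero}  {suc k} eq = contradiction (sym eq) (fresh k)
    distinct′ {suc j} {zero}  eq = contradiction eq (fresh j)
    distinct′ {suc j} {suc k} eq = cong suc (distinct eq)
    step′ : ∀ (j : Fin (ℕ.suc l)) → Adj A (vertex′ (Fin.inject₁ j)) (vertex′ (suc j))
    step′ zero    = ≡true⇒T (adj-flip vw)
    step′ (suc j) = step j

  module _ (acyclic : ¬ Cycle A) where

    -- When every vertex of `xs` has two neighbours there, the end of a path has one other than its
    -- predecessor. A fresh neighbour extends the path; one already on the path would close a cycle.
    longPath : ∀ xs {r} → r ∈ xs → (∀ {v} → v ∈ xs → Branching xs v) → ∀ l → Path xs l
    longPath xs {r} r∈xs branch ℕ.zero = record
      { vertex   = λ _ → r
      ; distinct = λ { {zero} {zero} _ → refl }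
      ; step     = λ ()
      ; inside   = λ _ → r∈xs
      }
    longPath xs {r} r∈xs branch (ℕ.suc l) = next l (longPath xs r∈xs branch l)
      where
      avoiding : ∀ {v} u → v ∈ xs → ∃ λ w → w ∈ xs × adj A v w ≡ true × u ≢ w
      avoiding u v∈xs with branch v∈xs
      ... | p , q , p≢q , (p∈xs , q∈xs) , (vp , vq) with u Fin.≟ p
      ...   | yes refl = q , q∈xs , vq , p≢q
      ...   | no  u≢p  = p , p∈xs , vp , u≢p
      next : ∀ l → Path xs l → Path xs (ℕ.suc l)
      -- A path with one vertex has no predecessor to avoid; `r` is a dummy.
      next ℕ.zero P with avoiding r (Path.inside P zero)
      ... | w , w∈xs , vw , _ = extendPath P w∈xs vw λ { zero → adj⇒≢ vw }
      next (ℕ.suc l) P with avoiding (Path.vertex P (suc zero)) (Path.inside P zero)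
      ... | w , w∈xs , vw , v₁≢w with Fin.any? (λ j → Path.vertex P j Fin.≟ w)
      ...   | no  fresh = extendPath P w∈xs vw λ j eq → fresh (j , eq)
      ...   | yes (zero , eq) = contradiction eq (adj⇒≢ vw)
      ...   | yes (suc zero , eq) = contradiction eq v₁≢w
      ...   | yes (i@(suc (suc j)) , refl) =
        contradiction (closePath P i (ℕ.s≤s (ℕ.s≤s ℕ.z≤n)) (≡true⇒T (adj-flip vw))) acyclic

    -- Otherwise there would be a path with n + 1 distinct vertices.
    nonBranching : ∀ xs {r} → r ∈ xs → ∃ λ v → v ∈ xs × ¬ Branching xs v
    nonBranching xs {r} r∈xs with All.all? (branching? xs) xs
    ... | no ¬all = find (All.¬All⇒Any¬ (branching? xs) xs ¬all)
    ... | yes all = contradiction (Fin.injective⇒≤ (Path.distinct (longPath xs r∈xs (All.lookup all) n))) (ℕ.<-irrefl refl)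

    ProperOn : List (Fin n) → (Fin n → Bool) → Set
    ProperOn xs c = ∀ {u v} → u ∈ xs → v ∈ xs → adj A u v ≡ true → c u ≢ c v

    -- A vertex with at most one neighbour in `xs` is removed, the rest is coloured, and the vertex
    -- gets the colour opposite to that neighbour's. The bound `k` makes the recursion structural.
    twoColouring : ∀ k xs → length xs ℕ.≤ k → ∃ (ProperOn xs)
    twoColouring k [] _ = (λ _ → true) , λ ()
    twoColouring (ℕ.suc k) xs@(r ∷ _) short with nonBranching xs (here refl)
    ... | v , v∈xs , ¬branch with twoColouring k (filter (λ u → ¬? (u Fin.≟ v)) xs)
                                   (ℕ.s≤s⁻¹ (ℕ.<-≤-trans (List.filter-notAll (λ u → ¬? (u Fin.≟ v)) xs
                                     (lose v∈xs λ v≢v → v≢v refl)) short))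
    ...   | c , proper = colour (Fin.any? λ w → w ∈? xs ×-dec (adj A v w Bool.≟ true))
      where
      keep : ∀ {u} → u ∈ xs → u ≢ v → u ∈ filter (λ u → ¬? (u Fin.≟ v)) xs
      keep u∈xs u≢v = ∈-filter⁺ (λ u → ¬? (u Fin.≟ v)) u∈xs u≢v
      recolour : Bool → Fin n → Bool
      recolour b u with u Fin.≟ v
      ... | yes _ = b
      ... | no  _ = c u
      recolour-proper : ∀ b → (∀ {w} → w ∈ xs → adj A v w ≡ true → b ≢ c w) → ProperOn xs (recolour b)
      recolour-proper b differs {s} {t} s∈xs t∈xs st with s Fin.≟ v | t Fin.≟ v
      ... | yes refl | yes refl = contradiction refl (adj⇒≢ st)
      ... | yes refl | no  _    = differs t∈xs st
      ... | no  _    | yes refl = differs s∈xs (adj-flip st) ∘ sym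
      ... | no  s≢v  | no  t≢v  = proper (keep s∈xs s≢v) (keep t∈xs t≢v) st
      colour : Dec (∃ λ w → w ∈ xs × adj A v w ≡ true) → ∃ (ProperOn xs)
      colour (no lonely) = recolour true , recolour-proper true λ w∈xs vw → contradiction (_ , w∈xs , vw) lonely
      colour (yes (w , w∈xs , vw)) = recolour (not (c w)) , recolour-proper (not (c w)) differs
        where
        differs : ∀ {u} → u ∈ xs → adj A v u ≡ true → not (c w) ≢ c u
        differs {u} u∈xs vu with w Fin.≟ u
        ... | yes refl = Bool.not-¬ refl ∘ sym
        ... | no  w≢u  = contradiction (w , u , w≢u , (w∈xs , u∈xs) , (vw , vu)) ¬branch

unique⇒length≤ : ∀ (p : Subset n) ys → Unique ys → All (Subset._∈ p) ys → length ys ℕ.≤ Subset.∣ p ∣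
unique⇒length≤ p []       []           []           = ℕ.z≤n
unique⇒length≤ p (y ∷ ys) (y≢ys ∷ uys) (y∈p ∷ ys⊆p) = ℕ.≤-<-trans
  (unique⇒length≤ (p Subset.- y) ys uys
    (All.zipWith (λ (y≢z , z∈p) → Subset.x∈p∧x≢y⇒x∈p-y z∈p (y≢z ∘ sym)) (y≢ys , ys⊆p)))
  (Subset.x∈p⇒∣p-x∣<∣p∣ y∈p)

cover-length : ∀ {P Q : V → Set} (P? : ∀ v → Dec (P v)) (Q? : ∀ v → Dec (Q v)) → ∀ xs → (∀ {v} → v ∈ xs → P v ⊎ Q v) →
               length xs ℕ.≤ length (filter P? xs) ℕ.+ length (filter Q? xs)
cover-length P? Q? []       _     = ℕ.z≤n
cover-length P? Q? (x ∷ xs) cover with cover-length P? Q? xs (cover ∘ there) | P? x | Q? x | cover (here refl)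
... | ih | yes _  | yes _  | _        = ℕ.s≤s (ℕ.≤-trans ih (ℕ.+-monoʳ-≤ _ (ℕ.n≤1+n _)))
... | ih | yes _  | no  _  | _        = ℕ.s≤s ih
... | ih | no  _  | yes _  | _        = ℕ.≤-trans (ℕ.s≤s ih) (ℕ.≤-reflexive (sym (ℕ.+-suc _ _)))
... | ih | no ¬p  | no  _  | inj₁ p   = contradiction p ¬p
... | ih | no  _  | no ¬q  | inj₂ q   = contradiction q ¬q

-- Greedy pairing of vertices into gadgets

module _ (A : Graph (Fin n)) where

  open DecMembership (Fin._≟_ {n}) using (_∈?_)
  open Gadget using (x; y)

  Swappable : Fin n → Fin n → Set
  Swappable u v = ∃₂ λ p q → (adj A u p ≡ true × NonAdj A v p) × (adj A v q ≡ true × NonAdj A u q)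

  swappable? : ∀ u v → Dec (Swappable u v)
  swappable? u v = Fin.any? λ p → Fin.any? λ q →
    ((adj A u p Bool.≟ true) ×-dec (adj A v p Bool.≟ false)) ×-dec ((adj A v q Bool.≟ true) ×-dec (adj A u q Bool.≟ false))

  ends : List (Gadget A) → List (Fin n)
  ends []       = []
  ends (g ∷ gs) = x g ∷ y g ∷ ends gs

  length-ends : ∀ gs → length (ends gs) ≡ 2 ℕ.* length gs
  length-ends []       = refl
  length-ends (g ∷ gs) = trans (cong (2 ℕ.+_) (length-ends gs)) (sym (ℕ.*-suc 2 (length gs)))

  record Pairing (xs : List (Fin n)) : Set where
    field
      gadgets : List (Gadget A)
      rest    : List (Fin n)
      perm    : ends gadgets ++ rest ↭ xs
      stuck   : ∀ {u v} → u ∈ rest → v ∈ rest → ¬ Swappable u v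

  Independent : List (Fin n) → Set
  Independent xs = ∀ {u v} → u ∈ xs → v ∈ xs → NonAdj A u v

  true≢false : ∀ {b} → b ≡ true → b ≢ false
  true≢false refl ()

  -- Each new vertex is matched with a leftover that it can form a gadget with, or else joins the
  -- leftovers, so no two leftovers ever fit together.
  pairUp : ∀ xs → Independent xs → Pairing xs
  pairUp []       ind = record { gadgets = [] ; rest = [] ; perm = ↭-refl ; stuck = λ () }
  pairUp (r ∷ xs) ind = add (Any.any? (swappable? r) rest)
    where
    open Pairing (pairUp xs (λ u∈ v∈ → ind (there u∈) (there v∈)))
    add : Dec (Any.Any (Swappable r) rest) → Pairing (r ∷ xs)
    add (no none) = record
      { gadgets = gadgets
      ; rest    = r ∷ rest
      ; perm    = ↭-trans (shift r (ends gadgets) rest) (↭-prep r perm)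
      ; stuck   = stuck′
      }
      where
      stuck′ : ∀ {u v} → u ∈ r ∷ rest → v ∈ r ∷ rest → ¬ Swappable u v
      stuck′ (here refl) (here refl) (p , q , (rp , ¬rp) , _)  = true≢false rp ¬rp
      stuck′ (here refl) (there v∈)  good                      = none (lose v∈ good)
      stuck′ (there u∈)  (here refl) (p , q , up , rq)         = none (lose u∈ (q , p , rq , up))
      stuck′ (there u∈)  (there v∈)  good                      = stuck u∈ v∈ good
    add (yes any) with find any
    ... | v , v∈rest , (p , q , (rp , ¬vp) , (vq , ¬rq)) with ∈-∃++ v∈rest
    ...   | ys , zs , eq = record
      { gadgets = gadget ∷ gadgets
      ; rest    = ys ++ zs
      ; perm    = ↭-prep r (↭-trans (↭-sym (shift v (ends gadgets) (ys ++ zs)))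
                    (↭-trans (++⁺ˡ (ends gadgets) (subst (v ∷ ys ++ zs ↭_) (sym eq) (↭-sym (shift v ys zs)))) perm))
      ; stuck   = λ u∈ w∈ → stuck (old u∈) (old w∈)
      }
      where
      old : ∀ {u} → u ∈ ys ++ zs → u ∈ rest
      old u∈ with ∈-++⁻ ys u∈
      ... | inj₁ u∈ys = subst (_ ∈_) (sym eq) (∈-++⁺ˡ u∈ys)
      ... | inj₂ u∈zs = subst (_ ∈_) (sym eq) (∈-++⁺ʳ ys (there u∈zs))
      gadget : Gadget A
      gadget = record
        { x = r ; y = v ; p = p ; q = q
        ; x≢y = λ r≡v → true≢false (trans (cong (λ z → adj A z p) (sym r≡v)) rp) ¬vp
        ; xy = ind (here refl) (there (∈-resp-↭ perm (∈-++⁺ʳ (ends gadgets) v∈rest)))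
        ; xp = rp ; yq = vq ; yp = ¬vp ; xq = ¬rq }

  separated : ∀ gs rest → Unique (ends gs ++ rest) → Independent (ends gs ++ rest) → AllPairs (Separated {A = A}) gs
  separated []       rest _ _ = []
  separated (g ∷ gs) rest ((_ ∷ x≢) ∷ y≢ ∷ uniq) ind =
    All.tabulate (λ h∈ → (apartx (end-x h∈) , aparty (end-x h∈)) , (apartx (end-y h∈) , aparty (end-y h∈)))
    ∷ separated gs rest uniq (λ u∈ v∈ → ind (there (there u∈)) (there (there v∈)))
    where
    ends⊆ : ∀ {v} → v ∈ ends gs → v ∈ ends gs ++ rest
    ends⊆ = ∈-++⁺ˡ
    apartx : ∀ {v} → v ∈ ends gs → Apart A v (x g)
    apartx v∈ = (λ v≡x → All.lookup x≢ (ends⊆ v∈) (sym v≡x)) , ind (there (there (ends⊆ v∈))) (here refl)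
    aparty : ∀ {v} → v ∈ ends gs → Apart A v (y g)
    aparty v∈ = (λ v≡y → All.lookup y≢ (ends⊆ v∈) (sym v≡y)) , ind (there (there (ends⊆ v∈))) (there (here refl))
    end-x : ∀ {hs h} → h ∈ hs → x h ∈ ends hs
    end-x (here refl) = here refl
    end-x (there h∈)  = there (there (end-x h∈))
    end-y : ∀ {hs h} → h ∈ hs → y h ∈ ends hs
    end-y (here refl) = there (here refl)
    end-y (there h∈)  = there (there (end-y h∈))

  pairing-separated : ∀ {xs} (P : Pairing xs) → Unique xs → Independent xs → AllPairs (Separated {A = A}) (Pairing.gadgets P)
  pairing-separated P uniq ind = separated gadgets rest
    (PermutationSetoid.Unique-resp-↭ (≡.setoid (Fin n)) (↭⇒↭ₛ (↭-sym perm)) uniq)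
    (λ u∈ v∈ → ind (∈-resp-↭ perm u∈) (∈-resp-↭ perm v∈))
    where open Pairing P

  rest-unique : ∀ {xs} (P : Pairing xs) → Unique xs → Unique (Pairing.rest P)
  rest-unique P uniq = Unique-++⁻ʳ (ends gadgets)
    (PermutationSetoid.Unique-resp-↭ (≡.setoid (Fin n)) (↭⇒↭ₛ (↭-sym perm)) uniq)
    where
    open Pairing P
    Unique-++⁻ʳ : ∀ ys {zs} → Unique (ys ++ zs) → Unique zs
    Unique-++⁻ʳ []       u       = u
    Unique-++⁻ʳ (_ ∷ ys) (_ ∷ u) = Unique-++⁻ʳ ys u

  pairing-length : ∀ {xs} (P : Pairing xs) → length xs ≡ 2 ℕ.* length (Pairing.gadgets P) ℕ.+ length (Pairing.rest P)
  pairing-length P = trans (sym (↭-length perm)) (trans (List.length-++ (ends gadgets)) (cong (ℕ._+ length rest) (length-ends gadgets)))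
    where open Pairing P

  neighbours≤Δ : ∀ p ys → Unique ys → (∀ {v} → v ∈ ys → adj A p v ≡ true) → length ys ℕ.≤ maxDegree A
  neighbours≤Δ p ys uniq adjacent = ℕ.≤-trans
    (unique⇒length≤ (Vec.tabulate (adj A p)) ys uniq
      (All.tabulate λ {v} v∈ → Vec.lookup⇒[]= v _ (trans (Vec.lookup∘tabulate (adj A p) v) (adjacent v∈))))
    (All.lookup (xs≤max 0 (map (degree A) (allFin n))) (∈-map⁺ (degree A) (∈-allFin p)))

  -- Leaves, non-leaves and the gadgets of a tree that is not a star

  NonLeaf : Fin n → Set
  NonLeaf = Branching A (allFin n)

  nonLeaf? : ∀ v → Dec (NonLeaf v)
  nonLeaf? = branching? A (allFin n)

  leaf-unique : ∀ {u v w} → ¬ NonLeaf u → adj A u v ≡ true → adj A u w ≡ true → v ≡ w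
  leaf-unique {u} {v} {w} leaf uv uw with v Fin.≟ w
  ... | yes v≡w = v≡w
  ... | no  v≢w = contradiction (v , w , v≢w , (∈-allFin v , ∈-allFin w) , (uv , uw)) leaf

  module _ (tree : IsTree A) (notStar : 2 ℕ.+ maxDegree A ℕ.≤ n) where

    open IsTree tree

    -- If all neighbours of `p` were leaves, `p` and its neighbours would be closed under adjacency,
    -- hence everything, and n ≤ 1 + Δ would contradict `notStar`.
    hub : ∀ p → ∃ λ w → adj A p w ≡ true × NonLeaf w
    hub p with Fin.any? (λ w → (adj A p w Bool.≟ true) ×-dec nonLeaf? w)
    ... | yes found = found
    ... | no  none  = contradiction notStar (ℕ.<⇒≱ (ℕ.s≤s (begin
      n                          ≡⟨ List.length-tabulate {n = n} id ⟨
      length (allFin n)          ≤⟨ cover-length (Fin._≟ p) (λ v → adj A p v Bool.≟ true) (allFin n) (λ {v} _ → everything v) ⟩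
      length (filter (Fin._≟ p) (allFin n)) ℕ.+ length nbrs
        ≤⟨ ℕ.+-mono-≤ (ℕ.≤-trans (unique⇒length≤ Subset.⁅ p ⁆ _ (Unique.filter⁺ (Fin._≟ p) (Unique.allFin⁺ n))
                                   (All.tabulate λ {v} v∈ → subst (Subset._∈ Subset.⁅ p ⁆) (sym (proj₂ (∈-filter⁻ (Fin._≟ p) {xs = allFin n} v∈))) (Subset.x∈⁅x⁆ p)))
                                 (ℕ.≤-reflexive (Subset.∣⁅x⁆∣≡1 p)))
                      (neighbours≤Δ p nbrs (Unique.filter⁺ (λ v → adj A p v Bool.≟ true) (Unique.allFin⁺ n))
                        (λ v∈ → proj₂ (∈-filter⁻ (λ v → adj A p v Bool.≟ true) {xs = allFin n} v∈))) ⟩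
      1 ℕ.+ maxDegree A ∎)))
      where
      open ℕ.≤-Reasoning
      nbrs = filter (λ v → adj A p v Bool.≟ true) (allFin n)
      step : ∀ {u v} → adj A u v ≡ true → u ≡ p ⊎ adj A p u ≡ true → v ≡ p ⊎ adj A p v ≡ true
      step uv (inj₁ refl) = inj₂ uv
      step {u} uv (inj₂ pu) = inj₁ (leaf-unique (λ nl → none (u , pu , nl)) uv (adj-flip A pu))
      everything : ∀ v → v ≡ p ⊎ adj A p v ≡ true
      everything v = closed⇒everything A (λ v → v ≡ p ⊎ adj A p v ≡ true) step (connected p v) (inj₁ refl)

    leaves nonLeaves : List (Fin n)
    leaves    = filter (λ v → ¬? (nonLeaf? v)) (allFin n)
    nonLeaves = filter nonLeaf? (allFin n)

    ∈leaves : ∀ {v} → v ∈ leaves → ¬ NonLeaf v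
    ∈leaves v∈ = proj₂ (∈-filter⁻ (λ v → ¬? (nonLeaf? v)) {xs = allFin n} v∈)

    ∈nonLeaves : ∀ {v} → v ∈ nonLeaves → NonLeaf v
    ∈nonLeaves v∈ = proj₂ (∈-filter⁻ nonLeaf? {xs = allFin n} v∈)

    leaf-hub : ∀ {r} → ¬ NonLeaf r → ∀ {v} → adj A r v ≡ true → NonLeaf v
    leaf-hub {r} leaf rv with hub r
    ... | w , rw , nl = subst NonLeaf (leaf-unique leaf rw rv) nl

    leaves-independent : Independent leaves
    leaves-independent u∈ v∈ = ≢true⇒false λ uv → ∈leaves v∈ (leaf-hub (∈leaves u∈) uv)

    leaves-unique : Unique leaves
    leaves-unique = Unique.filter⁺ (λ v → ¬? (nonLeaf? v)) (Unique.allFin⁺ n)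

    leafPairing : Pairing leaves
    leafPairing = pairUp leaves leaves-independent

    -- Unpaired leaves hang on a common vertex, which moreover has a neighbour that is not a leaf.
    leafRest : length (Pairing.rest leafPairing) ℕ.+ 1 ℕ.≤ maxDegree A
    leafRest = bound′ rest refl
      where
      open Pairing leafPairing
      isLeaf : ∀ {v} → v ∈ rest → ¬ NonLeaf v
      isLeaf v∈ = ∈leaves (∈-resp-↭ perm (∈-++⁺ʳ (ends gadgets) v∈))
      bound′ : ∀ rs → rest ≡ rs → length rs ℕ.+ 1 ℕ.≤ maxDegree A
      -- Without leftovers the claim is 1 ≤ Δ, for which any edge will do.
      bound′ [] _ with hub nonempty
      ... | w , uw , _ = neighbours≤Δ nonempty (w ∷ []) ([] ∷ []) λ { (here refl) → uw }
      bound′ (r ∷ rs) eq with hub r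
      ... | p , rp , _ with hub p
      ...   | z , pz , z-nl = subst (ℕ._≤ maxDegree A) (ℕ.+-comm 1 (length (r ∷ rs)))
        (neighbours≤Δ p (z ∷ r ∷ rs) (All.tabulate z≢ ∷ subst Unique eq (rest-unique leafPairing leaves-unique))
          λ { (here refl) → pz ; (there v∈) → attached v∈ })
        where
        inRest : ∀ {v} → v ∈ r ∷ rs → v ∈ rest
        inRest = subst (_ ∈_) (sym eq)
        z≢ : ∀ {v} → v ∈ r ∷ rs → z ≢ v
        z≢ v∈ refl = isLeaf (inRest v∈) z-nl
        attached : ∀ {v} → v ∈ r ∷ rs → adj A p v ≡ true
        attached {v} v∈ with hub v
        ... | q , vq , _ with p Fin.≟ q
        ...   | yes refl = adj-flip A vq
        -- Two leaves hanging on different vertices have these as private neighbours, so they would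
        -- have been paired.
        ...   | no  p≢q  = contradiction
          (p , q , (rp , ≢true⇒false λ vp → p≢q (leaf-unique (isLeaf (inRest v∈)) vp vq))
                 , (vq , ≢true⇒false λ rq → p≢q (leaf-unique (isLeaf (inRest (here refl))) rp rq)))
          (stuck (inRest (here refl)) (inRest v∈))

    4-cycle : ∀ {u v a b} → u ≢ v → a ≢ b → adj A u a ≡ true → adj A u b ≡ true →
              adj A v a ≡ true → adj A v b ≡ true → Cycle A
    4-cycle {u} {v} {a} {b} u≢v a≢b ua ub va vb = record
      { m = 3 ; 2≤m = ℕ.s≤s (ℕ.s≤s ℕ.z≤n) ; vertex = vertex ; distinct = distinct
      ; step = λ { zero → ≡true⇒T ua ; (suc zero) → ≡true⇒T (adj-flip A va) ; (suc (suc zero)) → ≡true⇒T vb }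
      ; close = ≡true⇒T (adj-flip A ub) }
      where
      vertex : Fin 4 → Fin n
      vertex zero                   = u
      vertex (suc zero)             = a
      vertex (suc (suc zero))       = v
      vertex (suc (suc (suc zero))) = b
      distinct : Injective _≡_ _≡_ vertex
      distinct {zero}                   {zero}                   _  = refl
      distinct {suc zero}               {suc zero}               _  = refl
      distinct {suc (suc zero)}         {suc (suc zero)}         _  = refl
      distinct {suc (suc (suc zero))}   {suc (suc (suc zero))}   _  = refl
      distinct {zero}                   {suc zero}               eq = contradiction eq (adj⇒≢ A ua)
      distinct {zero}                   {suc (suc zero)}         eq = contradiction eq u≢v
      distinct {zero}                   {suc (suc (suc zero))}   eq = contradiction eq (adj⇒≢ A ub)
      distinct {suc zero}               {zero}                   eq = contradiction (sym eq) (adj⇒≢ A ua)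
      distinct {suc zero}               {suc (suc zero)}         eq = contradiction (sym eq) (adj⇒≢ A va)
      distinct {suc zero}               {suc (suc (suc zero))}   eq = contradiction eq a≢b
      distinct {suc (suc zero)}         {zero}                   eq = contradiction (sym eq) u≢v
      distinct {suc (suc zero)}         {suc zero}               eq = contradiction eq (adj⇒≢ A va)
      distinct {suc (suc zero)}         {suc (suc (suc zero))}   eq = contradiction eq (adj⇒≢ A vb)
      distinct {suc (suc (suc zero))}   {zero}                   eq = contradiction (sym eq) (adj⇒≢ A ub)
      distinct {suc (suc (suc zero))}   {suc zero}               eq = contradiction (sym eq) a≢b
      distinct {suc (suc (suc zero))}   {suc (suc zero)}         eq = contradiction (sym eq) (adj⇒≢ A vb)

    private-neighbour : ∀ {u v} → u ≢ v → NonLeaf u → ∃ λ p → adj A u p ≡ true × NonAdj A v p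
    private-neighbour {u} {v} u≢v (a , b , a≢b , _ , (ua , ub)) with adj A v a in va | adj A v b in vb
    ... | false | _     = a , ua , va
    ... | true  | false = b , ub , vb
    ... | true  | true  = contradiction (4-cycle u≢v a≢b ua ub va vb) acyclic

    module _ (c : Fin n → Bool) (proper : ∀ {u v} → adj A u v ≡ true → c u ≢ c v) (b : Bool) where

      class : List (Fin n)
      class = filter (λ v → c v Bool.≟ b) nonLeaves

      class-independent : Independent class
      class-independent u∈ v∈ = ≢true⇒false λ uv → proper uv
        (trans (proj₂ (∈-filter⁻ (λ v → c v Bool.≟ b) {xs = nonLeaves} u∈))
          (sym (proj₂ (∈-filter⁻ (λ v → c v Bool.≟ b) {xs = nonLeaves} v∈))))

      class-unique : Unique class
      class-unique = Unique.filter⁺ (λ v → c v Bool.≟ b) (Unique.filter⁺ nonLeaf? (Unique.allFin⁺ n))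

      classPairing : Pairing class
      classPairing = pairUp class class-independent

      classRest : length (Pairing.rest classPairing) ℕ.≤ 1
      classRest = bound′ rest refl
        where
        open Pairing classPairing
        isNonLeaf : ∀ {v} → v ∈ rest → NonLeaf v
        isNonLeaf v∈ = ∈nonLeaves (proj₁ (∈-filter⁻ (λ v → c v Bool.≟ b) {xs = nonLeaves}
          (∈-resp-↭ perm (∈-++⁺ʳ (ends gadgets) v∈))))
        bound′ : ∀ rs → rest ≡ rs → length rs ℕ.≤ 1
        bound′ []       _ = ℕ.z≤n
        bound′ (_ ∷ []) _ = ℕ.s≤s ℕ.z≤n
        bound′ (u ∷ v ∷ rs) eq with subst Unique eq (rest-unique classPairing class-unique)
        ... | (u≢v ∷ _) ∷ _ =
          let u∈ = subst (u ∈_) (sym eq) (here refl)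
              v∈ = subst (v ∈_) (sym eq) (there (here refl))
              p , up , vp = private-neighbour u≢v (isNonLeaf u∈)
              q , vq , uq = private-neighbour (u≢v ∘ sym) (isNonLeaf v∈)
          in contradiction (p , q , (up , vp) , (vq , uq)) (stuck u∈ v∈)

    -- The 6 is two vertices per gadget times three families, of which the one with most gadgets is
    -- used.
    Enough : List (Gadget A) → Set
    Enough gs = AllPairs (Separated {A = A}) gs × n ℕ.≤ 6 ℕ.* length gs ℕ.+ 1 ℕ.+ maxDegree A

    many-gadgets : ∃ Enough
    many-gadgets with twoColouring A acyclic n (allFin n) (ℕ.≤-reflexive (List.length-tabulate {n = n} id))
    ... | c , proper = choose
      where
      proper′ : ∀ {u v} → adj A u v ≡ true → c u ≢ c v
      proper′ = proper (∈-allFin _) (∈-allFin _)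
      PT = classPairing c proper′ true
      PF = classPairing c proper′ false
      size : ∀ {xs} → Pairing xs → ℕ
      size P = length (Pairing.gadgets P)
      l t f : ℕ
      l = size leafPairing
      t = size PT
      f = size PF
      lr = length (Pairing.rest leafPairing)
      total : n ℕ.≤ 2 ℕ.* (l ℕ.+ t ℕ.+ f) ℕ.+ 1 ℕ.+ maxDegree A
      total = begin
        n ≡⟨ List.length-tabulate {n = n} id ⟨
        length (allFin n)
          ≤⟨ cover-length (λ v → ¬? (nonLeaf? v)) nonLeaf? (allFin n) (λ {v} _ → split (nonLeaf? v)) ⟩
        length leaves ℕ.+ length nonLeaves
          ≤⟨ ℕ.+-monoʳ-≤ (length leaves) (cover-length (λ v → c v Bool.≟ true) (λ v → c v Bool.≟ false) nonLeaves (λ {v} _ → colour (c v))) ⟩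
        length leaves ℕ.+ (length (class c proper′ true) ℕ.+ length (class c proper′ false))
          ≡⟨ cong₂ ℕ._+_ (pairing-length leafPairing) (cong₂ ℕ._+_ (pairing-length PT) (pairing-length PF)) ⟩
        (2 ℕ.* l ℕ.+ lr) ℕ.+ ((2 ℕ.* t ℕ.+ length (Pairing.rest PT)) ℕ.+ (2 ℕ.* f ℕ.+ length (Pairing.rest PF)))
          ≤⟨ ℕ.+-monoʳ-≤ (2 ℕ.* l ℕ.+ lr) (ℕ.+-mono-≤ (ℕ.+-monoʳ-≤ (2 ℕ.* t) (classRest c proper′ true)) (ℕ.+-monoʳ-≤ (2 ℕ.* f) (classRest c proper′ false))) ⟩
        (2 ℕ.* l ℕ.+ lr) ℕ.+ ((2 ℕ.* t ℕ.+ 1) ℕ.+ (2 ℕ.* f ℕ.+ 1))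
          -- Each colour class may leave one vertex over. Beside Δ there is room for only one of
          -- them, so the other is absorbed by the `+ 1` in `leafRest`.
          ≡⟨ arrange l t f lr ⟩
        2 ℕ.* (l ℕ.+ t ℕ.+ f) ℕ.+ 1 ℕ.+ (lr ℕ.+ 1)
          ≤⟨ ℕ.+-monoʳ-≤ (2 ℕ.* (l ℕ.+ t ℕ.+ f) ℕ.+ 1) leafRest ⟩
        2 ℕ.* (l ℕ.+ t ℕ.+ f) ℕ.+ 1 ℕ.+ maxDegree A ∎
        where
        open ℕ.≤-Reasoning
        split : ∀ {P : Set} → Dec P → ¬ P ⊎ P
        split (yes p) = inj₂ p
        split (no ¬p) = inj₁ ¬p
        colour : ∀ b → b ≡ true ⊎ b ≡ false
        colour true  = inj₁ refl
        colour false = inj₂ refl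
        arrange : ∀ l t f r → (2 ℕ.* l ℕ.+ r) ℕ.+ ((2 ℕ.* t ℕ.+ 1) ℕ.+ (2 ℕ.* f ℕ.+ 1)) ≡ 2 ℕ.* (l ℕ.+ t ℕ.+ f) ℕ.+ 1 ℕ.+ (r ℕ.+ 1)
        arrange = ℕ-solve-∀
      enough : ∀ k → l ℕ.+ t ℕ.+ f ℕ.≤ 3 ℕ.* k → n ℕ.≤ 6 ℕ.* k ℕ.+ 1 ℕ.+ maxDegree A
      enough k le = ℕ.≤-trans total (ℕ.+-monoˡ-≤ (maxDegree A) (ℕ.+-monoˡ-≤ 1
        (ℕ.≤-trans (ℕ.*-monoʳ-≤ 2 le) (ℕ.≤-reflexive (sym (ℕ.*-assoc 2 3 k))))))
      three : ∀ k → l ℕ.≤ k → t ℕ.≤ k → f ℕ.≤ k → l ℕ.+ t ℕ.+ f ℕ.≤ 3 ℕ.* k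
      three k l≤ t≤ f≤ = ℕ.≤-trans (ℕ.+-mono-≤ (ℕ.+-mono-≤ l≤ t≤) f≤) (ℕ.≤-reflexive (triple k))
        where
        triple : ∀ k → k ℕ.+ k ℕ.+ k ≡ 3 ℕ.* k
        triple = ℕ-solve-∀
      useL : t ℕ.≤ l → f ℕ.≤ l → ∃ Enough
      useL t≤ f≤ = Pairing.gadgets leafPairing , pairing-separated leafPairing leaves-unique leaves-independent ,
        enough l (three l ℕ.≤-refl t≤ f≤)
      useC : ∀ b → (let k = size (classPairing c proper′ b) in l ℕ.≤ k → t ℕ.≤ k → f ℕ.≤ k → ∃ Enough)
      useC b l≤ t≤ f≤ = Pairing.gadgets (classPairing c proper′ b) ,
        pairing-separated (classPairing c proper′ b) (class-unique c proper′ b) (class-independent c proper′ b) ,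
        enough (size (classPairing c proper′ b)) (three (size (classPairing c proper′ b)) l≤ t≤ f≤)
      choose : ∃ Enough
      choose with ℕ.≤-total t l | ℕ.≤-total f l | ℕ.≤-total t f
      ... | inj₁ t≤l | inj₁ f≤l | _        = useL t≤l f≤l
      ... | inj₁ t≤l | inj₂ l≤f | _        = useC false l≤f (ℕ.≤-trans t≤l l≤f) ℕ.≤-refl
      ... | inj₂ l≤t | _        | inj₁ t≤f = useC false (ℕ.≤-trans l≤t t≤f) t≤f ℕ.≤-refl
      ... | inj₂ l≤t | _        | inj₂ f≤t = useC true l≤t ℕ.≤-refl f≤t

-- Discrepancy of sparse graphs

complement : Graph (Fin n) → Graph (Fin n)
complement {n} G = record
  { adj        = λ u v → adj (complete n) u v Bool.∧ not (adj G u v)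
  ; adj-sym    = λ u v → cong₂ (λ a b → a Bool.∧ not b) (adj-sym (complete n) u v) (adj-sym G u v)
  ; adj-irrefl = λ v → cong (Bool._∧ not (adj G v v)) (adj-irrefl (complete n) v)
  }

ι-complete : (u v : Fin n) → ι (complete n) u v ≡ 1ℤ - δ u v
ι-complete u v with does (u Fin.≟ v)
... | true  = refl
... | false = refl

ι-complement : ∀ (G : Graph (Fin n)) u v → ι (complement G) u v ≡ 1ℤ - δ u v - ι G u v
ι-complement G u v = go (u Fin.≟ v)
  where
  go : Dec (u ≡ v) → ι (complement G) u v ≡ 1ℤ - δ u v - ι G u v
  go (yes refl) rewrite dec-true (u Fin.≟ u) refl | adj-irrefl G u = refl
  go (no u≢v) rewrite dec-false (u Fin.≟ v) u≢v with adj G u v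
  ... | true  = refl
  ... | false = refl

complete-adj⁻ : ∀ {u v : Fin n} → adj (complete n) u v ≡ true → u ≢ v
complete-adj⁻ {u = u} uv refl = contradiction (trans (sym uv) (adj-irrefl (complete _) u)) λ ()

complete-adj⁺ : ∀ {u v : Fin n} → u ≢ v → adj (complete n) u v ≡ true
complete-adj⁺ {u = u} {v} u≢v = cong not (dec-false (u Fin.≟ v) u≢v)

∧-true⁻ : ∀ {a b} → a Bool.∧ b ≡ true → a ≡ true × b ≡ true
∧-true⁻ {true} {true} _ = refl , refl

not-true⁻ : ∀ {a} → not a ≡ true → a ≡ false
not-true⁻ {false} _ = refl

⟦∧⟧ : ∀ a b → ⟦ a Bool.∧ b ⟧ ≡ ⟦ a ⟧ * ⟦ b ⟧
⟦∧⟧ true  b = sym (ℤ.*-identityˡ ⟦ b ⟧)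
⟦∧⟧ false b = refl

⟦⟧-≤ : ∀ b {s t} → 0ℤ ≤ t → (b ≡ true → s ≤ t) → ⟦ b ⟧ * s ≤ t
⟦⟧-≤ true  {s} 0≤t s≤t = subst (_≤ _) (sym (ℤ.*-identityˡ s)) (s≤t refl)
⟦⟧-≤ false     0≤t _   = 0≤t

degreeSum-complement : (G : Graph (Fin n)) → degreeSum (complement G) ≡ + n * (+ n - 1ℤ) - degreeSum G
degreeSum-complement {n} G = begin
  ∑² (ι (complement G))
    ≡⟨ ∑²-cong (ι-complement G) ⟩
  ∑² (λ u v → 1ℤ - δ u v - ι G u v)
    ≡⟨ sum-cong-≗ row ⟩
  ∑ (λ u → + n - 1ℤ - ∑ (ι G u))
    ≡⟨ ∑-distrib-- (λ _ → + n - 1ℤ) (λ u → ∑ (ι G u)) ⟩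
  ∑ {n} (λ _ → + n - 1ℤ) - degreeSum G
    ≡⟨ cong (_- degreeSum G) (∑-const {n} (+ n - 1ℤ)) ⟩
  + n * (+ n - 1ℤ) - degreeSum G ∎
  where
  open ≡-Reasoning
  row : ∀ u → ∑ (λ v → 1ℤ - δ u v - ι G u v) ≡ + n - 1ℤ - ∑ (ι G u)
  row u = begin
    ∑ (λ v → 1ℤ - δ u v - ι G u v)      ≡⟨ ∑-distrib-- (λ v → 1ℤ - δ u v) (ι G u) ⟩
    ∑ (λ v → 1ℤ - δ u v) - ∑ (ι G u)    ≡⟨ cong (_- ∑ (ι G u)) (∑-distrib-- (λ _ → 1ℤ) (δ u)) ⟩
    ∑ {n} (λ _ → 1ℤ) - ∑ (δ u) - ∑ (ι G u)
      ≡⟨ cong₂ (λ a b → a - b - ∑ (ι G u)) (trans (∑-const {n} 1ℤ) (ℤ.*-identityʳ (+ n)))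
           (trans (sum-cong-≗ λ v → sym (ℤ.*-identityʳ (δ u v))) (∑-δ u (λ _ → 1ℤ))) ⟩
    + n - 1ℤ - ∑ (ι G u) ∎

codegree : ∀ (G : Graph (Fin n)) v → ∑ (ι (complement G) v) ≡ + n - 1ℤ - ∑ (ι G v)
codegree {n} G v = begin
  ∑ (ι (complement G) v)                ≡⟨ sum-cong-≗ (ι-complement G v) ⟩
  ∑ (λ w → 1ℤ - δ v w - ι G v w)        ≡⟨ ∑-distrib-- (λ w → 1ℤ - δ v w) (ι G v) ⟩
  ∑ (λ w → 1ℤ - δ v w) - ∑ (ι G v)      ≡⟨ cong (_- ∑ (ι G v)) (∑-distrib-- (λ _ → 1ℤ) (δ v)) ⟩
  ∑ {n} (λ _ → 1ℤ) - ∑ (δ v) - ∑ (ι G v)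
    ≡⟨ cong₂ (λ a b → a - b - ∑ (ι G v)) (trans (∑-const {n} 1ℤ) (ℤ.*-identityʳ (+ n)))
         (trans (sum-cong-≗ λ w → sym (ℤ.*-identityʳ (δ v w))) (∑-δ v (λ _ → 1ℤ))) ⟩
  + n - 1ℤ - ∑ (ι G v) ∎
  where open ≡-Reasoning

-- Between distinct vertices complementation replaces ι by 1 - ι, which only reverses the sign of
-- the alternating sum.
totalDiscrepancy-complement : (G : Graph (Fin n)) → totalDiscrepancy (complement G) ≡ totalDiscrepancy G
totalDiscrepancy-complement {n} G = ∑²-cong λ x y → ∑²-cong λ p q → same x y p q
  where
  flip : ∀ a b c d → ((1ℤ - 0ℤ - a) - (1ℤ - 0ℤ - b)) - ((1ℤ - 0ℤ - c) - (1ℤ - 0ℤ - d)) ≡ - ((a - b) - (c - d))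
  flip = solve-∀
  at : ∀ {u v} → u ≢ v → ι (complement G) u v ≡ 1ℤ - 0ℤ - ι G u v
  at {u} {v} u≢v = trans (ι-complement G u v) (cong (λ d → 1ℤ - d - ι G u v) (δ-≢ u≢v))
  same : ∀ x y p q → discrepancy (complement G) x y p q ≡ discrepancy G x y p q
  same x y p q = go (distinct? x y p q)
    where
    go : (d : Dec (Distinct x y p q)) →
      ⟦ does d ⟧ * + ∣ (ι (complement G) y q - ι (complement G) x q) - (ι (complement G) y p - ι (complement G) x p) ∣ ≡
      ⟦ does d ⟧ * + ∣ (ι G y q - ι G x q) - (ι G y p - ι G x p) ∣
    go (no _) = refl
    go (yes (_ , (x≢p , y≢p) , (x≢q , y≢q , _))) = cong (λ z → 1ℤ * + z) (trans
      (cong ∣_∣ (trans (cong₂ _-_ (cong₂ _-_ (at y≢q) (at x≢q)) (cong₂ _-_ (at y≢p) (at x≢p)))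
        (flip (ι G y q) (ι G x q) (ι G y p) (ι G x p))))
      (ℤ.∣-i∣≡∣i∣ ((ι G y q - ι G x q) - (ι G y p - ι G x p))))

-- Both lower bounds on the discrepancy fix `y` and `q`, which are consecutive on the 4-cycle, and
-- count the choices of `x` and `p`.
∑⁴-reorder : (F : Fin n → Fin n → Fin n → Fin n → ℤ) →
             ∑⁴ F ≡ ∑² λ y q → ∑² λ x p → F x y p q
∑⁴-reorder F = trans
  (∑-comm λ x y → ∑² λ p q → F x y p q)
  (sum-cong-≗ λ y → trans
    (sum-cong-≗ λ x → ∑-comm λ p q → F x y p q)
    (∑-comm λ x q → ∑ λ p → F x y p q))

discrepancy-≥ : ∀ (G : Graph (Fin n)) {x y p q} → Distinct x y p q →
                ∀ {a b c d} → ι G y q ≡ a → ι G x q ≡ b → ι G y p ≡ c → ι G x p ≡ d →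
                1ℤ ≤ + ∣ (a - b) - (c - d) ∣ → 1ℤ ≤ discrepancy G x y p q
discrepancy-≥ G {x} {y} {p} {q} dist refl refl refl refl le = subst (1ℤ ≤_)
  (sym (trans (cong (λ b → ⟦ b ⟧ * Z) (dec-true (distinct? x y p q) dist)) (ℤ.*-identityˡ Z))) le
  where Z = + ∣ (ι G y q - ι G x q) - (ι G y p - ι G x p) ∣

module _ (G : Graph (Fin n)) where

  private
    N = + n
    Ḡ = complement G

  deg : Fin n → ℤ
  deg v = ∑ (ι G v)

  -- Three quarters exceeds the 2/3 that bounds the share of heavy vertices (`few-heavy`), so a
  -- heavy vertex keeps n / 12 light neighbours; and a light vertex still has about n / 4
  -- non-neighbours.
  heavy : Fin n → Bool
  heavy v = does (+ 3 * N ℤ.≤? + 4 * deg v)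

  hi lo : Fin n → ℤ
  hi v = ⟦ heavy v ⟧
  lo v = ⟦ not (heavy v) ⟧

  heavy⇒ : ∀ {v} → heavy v ≡ true → + 3 * N ≤ + 4 * deg v
  heavy⇒ {v} hv with + 3 * N ℤ.≤? + 4 * deg v
  ... | yes le = le

  light⇒ : ∀ {v} → heavy v ≡ false → + 4 * deg v ≤ + 3 * N
  light⇒ {v} hv with + 3 * N ℤ.≤? + 4 * deg v
  ... | no ¬le = ℤ.<⇒≤ (ℤ.≰⇒> ¬le)

  h E : ℤ
  h = ∑ hi
  E = ∑² λ u v → lo u * lo v * ι G u v

  local : (y q : Fin n) → ℤ
  local y q = ∑² λ x p → discrepancy G x y p q

  local-nonneg : ∀ y q → 0ℤ ≤ local y q
  local-nonneg y q = ∑²-nonneg λ x p → discrepancy-nonneg G x y p q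

  complement-adj⁻ : ∀ {u v} → adj Ḡ u v ≡ true → u ≢ v × adj G u v ≡ false
  complement-adj⁻ uv = complete-adj⁻ (proj₁ (∧-true⁻ uv)) , not-true⁻ (proj₂ (∧-true⁻ uv))

  -- For an edge yq, every 4-cycle y q x p with qx and yp non-edges is unbalanced.
  local-edge : ∀ {y q} → adj G y q ≡ true →
               ∑ (ι Ḡ q) * ∑ (ι Ḡ y) - ∑ (ι Ḡ q) ≤ local y q
  local-edge {y} {q} yq = begin
    ∑ (ι Ḡ q) * ∑ (ι Ḡ y) - ∑ (ι Ḡ q)
      ≤⟨ ℤ.+-monoʳ-≤ (∑ (ι Ḡ q) * ∑ (ι Ḡ y)) (ℤ.neg-mono-≤ (∑-mono diag)) ⟩
    ∑ (ι Ḡ q) * ∑ (ι Ḡ y) - ∑ (λ x → ι Ḡ q x * ι Ḡ y x)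
      ≡⟨ cong₂ _-_ (∑∑-* (ι Ḡ q) (ι Ḡ y)) (sum-cong-≗ λ x → ∑-δ x (λ p → ι Ḡ q x * ι Ḡ y p)) ⟨
    ∑² (λ x p → ι Ḡ q x * ι Ḡ y p) - ∑² (λ x p → δ x p * (ι Ḡ q x * ι Ḡ y p))
      ≡⟨ ∑²-distrib-- (λ x p → ι Ḡ q x * ι Ḡ y p) (λ x p → δ x p * (ι Ḡ q x * ι Ḡ y p)) ⟨
    ∑² (λ x p → ι Ḡ q x * ι Ḡ y p - δ x p * (ι Ḡ q x * ι Ḡ y p))
      ≤⟨ ∑²-mono pointwise ⟩
    local y q ∎
    where
    open ℤ.≤-Reasoning
    -- Choices with x = p are degenerate and get subtracted; there are at most as many as
    -- non-neighbours of `q`.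
    diag : ∀ x → ι Ḡ q x * ι Ḡ y x ≤ ι Ḡ q x
    diag x = subst (ι Ḡ q x * ι Ḡ y x ≤_) (ℤ.*-identityʳ (ι Ḡ q x))
      (ℤ.*-monoˡ-≤-nonNeg (ι Ḡ q x) {{ℤ.nonNegative (⟦⟧-nonneg (adj Ḡ q x))}} (⟦⟧≤1 (adj Ḡ y x)))
    unfold : ∀ a b d → a * b - d * (a * b) ≡ (a * (b * (1ℤ - d))) * 1ℤ
    unfold = solve-∀
    pointwise : ∀ x p → ι Ḡ q x * ι Ḡ y p - δ x p * (ι Ḡ q x * ι Ḡ y p) ≤ discrepancy G x y p q
    pointwise x p = ℤ.≤-trans (ℤ.≤-reflexive (trans (unfold (ι Ḡ q x) (ι Ḡ y p) (δ x p)) (cong (_* 1ℤ) (sym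
        (trans (⟦∧⟧ (adj Ḡ q x) _) (cong (ι Ḡ q x *_) (trans (⟦∧⟧ (adj Ḡ y p) _) (cong (ι Ḡ y p *_) (ι-complete x p)))))))))
      (⟦⟧-≤ (adj Ḡ q x Bool.∧ (adj Ḡ y p Bool.∧ adj (complete n) x p)) (discrepancy-nonneg G x y p q) unbalanced)
      where
      unbalanced : adj Ḡ q x Bool.∧ (adj Ḡ y p Bool.∧ adj (complete n) x p) ≡ true → 1ℤ ≤ discrepancy G x y p q
      unbalanced all with ∧-true⁻ all
      ... | qx , rest with ∧-true⁻ rest
      ...   | yp , xp with complement-adj⁻ qx | complement-adj⁻ yp
      ...     | q≢x , ¬qx | y≢p , ¬yp = discrepancy-≥ G
        ((λ x≡y → contradiction (trans (sym yq) (trans (adj-sym G y q) (trans (cong (adj G q) (sym x≡y)) ¬qx))) λ ()) ,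
         (complete-adj⁻ xp , y≢p) ,
         (q≢x ∘ sym , adj⇒≢ G yq , λ p≡q → contradiction (trans (sym yq) (trans (cong (adj G y) (sym p≡q)) ¬yp)) λ ()))
        (cong ⟦_⟧ yq) (cong ⟦_⟧ (trans (adj-sym G x q) ¬qx)) (cong ⟦_⟧ ¬yp) refl (positive (adj G x p))
        where
        -- Whether xp is an edge is left open: it enters with the same sign as yq and cannot cancel
        -- it.
        positive : ∀ b → 1ℤ ≤ + ∣ (1ℤ - 0ℤ) - (0ℤ - ⟦ b ⟧) ∣
        positive true  = +≤+ (ℕ.s≤s ℕ.z≤n)
        positive false = +≤+ (ℕ.s≤s ℕ.z≤n)

  -- For heavy y ≠ q, every 4-cycle y q x p with light non-adjacent x, p and edges qx, yp is unbalanced.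
  local-heavy : ∀ {y q} → heavy y ≡ true → heavy q ≡ true → y ≢ q →
                ∑ (λ x → lo x * ι G q x) * ∑ (λ p → lo p * ι G y p) - (N + E) ≤ local y q
  local-heavy {y} {q} hy hq y≢q = begin
    ∑ f * ∑ g - (N + E)
      ≤⟨ ℤ.+-monoʳ-≤ (∑ f * ∑ g) (ℤ.neg-mono-≤ (ℤ.+-monoˡ-≤ E diag)) ⟩
    ∑ f * ∑ g - (∑² {n} (λ x p → δ x p * 1ℤ) + E)
      ≡⟨ cong₂ _-_ (∑∑-* f g) (∑²-+ (λ x p → δ x p * 1ℤ) (λ x p → lo x * lo p * ι G x p)) ⟨
    ∑² (λ x p → f x * g p) - ∑² (λ x p → δ x p * 1ℤ + lo x * lo p * ι G x p)
      ≡⟨ ∑²-distrib-- (λ x p → f x * g p) (λ x p → δ x p * 1ℤ + lo x * lo p * ι G x p) ⟨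
    ∑² (λ x p → f x * g p - (δ x p * 1ℤ + lo x * lo p * ι G x p))
      ≤⟨ ∑²-mono pointwise ⟩
    local y q ∎
    where
    open ℤ.≤-Reasoning
    f g : Fin n → ℤ
    f x = lo x * ι G q x
    g p = lo p * ι G y p
    diag : ∑² {n} (λ x p → δ x p * 1ℤ) ≤ N
    diag = ℤ.≤-reflexive (trans (sum-cong-≗ {n} λ x → ∑-δ x (λ _ → 1ℤ)) (trans (∑-const {n} 1ℤ) (ℤ.*-identityʳ N)))
    cond : Fin n → Fin n → Bool
    cond x p = (not (heavy x) Bool.∧ not (heavy p)) Bool.∧ ((adj G q x Bool.∧ adj G y p) Bool.∧ adj Ḡ x p)
    unbalanced : ∀ x p → cond x p ≡ true → 1ℤ ≤ discrepancy G x y p q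
    unbalanced x p all with ∧-true⁻ all
    ... | light , rest with ∧-true⁻ light | ∧-true⁻ rest
    ...   | lx , lp | edges , xp with ∧-true⁻ edges | complement-adj⁻ xp
    ...     | qx , yp | x≢p , ¬xp = discrepancy-≥ G
      (light≢heavy lx hy , (x≢p , adj⇒≢ G yp) , (adj⇒≢ G qx ∘ sym , y≢q , light≢heavy lp hq))
      refl (cong ⟦_⟧ (trans (adj-sym G x q) qx)) (cong ⟦_⟧ yp) (cong ⟦_⟧ ¬xp) (positive (adj G y q))
      where
      light≢heavy : ∀ {u v} → not (heavy u) ≡ true → heavy v ≡ true → u ≢ v
      light≢heavy lu hu refl = contradiction (trans (sym hu) (not-true⁻ lu)) λ ()
      -- Here yq is the open pair: the edges qx and yp stand against at most one edge of the
      -- opposite sign.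
      positive : ∀ b → 1ℤ ≤ + ∣ (⟦ b ⟧ - 1ℤ) - (1ℤ - 0ℤ) ∣
      positive true  = +≤+ (ℕ.s≤s ℕ.z≤n)
      positive false = +≤+ (ℕ.s≤s ℕ.z≤n)
    -- A truth table: each pair counted by `f x * g p` is good, or has x = p, or is an edge between
    -- light vertices.
    compare : ∀ a b c d e k → ⟦ a ⟧ * ⟦ c ⟧ * (⟦ b ⟧ * ⟦ d ⟧) - (⟦ k ⟧ * 1ℤ + ⟦ a ⟧ * ⟦ b ⟧ * ⟦ e ⟧) ≤
                            ⟦ (a Bool.∧ b) Bool.∧ ((c Bool.∧ d) Bool.∧ (not k Bool.∧ not e)) ⟧ * 1ℤ
    compare false b     c     d     e     true  = ℤ.-≤+
    compare false b     c     d     e     false = ℤ.≤-refl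
    compare true  false false d     e     true  = ℤ.-≤+
    compare true  false true  d     e     true  = ℤ.-≤+
    compare true  false false d     e     false = ℤ.≤-refl
    compare true  false true  d     e     false = ℤ.≤-refl
    compare true  true  false d     true  true  = ℤ.-≤+
    compare true  true  false d     true  false = ℤ.-≤+
    compare true  true  false d     false true  = ℤ.-≤+
    compare true  true  false d     false false = ℤ.≤-refl
    compare true  true  true  false true  true  = ℤ.-≤+
    compare true  true  true  false true  false = ℤ.-≤+
    compare true  true  true  false false true  = ℤ.-≤+
    compare true  true  true  false false false = ℤ.≤-refl
    compare true  true  true  true  true  true  = ℤ.-≤+
    compare true  true  true  true  true  false = ℤ.≤-refl
    compare true  true  true  true  false true  = ℤ.≤-refl
    compare true  true  true  true  false false = ℤ.≤-refl
    pointwise : ∀ x p → f x * g p - (δ x p * 1ℤ + lo x * lo p * ι G x p) ≤ discrepancy G x y p q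
    pointwise x p = ℤ.≤-trans
      (compare (not (heavy x)) (not (heavy p)) (adj G q x) (adj G y p) (adj G x p) (does (x Fin.≟ p)))
      (⟦⟧-≤ (cond x p) (discrepancy-nonneg G x y p q) (unbalanced x p))

⟦∧∧⟧ : ∀ a b c → ⟦ (a Bool.∧ b) Bool.∧ c ⟧ ≡ ⟦ a ⟧ * ⟦ b ⟧ * ⟦ c ⟧
⟦∧∧⟧ a b c = trans (⟦∧⟧ (a Bool.∧ b) c) (cong (_* ⟦ c ⟧) (⟦∧⟧ a b))

∑²-*ʳ : (F : Fin n → Fin n → ℤ) → ∀ c → ∑² (λ u v → F u v * c) ≡ ∑² F * c
∑²-*ʳ F c = trans (sum-cong-≗ λ u → sym (*-distribʳ-sum c (F u))) (sym (*-distribʳ-sum c (λ u → ∑ (F u))))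

∑²-*ˡ : ∀ c (F : Fin n → Fin n → ℤ) → ∑² (λ u v → c * F u v) ≡ c * ∑² F
∑²-*ˡ c F = trans (sum-cong-≗ λ u → sym (*-distribˡ-sum c (F u))) (sym (*-distribˡ-sum c (λ u → ∑ (F u))))

-- Each light end has at least N / 4 - 1 non-neighbours, and removing the degenerate choices costs
-- one more in one factor; this explains N - 4, N - 8 and the 16.
edge-arithmetic : ∀ N d e → + 8 ≤ N → + 4 * d ≤ + 3 * N → + 4 * e ≤ + 3 * N →
                  (N - + 4) * (N - + 8) ≤
                  + 16 * ((N - 1ℤ - d) * (N - 1ℤ - e) - (N - 1ℤ - d))
edge-arithmetic N d e 8≤N dl el = ≤-by
  (0≤+ (0≤+ (0≤* (0≤- dl) (0≤- el)) (0≤* (0≤- dl) (0≤- 8≤N))) (0≤* (0≤+ (0≤- 8≤N) (0≤ℕ 4)) (0≤- el)))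
  (lem N d e)
  where
  lem : ∀ N d e → + 16 * ((N - 1ℤ - d) * (N - 1ℤ - e) - (N - 1ℤ - d)) - (N - + 4) * (N - + 8) ≡
        ((+ 3 * N - + 4 * d) * (+ 3 * N - + 4 * e) + (+ 3 * N - + 4 * d) * (N - + 8)) + (N - + 8 + + 4) * (+ 3 * N - + 4 * e)
  lem = solve-∀

heavy-arithmetic : ∀ N E s t → 0ℤ ≤ N → N ≤ + 12 * s → N ≤ + 12 * t →
                   N * N - + 144 * N - + 144 * E ≤ + 144 * (s * t - (N + E))
heavy-arithmetic N E s t 0≤N sl tl = ≤-by
  (0≤+ (0≤+ (0≤* (0≤- sl) (0≤- tl)) (0≤* 0≤N (0≤- tl))) (0≤* 0≤N (0≤- sl)))
  (lem N E s t)
  where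
  lem : ∀ N E s t → + 144 * (s * t - (N + E)) - (N * N - + 144 * N - + 144 * E) ≡
        ((+ 12 * s - N) * (+ 12 * t - N) + N * (+ 12 * t - N)) + N * (+ 12 * s - N)
  lem = solve-∀

-- `M` is twice the number of edges, and the split is on whether edges between light vertices carry
-- a thousandth of it. If they do, E (N - 4) (N - 8) is about E N² and N² ≥ 2 M, so M² ≤ 16000 Q
-- with room to spare. Otherwise M ≤ 4 N h, hence h ≥ 125 and h² - h ≥ h² / 2; as `E` is tiny, the
-- factor `B` is at least N² / 2, and M² ≤ 9216 Q with 9216 = 16 · 2 · 2 · 144.
sparse-arithmetic : ∀ N M h E Q → + 500 * N ≤ M → + 2 * M ≤ N * (N - 1ℤ) → + 1000 ≤ N →
                    0ℤ ≤ E → 0ℤ ≤ h →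
                    E * ((N - + 4) * (N - + 8)) ≤ + 16 * Q →
                    (h * h - h) * (N * N - + 144 * N - + 144 * E) ≤ + 144 * Q →
                    M ≤ E + + 2 * N * h →
                    M * M ≤ + 16000 * Q
sparse-arithmetic N M h E Q 500N≤M 2M≤ 1000≤N 0≤E 0≤h edge heavy′ cover =
  case ℤ.≤-total M (+ 1000 * E) of λ
    { (inj₁ M≤E) → manyLight M≤E
    ; (inj₂ E≤M) → fewLight E≤M }
  where
  0≤N : 0ℤ ≤ N
  0≤N = ℤ.≤-trans (0≤ℕ 1000) 1000≤N
  0≤M : 0ℤ ≤ M
  0≤M = ℤ.≤-trans (0≤* (0≤ℕ 500) 0≤N) 500N≤M
  manyLight : M ≤ + 1000 * E → M * M ≤ + 16000 * Q
  manyLight M≤E = ℤ.*-cancelˡ-≤-pos (M * M) (+ 16000 * Q) (+ 2) (≤-by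
    (0≤+ (0≤+ (0≤+ (0≤+ (0≤* (0≤ℕ 2000) (0≤- edge)) (0≤* 0≤M (0≤- 2M≤)))
         (0≤* (0≤- M≤E) (0≤* 0≤N 0≤N)))
         (0≤* (0≤* (0≤ℕ 1000) 0≤E) (0≤+ (0≤* (0≤+ (0≤- 1000≤N) (0≤ℕ 976)) 0≤N) (0≤ℕ 64))))
         (0≤* 0≤M 0≤N))
    (lem N M E Q))
    where
    lem : ∀ N M E Q → + 2 * (+ 16000 * Q) - + 2 * (M * M) ≡
          + 2000 * (+ 16 * Q - E * ((N - + 4) * (N - + 8))) + M * (N * (N - 1ℤ) - + 2 * M)
          + (+ 1000 * E - M) * (N * N)
          + + 1000 * E * ((N - + 1000 + + 976) * N + + 64)
          + M * N
    lem = solve-∀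
  fewLight : + 1000 * E ≤ M → M * M ≤ + 16000 * Q
  fewLight E≤M = ℤ.≤-trans MM≤9216Q (ℤ.*-monoʳ-≤-nonNeg Q {{ℤ.nonNegative 0≤Q}} (+≤+ (ℕ.m≤m+n 9216 6784)))
    where
    M≤4Nh : M ≤ + 4 * N * h
    M≤4Nh = ≤-by (0≤+ (0≤* (0≤ℕ 2) (0≤- cover)) (0≤+ (0≤- E≤M) (0≤* (0≤ℕ 998) 0≤E))) (lem N M E h)
      where
      lem : ∀ N M E h → + 4 * N * h - M ≡ + 2 * (E + + 2 * N * h - M) + ((M - + 1000 * E) + + 998 * E)
      lem = solve-∀
    125≤h : + 125 ≤ h
    125≤h = ℤ.*-cancelˡ-≤-pos (+ 125) h (+ 4 * N) {{ℤ.positive 0<4N}}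
      (ℤ.≤-trans (≤-by (0≤- 500N≤M) (lem N M)) M≤4Nh)
      where
      0<4N : 0ℤ < + 4 * N
      0<4N = ℤ.<-≤-trans (ℤ.+<+ (ℕ.s≤s ℕ.z≤n)) (ℤ.*-monoˡ-≤-nonNeg (+ 4) 1000≤N)
      lem : ∀ N M → M - + 4 * N * + 125 ≡ M - + 500 * N
      lem = solve-∀
    B : ℤ
    B = N * N - + 144 * N - + 144 * E
    NN≤2B : N * N ≤ + 2 * B
    NN≤2B = ℤ.*-cancelˡ-≤-pos (N * N) (+ 2 * B) (+ 1000) (≤-by
      (0≤+ (0≤+ (0≤* (0≤ℕ 288) (0≤- E≤M)) (0≤* (0≤ℕ 144) (0≤- 2M≤)))
           (0≤* (0≤+ (0≤* (0≤ℕ 856) (0≤- 1000≤N)) (0≤ℕ 568144)) 0≤N))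
      (lem N M E))
      where
      lem : ∀ N M E → + 1000 * (+ 2 * (N * N - + 144 * N - + 144 * E)) - + 1000 * (N * N) ≡
            + 288 * (M - + 1000 * E) + + 144 * (N * (N - 1ℤ) - + 2 * M)
            + (+ 856 * (N - + 1000) + + 568144) * N
      lem = solve-∀
    0≤B : 0ℤ ≤ B
    0≤B = ℤ.*-cancelˡ-≤-pos 0ℤ B (+ 2) (ℤ.≤-trans (0≤* 0≤N 0≤N) NN≤2B)
    hh : h * h ≤ + 2 * (h * h - h)
    hh = ≤-by (0≤* 0≤h (0≤+ (0≤- 125≤h) (0≤ℕ 123))) (lem h)
      where
      lem : ∀ h → + 2 * (h * h - h) - h * h ≡ h * (h - + 125 + + 123)
      lem = solve-∀
    MM≤16 : M * M ≤ (+ 4 * N * h) * (+ 4 * N * h)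
    MM≤16 = *-mono-≤ 0≤M (ℤ.≤-trans 0≤M M≤4Nh) M≤4Nh M≤4Nh
    hhNN : (h * h) * (N * N) ≤ (+ 2 * (h * h - h)) * (+ 2 * B)
    hhNN = *-mono-≤ (0≤* 0≤h 0≤h) (0≤* (0≤ℕ 2) 0≤B) hh NN≤2B
    MM≤9216Q : M * M ≤ + 9216 * Q
    MM≤9216Q = ≤-by (0≤+ (0≤+ (0≤- MM≤16) (0≤* (0≤ℕ 16) (0≤- hhNN))) (0≤* (0≤ℕ 64) (0≤- heavy′)))
      (lem N M h (h * h - h) B Q)
      where
      lem : ∀ N M h k B Q → + 9216 * Q - M * M ≡
            ((+ 4 * N * h) * (+ 4 * N * h) - M * M) + + 16 * ((+ 2 * k) * (+ 2 * B) - (h * h) * (N * N))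
            + + 64 * (+ 144 * Q - k * B)
      lem = solve-∀
    0≤Q : 0ℤ ≤ Q
    0≤Q = ℤ.*-cancelˡ-≤-pos 0ℤ Q (+ 9216) (ℤ.≤-trans (0≤* 0≤M 0≤M) MM≤9216Q)

module _ (G : Graph (Fin n)) where

  private
    N = + n
    Q = totalDiscrepancy G

  totalDiscrepancy-local : Q ≡ ∑² (local G)
  totalDiscrepancy-local = ∑⁴-reorder (discrepancy G)

  edge-bound : 8 ℕ.≤ n → E G * ((N - + 4) * (N - + 8)) ≤ + 16 * Q
  edge-bound 8≤n = begin
    E G * c                        ≡⟨ ∑²-*ʳ (λ u v → lo G u * lo G v * ι G u v) c ⟨
    ∑² (λ y q → lo G y * lo G q * ι G y q * c) ≤⟨ ∑²-mono pointwise ⟩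
    ∑² (λ y q → + 16 * local G y q) ≡⟨ ∑²-*ˡ (+ 16) (local G) ⟩
    + 16 * ∑² (local G)            ≡⟨ cong (+ 16 *_) totalDiscrepancy-local ⟨
    + 16 * Q ∎
    where
    open ℤ.≤-Reasoning
    c = (N - + 4) * (N - + 8)
    pointwise : ∀ y q → lo G y * lo G q * ι G y q * c ≤ + 16 * local G y q
    pointwise y q = subst (λ z → z * c ≤ + 16 * local G y q) (⟦∧∧⟧ (not (heavy G y)) (not (heavy G q)) (adj G y q))
      (⟦⟧-≤ ((not (heavy G y) Bool.∧ not (heavy G q)) Bool.∧ adj G y q) (0≤* (0≤ℕ 16) (local-nonneg G y q)) good)
      where
      good : (not (heavy G y) Bool.∧ not (heavy G q)) Bool.∧ adj G y q ≡ true → c ≤ + 16 * local G y q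
      good all with ∧-true⁻ all
      ... | light , yq with ∧-true⁻ light
      ...   | ly , lq = ℤ.≤-trans
        (edge-arithmetic N (deg G q) (deg G y) (+≤+ 8≤n) (light⇒ G (not-true⁻ lq)) (light⇒ G (not-true⁻ ly)))
        (ℤ.*-monoˡ-≤-nonNeg (+ 16) (subst (_≤ local G y q)
          (cong₂ (λ a b → a * b - a) (codegree G q) (codegree G y)) (local-edge G yq)))

  light-degree : ∀ y → deg G y ≤ ∑ (λ p → lo G p * ι G y p) + h G
  light-degree y = ℤ.≤-trans (∑-mono λ p → pointwise (heavy G p) (adj G y p))
    (ℤ.≤-reflexive (∑-distrib-+ (λ p → lo G p * ι G y p) (hi G)))
    where
    pointwise : ∀ a b → ⟦ b ⟧ ≤ ⟦ not a ⟧ * ⟦ b ⟧ + ⟦ a ⟧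
    pointwise true  b     = ⟦⟧≤1 b
    pointwise false true  = ℤ.≤-refl
    pointwise false false = ℤ.≤-refl

  heavy-bound : + 3 * h G ≤ + 2 * N → (h G * h G - h G) * (N * N - + 144 * N - + 144 * E G) ≤ + 144 * Q
  heavy-bound 3h≤2N = begin
    (h G * h G - h G) * c            ≡⟨ cong (_* c) pairs ⟨
    ∑² (λ y q → hi G y * hi G q * ι (complete n) y q) * c
      ≡⟨ ∑²-*ʳ (λ y q → hi G y * hi G q * ι (complete n) y q) c ⟨
    ∑² (λ y q → hi G y * hi G q * ι (complete n) y q * c) ≤⟨ ∑²-mono pointwise ⟩
    ∑² (λ y q → + 144 * local G y q) ≡⟨ ∑²-*ˡ (+ 144) (local G) ⟩
    + 144 * ∑² (local G)            ≡⟨ cong (+ 144 *_) totalDiscrepancy-local ⟨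
    + 144 * Q ∎
    where
    open ℤ.≤-Reasoning
    c = N * N - + 144 * N - + 144 * E G
    idem : ∀ b → ⟦ b ⟧ * ⟦ b ⟧ ≡ ⟦ b ⟧
    idem true  = refl
    idem false = refl
    distr : ∀ a b d → a * b * (1ℤ - d) ≡ a * b - d * (a * b)
    distr = solve-∀
    pairs : ∑² (λ y q → hi G y * hi G q * ι (complete n) y q) ≡ h G * h G - h G
    pairs = trans (∑²-cong λ y q → trans (cong (hi G y * hi G q *_) (ι-complete y q)) (distr (hi G y) (hi G q) (δ y q)))
      (trans (∑²-distrib-- (λ y q → hi G y * hi G q) (λ y q → δ y q * (hi G y * hi G q)))
        (cong₂ _-_ (∑∑-* (hi G) (hi G))
          (sum-cong-≗ λ y → trans (∑-δ y (λ q → hi G y * hi G q)) (idem (heavy G y)))))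
    pointwise : ∀ y q → hi G y * hi G q * ι (complete n) y q * c ≤ + 144 * local G y q
    pointwise y q = subst (λ z → z * c ≤ + 144 * local G y q) (⟦∧∧⟧ (heavy G y) (heavy G q) (adj (complete n) y q))
      (⟦⟧-≤ ((heavy G y Bool.∧ heavy G q) Bool.∧ adj (complete n) y q) (0≤* (0≤ℕ 144) (local-nonneg G y q)) good)
      where
      many : ∀ {v} → heavy G v ≡ true → N ≤ + 12 * ∑ (λ p → lo G p * ι G v p)
      many {v} hv = ≤-by (0≤+ (0≤+ (0≤* (0≤ℕ 12) (0≤- (light-degree v))) (0≤* (0≤ℕ 3) (0≤- (heavy⇒ G hv))))
                              (0≤* (0≤ℕ 4) (0≤- 3h≤2N)))
        (lem N (∑ (λ p → lo G p * ι G v p)) (deg G v) (h G))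
        where
        lem : ∀ N s d h → + 12 * s - N ≡ (+ 12 * (s + h - d) + + 3 * (+ 4 * d - + 3 * N)) + + 4 * (+ 2 * N - + 3 * h)
        lem = solve-∀
      good : (heavy G y Bool.∧ heavy G q) Bool.∧ adj (complete n) y q ≡ true → c ≤ + 144 * local G y q
      good all with ∧-true⁻ all
      ... | heavies , yq with ∧-true⁻ heavies
      ...   | hy , hq = ℤ.≤-trans
        (heavy-arithmetic N (E G) (∑ (λ p → lo G p * ι G q p)) (∑ (λ p → lo G p * ι G y p)) (0≤ℕ n) (many hq) (many hy))
        (ℤ.*-monoˡ-≤-nonNeg (+ 144) (local-heavy G hy hq (complete-adj⁻ yq)))

  -- Markov's inequality for degrees: heavy vertices account for 3 n h / 4 of a degree sum that is
  -- at most n² / 2.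
  few-heavy : + 2 * degreeSum G ≤ N * (N - 1ℤ) → 0ℤ < N → + 3 * h G ≤ + 2 * N
  few-heavy 2M≤ 0<N = ℤ.*-cancelˡ-≤-pos (+ 3 * h G) (+ 2 * N) N {{ℤ.positive 0<N}}
    (≤-by (0≤+ (0≤+ (0≤- 3Nh≤4M) (0≤* (0≤ℕ 2) (0≤- 2M≤))) (0≤* (0≤ℕ 2) (ℤ.<⇒≤ 0<N))) (lem N (degreeSum G) (h G)))
    where
    lem : ∀ N M h → N * (+ 2 * N) - N * (+ 3 * h) ≡
          ((+ 4 * M - + 3 * N * h) + + 2 * (N * (N - 1ℤ) - + 2 * M)) + + 2 * N
    lem = solve-∀
    3Nh≤4M : + 3 * N * h G ≤ + 4 * degreeSum G
    3Nh≤4M = ℤ.≤-trans (ℤ.≤-reflexive (trans (ℤ.*-comm (+ 3 * N) (h G)) (*-distribʳ-sum (+ 3 * N) (hi G))))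
      (ℤ.≤-trans (∑-mono λ v → ⟦⟧-≤ (heavy G v) (0≤* (0≤ℕ 4) (∑-nonneg λ w → ⟦⟧-nonneg (adj G v w))) (heavy⇒ G))
        (ℤ.≤-reflexive (sym (*-distribˡ-sum (+ 4) (deg G)))))

  -- An adjacent pair not counted in `E` has a heavy end, and at most 2 n h ordered pairs do.
  light-cover : degreeSum G ≤ E G + + 2 * N * h G
  light-cover = begin
    ∑² (ι G)
      ≤⟨ ∑²-mono (λ u v → pointwise (heavy G u) (heavy G v) (adj G u v)) ⟩
    ∑² (λ u v → lo G u * lo G v * ι G u v + (hi G u * 1ℤ + 1ℤ * hi G v))
      ≡⟨ ∑²-+ (λ u v → lo G u * lo G v * ι G u v) (λ u v → hi G u * 1ℤ + 1ℤ * hi G v) ⟩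
    E G + ∑² (λ u v → hi G u * 1ℤ + 1ℤ * hi G v)
      ≡⟨ cong (λ z → E G + z) (trans (∑²-+ (λ u v → hi G u * 1ℤ) (λ u v → 1ℤ * hi G v))
           (cong₂ _+_ (∑∑-* {n} {n} (hi G) (λ _ → 1ℤ)) (∑∑-* {n} {n} (λ _ → 1ℤ) (hi G)))) ⟩
    E G + (h G * ∑ {n} (λ _ → 1ℤ) + ∑ {n} (λ _ → 1ℤ) * h G)
      ≡⟨ cong (λ z → E G + (h G * z + z * h G)) (trans (∑-const {n} 1ℤ) (ℤ.*-identityʳ N)) ⟩
    E G + (h G * N + N * h G)
      ≡⟨ lem (E G) N (h G) ⟩
    E G + + 2 * N * h G ∎
    where
    open ℤ.≤-Reasoning
    lem : ∀ E N h → E + (h * N + N * h) ≡ E + + 2 * N * h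
    lem = solve-∀
    pointwise : ∀ a b c → ⟦ c ⟧ ≤ ⟦ not a ⟧ * ⟦ not b ⟧ * ⟦ c ⟧ + (⟦ a ⟧ * 1ℤ + 1ℤ * ⟦ b ⟧)
    pointwise true  true  true  = +≤+ (ℕ.s≤s ℕ.z≤n)
    pointwise true  false true  = +≤+ (ℕ.s≤s ℕ.z≤n)
    pointwise false true  true  = +≤+ (ℕ.s≤s ℕ.z≤n)
    pointwise false false true  = +≤+ (ℕ.s≤s ℕ.z≤n)
    pointwise true  true  false = +≤+ ℕ.z≤n
    pointwise true  false false = +≤+ ℕ.z≤n
    pointwise false true  false = +≤+ ℕ.z≤n
    pointwise false false false = +≤+ ℕ.z≤n

  discrepancy-lower-bound : + 500 * N ≤ degreeSum G → + 2 * degreeSum G ≤ N * (N - 1ℤ) → 1000 ℕ.≤ n →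
                            degreeSum G * degreeSum G ≤ + 16000 * Q
  discrepancy-lower-bound 500N≤M 2M≤ 1000≤n =
    sparse-arithmetic N (degreeSum G) (h G) (E G) Q 500N≤M 2M≤ (+≤+ 1000≤n)
      (∑²-nonneg λ u v → 0≤* (0≤* (⟦⟧-nonneg (not (heavy G u))) (⟦⟧-nonneg (not (heavy G v)))) (⟦⟧-nonneg (adj G u v)))
      (∑-nonneg λ v → ⟦⟧-nonneg (heavy G v))
      (edge-bound (ℕ.≤-trans (ℕ.m≤m+n 8 992) 1000≤n))
      (heavy-bound (few-heavy 2M≤ (ℤ.<-≤-trans (ℤ.+<+ (ℕ.s≤s ℕ.z≤n)) (+≤+ 1000≤n))))
      light-cover

-- Graphs without discrepancy

-- Equivalently, any two rows `x` and `y` of the adjacency matrix differ by a constant away from the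
-- columns `x` and `y`.
Balanced : Graph (Fin n) → Set
Balanced G = ∀ {x y p q} → Distinct x y p q → ι G y q - ι G x q ≡ ι G y p - ι G x p

complement-adj⁺ : ∀ (G : Graph (Fin n)) {u v} → u ≢ v → adj G u v ≡ false → adj (complement G) u v ≡ true
complement-adj⁺ G u≢v uv = cong₂ (λ a b → a Bool.∧ not b) (complete-adj⁺ u≢v) uv

balanced : (G : Graph (Fin n)) → totalDiscrepancy G ≡ 0ℤ → Balanced G
balanced {n} G Q≡0 {x} {y} {p} {q} dist = ℤ.i-j≡0⇒i≡j _ _ (ℤ.∣i∣≡0⇒i≡0 (ℤ.+-injective (ℤ.≤-antisym Z≤0 (0≤ℕ _))))
  where
  Z = + ∣ (ι G y q - ι G x q) - (ι G y p - ι G x p) ∣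
  term≤∑² : ∀ {F : Fin n → Fin n → ℤ} → (∀ u v → 0ℤ ≤ F u v) → ∀ u v → F u v ≤ ∑² F
  term≤∑² {F} 0≤F u v = ℤ.≤-trans (term≤∑ (0≤F u) v) (term≤∑ {f = λ u → ∑ (F u)} (λ u → ∑-nonneg (0≤F u)) u)
  Z≤0 : Z ≤ 0ℤ
  Z≤0 = begin
    Z                         ≡⟨ trans (cong (λ b → ⟦ b ⟧ * Z) (dec-true (distinct? x y p q) dist)) (ℤ.*-identityˡ Z) ⟨
    discrepancy G x y p q     ≤⟨ term≤∑² (discrepancy-nonneg G x y) p q ⟩
    ∑² (discrepancy G x y)    ≤⟨ term≤∑² {λ x y → ∑² (discrepancy G x y)} (λ x y → ∑²-nonneg (discrepancy-nonneg G x y)) x y ⟩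
    totalDiscrepancy G        ≡⟨ Q≡0 ⟩
    0ℤ ∎
    where open ℤ.≤-Reasoning

-- The rows of `b` and `d` differ by 1 at `v`, hence everywhere else: `b` is adjacent to all
-- vertices and `d` to `b` alone. Comparing other rows with that of `b` makes `G` a star centred at
-- `b`.
star-degreeSum : ∀ (G : Graph (Fin n)) → Balanced G → ∀ {v b d} →
                 adj G b v ≡ true → adj G d v ≡ false → d ≢ v → adj G b d ≡ true →
                 degreeSum G ≡ + 2 * (+ n - 1ℤ)
star-degreeSum {n} G bal {v} {b} {d} bv dv d≢v bd = begin
  ∑² (ι G)
    ≡⟨ ∑²-cong star ⟩
  ∑² (λ u w → δ b u * 1ℤ + (δ b w * 1ℤ - δ b u * (δ b w * + 2)))
    ≡⟨ trans (∑²-+ (λ u w → δ b u * 1ℤ) (λ u w → δ b w * 1ℤ - δ b u * (δ b w * + 2)))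
         (cong (λ z → ∑² (λ u (w : Fin n) → δ b u * 1ℤ) + z)
           (∑²-distrib-- (λ u w → δ b w * 1ℤ) (λ u w → δ b u * (δ b w * + 2)))) ⟩
  ∑² (λ u (w : Fin n) → δ b u * 1ℤ) + (∑² (λ (u : Fin n) w → δ b w * 1ℤ) - ∑² (λ u w → δ b u * (δ b w * + 2)))
    ≡⟨ cong₂ _+_ (trans (∑-comm {n} {n} λ u w → δ b u * 1ℤ) rows) (cong₂ _-_ rows both) ⟩
  + n + (+ n - + 2)
    ≡⟨ lem (+ n) ⟩
  + 2 * (+ n - 1ℤ) ∎
  where
  open ≡-Reasoning
  lem : ∀ N → N + (N - + 2) ≡ + 2 * (N - 1ℤ)
  lem = solve-∀
  rows : ∑ {n} (λ _ → ∑ (λ w → δ b w * 1ℤ)) ≡ + n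
  rows = trans (sum-cong-≗ {n} λ _ → ∑-δ b (λ _ → 1ℤ)) (trans (∑-const {n} 1ℤ) (ℤ.*-identityʳ (+ n)))
  both : ∑² (λ u w → δ b u * (δ b w * + 2)) ≡ + 2
  both = trans (sum-cong-≗ λ u → sym (*-distribˡ-sum (δ b u) (λ w → δ b w * + 2)))
    (trans (∑-δ b (λ _ → ∑ {n} λ w → δ b w * + 2)) (∑-δ b (λ _ → + 2)))
  b≢d : b ≢ d
  b≢d = adj⇒≢ G bd
  b≢v : b ≢ v
  b≢v = adj⇒≢ G bv
  force : ∀ s t → ⟦ s ⟧ - ⟦ t ⟧ ≡ 1ℤ → s ≡ true × t ≡ false
  force true  false _ = refl , refl
  force true  true  ()
  force false true  ()
  force false false ()
  spokes : ∀ w → b ≢ w → d ≢ w → adj G b w ≡ true × adj G d w ≡ false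
  spokes w b≢w d≢w with v Fin.≟ w
  ... | yes refl = bv , dv
  ... | no  v≢w  = force (adj G b w) (adj G d w) (trans
    (bal {d} {b} {v} {w} (b≢d ∘ sym , (d≢v , b≢v) , (d≢w , b≢w , v≢w)))
    (cong₂ (λ s t → ⟦ s ⟧ - ⟦ t ⟧) bv dv))
  hub-adj : ∀ w → b ≢ w → adj G b w ≡ true
  hub-adj w b≢w with d Fin.≟ w
  ... | yes refl = bd
  ... | no  d≢w  = proj₁ (spokes w b≢w d≢w)
  cancel : ∀ s → ⟦ s ⟧ - 1ℤ ≡ 0ℤ - 1ℤ → s ≡ false
  cancel false _ = refl
  cancel true ()
  rim : ∀ u w → b ≢ u → b ≢ w → adj G u w ≡ false
  rim u w b≢u b≢w with u Fin.≟ w | d Fin.≟ u | d Fin.≟ w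
  ... | yes refl | _        | _        = adj-irrefl G u
  ... | no u≢w   | yes refl | _        = proj₂ (spokes w b≢w u≢w)
  ... | no u≢w   | no  d≢u  | yes refl = trans (adj-sym G u w) (proj₂ (spokes u b≢u d≢u))
  -- The rows of `b` and `u` differ by 1 at `d`, hence also at `w`, where `b` has an edge.
  ... | no u≢w   | no  d≢u  | no  d≢w  = cancel (adj G u w) (trans
    (cong (λ s → ι G u w - ⟦ s ⟧) (sym (hub-adj w b≢w)))
    (trans (bal {b} {u} {d} {w} (b≢u , (b≢d , d≢u ∘ sym) , (b≢w , u≢w , d≢w)))
      (cong₂ (λ s t → ⟦ s ⟧ - ⟦ t ⟧) (trans (adj-sym G u d) (proj₂ (spokes u b≢u d≢u))) bd)))
  -- The 2 cancels the pair (b, b), which both of the first two terms count.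
  star : ∀ u w → ι G u w ≡ δ b u * 1ℤ + (δ b w * 1ℤ - δ b u * (δ b w * + 2))
  star u w = go (b Fin.≟ u) (b Fin.≟ w)
    where
    go : Dec (b ≡ u) → Dec (b ≡ w) → ι G u w ≡ δ b u * 1ℤ + (δ b w * 1ℤ - δ b u * (δ b w * + 2))
    go (yes refl) (yes refl) rewrite δ-refl b | adj-irrefl G b = refl
    go (yes refl) (no b≢w)   rewrite δ-refl b | δ-≢ b≢w | hub-adj w b≢w = refl
    go (no b≢u)   (yes refl) rewrite δ-refl b | δ-≢ b≢u | adj-sym G u b | hub-adj u b≢u = refl
    go (no b≢u)   (no b≢w)   rewrite δ-≢ b≢u | δ-≢ b≢w | rim u w b≢u b≢w = refl

-- The search is for a vertex `v` with a neighbour `b` and a non-neighbour `d`. If bd is an edge,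
-- `G` is a star centred at `b`; if not, the complement is a star centred at `d`. When no vertex is
-- mixed, a single edge makes every vertex have a neighbour and so rules out all non-edges.
balanced-degreeSum : ∀ (G : Graph (Fin n)) → totalDiscrepancy G ≡ 0ℤ →
                     (degreeSum G ≡ 0ℤ ⊎ degreeSum (complement G) ≡ 0ℤ) ⊎
                     (degreeSum G ≡ + 2 * (+ n - 1ℤ) ⊎ degreeSum (complement G) ≡ + 2 * (+ n - 1ℤ))
balanced-degreeSum {n} G Q≡0
  with Fin.any? (λ v → Fin.any? λ b → Fin.any? λ d →
         (adj G b v Bool.≟ true) ×-dec (adj (complement G) d v Bool.≟ true))
... | yes (v , b , d , bv , dv) = inj₂ (mixed (adj G b d) refl)
  where
  d≢v = proj₁ (complement-adj⁻ G dv)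
  ¬dv = proj₂ (complement-adj⁻ G dv)
  mixed : ∀ s → adj G b d ≡ s → degreeSum G ≡ + 2 * (+ n - 1ℤ) ⊎ degreeSum (complement G) ≡ + 2 * (+ n - 1ℤ)
  mixed true  bd  = inj₁ (star-degreeSum G (balanced G Q≡0) bv ¬dv d≢v bd)
  mixed false ¬bd = inj₂ (star-degreeSum (complement G)
    (balanced (complement G) (trans (totalDiscrepancy-complement G) Q≡0)) dv
    (cong₂ (λ s t → s Bool.∧ not t) (complete-adj⁺ (adj⇒≢ G bv)) bv) (adj⇒≢ G bv)
    (complement-adj⁺ G (λ d≡b → contradiction (trans (sym bv) (trans (cong (λ z → adj G z v) (sym d≡b)) ¬dv)) λ ())
      (trans (adj-sym G d b) ¬bd)))
... | no  pure with Fin.any? (λ u → Fin.any? λ w → adj G u w Bool.≟ true)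
...   | no  empty = inj₁ (inj₁ (∑-zero λ u → ∑-zero λ w → cong ⟦_⟧ (≢true⇒false λ uw → empty (u , w , uw))))
...   | yes (u , w , uw) = inj₁ (inj₂ (∑-zero λ s → ∑-zero λ t → cong ⟦_⟧ (≢true⇒false λ st →
  let t-nbr , st-nbr = nonempty t in pure (t , t-nbr , s , st-nbr , st))))
  where
  nonempty : ∀ t → ∃ λ s → adj G s t ≡ true
  nonempty t with u Fin.≟ t
  ... | yes refl = w , trans (adj-sym G w u) uw
  ... | no  u≢t with adj G u t in ut
  ...   | true  = u , ut
  ...   | false = contradiction (u , w , t , trans (adj-sym G w u) uw ,
                    complement-adj⁺ G (u≢t ∘ sym) (trans (adj-sym G t u) ut)) pure

-- Otherwise n would divide 2 n - 2 (n - 1) = 2.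
star-indivisible : 4 ℕ.≤ n → ∀ k → + n * k ≢ + 2 * (+ n - 1ℤ)
star-indivisible {n} 4≤n k eq = contradiction (ℕ.∣⇒≤ n∣2) (ℕ.<⇒≱ (ℕ.≤-trans (ℕ.s≤s (ℕ.s≤s (ℕ.s≤s ℕ.z≤n))) 4≤n))
  where
  lem : ∀ N k → N * (+ 2 - k) ≡ + 2 * (N - 1ℤ) + + 2 - N * k
  lem = solve-∀
  lem′ : ∀ a → a + + 2 - a ≡ + 2
  lem′ = solve-∀
  n∣2 : n ℕ.∣ 2
  n∣2 = ℕ.divides ∣ + 2 - k ∣ (trans
    (cong ∣_∣ (sym (trans (lem (+ n) k) (trans (cong (λ z → + 2 * (+ n - 1ℤ) + + 2 - z) eq) (lem′ (+ 2 * (+ n - 1ℤ)))))))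
    (trans (ℤ.abs-* (+ n) (+ 2 - k)) (ℕ.*-comm n ∣ + 2 - k ∣)))

balanced-indivisible : ∀ (G : Graph (Fin n)) → 4 ℕ.≤ n → totalDiscrepancy G ≡ 0ℤ → ∀ k → degreeSum G ≡ + n * k →
                       degreeSum G ≡ 0ℤ ⊎ degreeSum (complement G) ≡ 0ℤ
balanced-indivisible {n} G 4≤n Q≡0 k divisible with balanced-degreeSum G Q≡0
... | inj₁ trivial     = trivial
... | inj₂ (inj₁ star) = contradiction (trans (sym divisible) star) (star-indivisible 4≤n k)
... | inj₂ (inj₂ star) = contradiction (trans (lem (+ n) k) (trans (cong (λ z → + n * (+ n - 1ℤ) - z) (sym divisible))
    (trans (sym (degreeSum-complement G)) star))) (star-indivisible 4≤n (+ n - 1ℤ - k))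
  where
  lem : ∀ N k → N * (N - 1ℤ - k) ≡ N * (N - 1ℤ) - N * k
  lem = solve-∀

-- The main inequality over the integers

square-nonneg : ∀ z → 0ℤ ≤ z * z
square-nonneg (+ j)        = 0≤* (0≤ℕ j) (0≤ℕ j)
square-nonneg (ℤ.-[1+ j ]) = 0≤ℕ _

-- The constant C is 1 / inverseC. The numerals are opaque so that products with them are never unfolded.
abstract
  scale : ℤ
  scale = + 50000

  inverseC : ℕ
  inverseC = 100000

  2*scale : + 2 * scale ≡ + inverseC
  2*scale = refl

  inverseC-nonZero : NonZero inverseC
  inverseC-nonZero = _

  scale-≥ : ∀ k → k ℕ.≤ 50000 → + k ≤ scale
  scale-≥ k k≤ = +≤+ k≤

module _ (c : ℤ) where

  -- The bound of the theorem with C = 1 / (2 c) and `μ` for m*, multiplied by 2 c N⁴ to clear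
  -- denominators.
  Target : (N D m μ e : ℤ) → Set
  Target N D m μ e = + 4 * c * m * (N * N * N) + (N - 1ℤ - D) * (μ * μ) ≤ + 2 * c * e * (N * N * N * N)

  -- The correction (N - 1 - D) μ² is at most 6 k s Q, while the embedding offers a surplus of c k
  -- Q.
  many-discrepancy-arithmetic :
    ∀ s N D m μ k Q e → 0ℤ ≤ c → + 6 * s ≤ c → 0ℤ ≤ k → 0ℤ ≤ Q → N ≤ + 6 * k + 1ℤ + D → μ * μ ≤ s * Q →
    + 2 * (+ 2 * m) * (N * N * N) + k * Q ≤ N * (N * (N * (N * (+ 2 * e)))) → Target N D m μ e
  many-discrepancy-arithmetic s N D m μ k Q e 0≤c 6s≤c 0≤k 0≤Q gadgets μμ≤ embedding = ≤-by
    (0≤+ (0≤+ (0≤+ (0≤* 0≤c (0≤- embedding)) (0≤* (0≤- gadgets) (square-nonneg μ)))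
         (0≤* (0≤* (0≤ℕ 6) 0≤k) (0≤- μμ≤)))
         (0≤* (0≤- 6s≤c) (0≤* 0≤k 0≤Q)))
    (lem c s N D m μ k Q e)
    where
    lem : ∀ c s N D m μ k Q e →
          + 2 * c * e * (N * N * N * N) - (+ 4 * c * m * (N * N * N) + (N - 1ℤ - D) * (μ * μ)) ≡
          c * (N * (N * (N * (N * (+ 2 * e)))) - (+ 2 * (+ 2 * m) * (N * N * N) + k * Q))
          + (+ 6 * k + 1ℤ + D - N) * (μ * μ) + + 6 * k * (s * Q - μ * μ) + (c - + 6 * s) * (k * Q)
    lem = solve-∀

  -- Beating the mean by 1 / N is worth 2 c N³ after scaling, while the correction is at most N (s
  -- N)².
  integral-arithmetic :
    ∀ s N D m μ e → 0ℤ ≤ c → s * s ≤ + 2 * c → 0ℤ ≤ s → 0ℤ ≤ N → 0ℤ ≤ D → 0ℤ ≤ μ → μ ≤ s * N →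
    1ℤ + + 2 * m ≤ e * N → Target N D m μ e
  integral-arithmetic s N D m μ e 0≤c ss≤ 0≤s 0≤N 0≤D 0≤μ small above = ≤-by
    (0≤+ (0≤+ (0≤+ (0≤* (0≤* (0≤* (0≤ℕ 2) 0≤c) (0≤* (0≤* 0≤N 0≤N) 0≤N)) (0≤- above))
         (0≤* 0≤N (0≤- (*-mono-≤ 0≤μ (0≤* 0≤s 0≤N) small small)))) (0≤* (0≤+ (0≤ℕ 1) 0≤D) (square-nonneg μ)))
         (0≤* (0≤- ss≤) (0≤* (0≤* 0≤N 0≤N) 0≤N)))
    (lem c s N D m μ e)
    where
    lem : ∀ c s N D m μ e →
          + 2 * c * e * (N * N * N * N) - (+ 4 * c * m * (N * N * N) + (N - 1ℤ - D) * (μ * μ)) ≡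
          + 2 * c * (N * N * N) * (e * N - (1ℤ + + 2 * m)) + N * ((s * N) * (s * N) - μ * μ)
          + (1ℤ + D) * (μ * μ) + (+ 2 * c - s * s) * (N * N * N)
    lem = solve-∀

  average-arithmetic :
    ∀ N D m μ e → 0ℤ ≤ c → N ≤ 1ℤ + D ⊎ μ ≡ 0ℤ →
    + 2 * (+ 2 * m) * (N * N * N) ≤ N * (N * (N * (N * (+ 2 * e)))) → Target N D m μ e
  average-arithmetic N D m μ e 0≤c trivial embedding = ≤-by
    (0≤+ (0≤* 0≤c (0≤- embedding)) (correction trivial))
    (lem c N D m μ e)
    where
    correction : N ≤ 1ℤ + D ⊎ μ ≡ 0ℤ → 0ℤ ≤ (1ℤ + D - N) * (μ * μ)
    correction (inj₁ le)   = 0≤* (0≤- le) (square-nonneg μ)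
    correction (inj₂ refl) = ℤ.≤-reflexive (sym (ℤ.*-zeroʳ (1ℤ + D - N)))
    lem : ∀ c N D m μ e →
          + 2 * c * e * (N * N * N * N) - (+ 4 * c * m * (N * N * N) + (N - 1ℤ - D) * (μ * μ)) ≡
          c * (N * (N * (N * (N * (+ 2 * e)))) - + 2 * (+ 2 * m) * (N * N * N)) + (1ℤ + D - N) * (μ * μ)
    lem = solve-∀

-- From gadgets and discrepancy to the integer inequality

module _ (A G : Graph (Fin n)) (tree : IsTree A) where

  private
    N = + n
    D = + maxDegree A
    Q = totalDiscrepancy G

  Q-nonneg : 0ℤ ≤ Q
  Q-nonneg = ∑²-nonneg λ x y → ∑²-nonneg (discrepancy-nonneg G x y)

  0<N : 0ℤ < N
  0<N = ℤ.+<+ (ℕ.≤-trans (ℕ.s≤s ℕ.z≤n) (Fin.toℕ<n (IsTree.nonempty tree)))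

  module _ {m μ : ℤ} (degrees : degreeSum G ≡ + 2 * m) (0≤μ : 0ℤ ≤ μ)
           (minority : + 2 * μ ≡ degreeSum G ⊎ + 2 * μ ≡ degreeSum (complement G))
           (2μ≤M : + 2 * μ ≤ degreeSum G) (2μ≤M̄ : + 2 * μ ≤ degreeSum (complement G)) where

    4μ≤ : + 2 * (+ 2 * μ) ≤ N * (N - 1ℤ)
    4μ≤ = ≤-by (0≤+ (0≤- 2μ≤M) (0≤- (subst (+ 2 * μ ≤_) (degreeSum-complement G) 2μ≤M̄)))
      (lem μ (N * (N - 1ℤ)) (degreeSum G))
      where
      lem : ∀ μ c M → c - + 2 * (+ 2 * μ) ≡ (M - + 2 * μ) + (c - M - + 2 * μ)
      lem = solve-∀

    large-discrepancy : + 500 * N ≤ + 2 * μ → μ * μ ≤ + 4000 * Q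
    large-discrepancy large = ℤ.*-cancelˡ-≤-pos (μ * μ) (+ 4000 * Q) (+ 4)
      (ℤ.≤-trans (ℤ.≤-reflexive (square μ)) (ℤ.≤-trans (bound′ minority) (ℤ.≤-reflexive (trans (cong (_* Q) 16000≡) (ℤ.*-assoc (+ 4) (+ 4000) Q)))))
      where
      16000≡ : + 16000 ≡ + 4 * + 4000
      16000≡ = refl
      square : ∀ μ → + 4 * (μ * μ) ≡ (+ 2 * μ) * (+ 2 * μ)
      square = solve-∀
      -- From 500 n ≤ 2 m* and 4 m* ≤ n (n - 1) it follows that n is large, so small n needs no
      -- separate treatment here.
      1000≤N-1 : + 1000 ≤ N - 1ℤ
      1000≤N-1 = ℤ.*-cancelˡ-≤-pos (+ 1000) (N - 1ℤ) N {{ℤ.positive 0<N}} (≤-by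
        (0≤+ (0≤- 4μ≤) (0≤* (0≤ℕ 2) (0≤- large))) (lem N μ))
        where
        lem : ∀ N μ → N * (N - 1ℤ) - N * + 1000 ≡ (N * (N - 1ℤ) - + 2 * (+ 2 * μ)) + + 2 * (+ 2 * μ - + 500 * N)
        lem = solve-∀
      1000≤n : 1000 ℕ.≤ n
      1000≤n = ℤ.drop‿+≤+ (ℤ.≤-trans 1000≤N-1 (ℤ.i≤j⇒i-k≤j (+ 1) ℤ.≤-refl))
      bound′ : + 2 * μ ≡ degreeSum G ⊎ + 2 * μ ≡ degreeSum (complement G) →
               (+ 2 * μ) * (+ 2 * μ) ≤ + 16000 * Q
      bound′ (inj₁ eq) = subst (λ M → M * M ≤ + 16000 * Q) (sym eq)
        (discrepancy-lower-bound G (subst (+ 500 * N ≤_) eq large)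
          (subst (λ M → + 2 * M ≤ N * (N - 1ℤ)) eq 4μ≤) 1000≤n)
      bound′ (inj₂ eq) = subst₂ (λ M Q′ → M * M ≤ + 16000 * Q′) (sym eq) (totalDiscrepancy-complement G)
        (discrepancy-lower-bound (complement G) (subst (+ 500 * N ≤_) eq large)
          (subst (λ M → + 2 * M ≤ N * (N - 1ℤ)) eq 4μ≤) 1000≤n)

    Goal : ℤ → Set
    Goal = Target scale N D m μ

    Embedded : ℤ → ℤ → Set
    Embedded k e = + 2 * (+ 2 * m) * (N * N * N) + k * Q ≤ N * (N * (N * (N * (+ 2 * e))))

    embedded⇒goal : ∀ k e → 4 ℕ.≤ n → 1ℤ ≤ k → N ≤ + 6 * k + 1ℤ + D → Embedded k e → Goal e
    embedded⇒goal k e 4≤n 1≤k gadgets embedded = cases (ℤ.≤-total (+ 500 * N) (+ 2 * μ))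
      where
      0≤N : 0ℤ ≤ N
      0≤N = 0≤ℕ n
      0≤k : 0ℤ ≤ k
      0≤k = ℤ.≤-trans (0≤ℕ 1) 1≤k
      0≤kQ : 0ℤ ≤ k * Q
      0≤kQ = 0≤* 0≤k Q-nonneg
      averaged : + 2 * (+ 2 * m) * (N * N * N) ≤ N * (N * (N * (N * (+ 2 * e))))
      averaged = ≤-by (0≤+ (0≤- embedded) 0≤kQ) (lem (+ 2 * (+ 2 * m) * (N * N * N)) (k * Q) (N * (N * (N * (N * (+ 2 * e))))))
        where
        lem : ∀ a b c → c - a ≡ (c - (a + b)) + b
        lem = solve-∀
      2NNN : ℤ
      2NNN = + 2 * (N * N * N)
      0<2NNN : 0ℤ < 2NNN
      0<2NNN = subst (_< 2NNN) (ℤ.*-zeroʳ (+ 2)) (ℤ.*-monoˡ-<-pos (+ 2) (positive³ 0<N))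
        where
        positive³ : ∀ {z} → 0ℤ < z → 0ℤ < z * z * z
        positive³ {+ ℕ.suc j} _ = ℤ.+<+ (ℕ.s≤s ℕ.z≤n)
        positive³ {+ ℕ.zero} (ℤ.+<+ ())
      2m≤eN : + 2 * m ≤ e * N
      2m≤eN = ℤ.*-cancelˡ-≤-pos (+ 2 * m) (e * N) 2NNN {{ℤ.positive 0<2NNN}} (≤-by (0≤- averaged) (lem N m e))
        where
        lem : ∀ N m e → + 2 * (N * N * N) * (e * N) - + 2 * (N * N * N) * (+ 2 * m) ≡
              N * (N * (N * (N * (+ 2 * e)))) - + 2 * (+ 2 * m) * (N * N * N)
        lem = solve-∀
      -- Without a strict excess over the mean there is no room for a positive `k * Q`, and k ≥ 1.
      Q≡0 : e * N ≤ + 2 * m → Q ≡ 0ℤ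
      Q≡0 eN≤2m = ℤ.≤-antisym (ℤ.≤-trans (≤-by (0≤* (0≤- 1≤k) Q-nonneg) (lem′ k Q)) kQ≤0) Q-nonneg
        where
        lem′ : ∀ k Q → k * Q - Q ≡ (k - 1ℤ) * Q
        lem′ = solve-∀
        lem : ∀ N m e q → 0ℤ - q ≡ (N * (N * (N * (N * (+ 2 * e)))) - (+ 2 * (+ 2 * m) * (N * N * N) + q))
              + + 2 * (N * N * N) * (+ 2 * m - e * N)
        lem = solve-∀
        kQ≤0 : k * Q ≤ 0ℤ
        kQ≤0 = ≤-by (0≤+ (0≤- embedded) (0≤* (ℤ.<⇒≤ 0<2NNN) (0≤- eN≤2m))) (lem N m e (k * Q))
      -- Now e N = 2 m, so n divides the degree sum; with Q = 0 this leaves only an empty `G` or an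
      -- empty complement.
      vanishing : e * N ≤ + 2 * m → μ ≡ 0ℤ
      vanishing eN≤2m = ℤ.≤-antisym (ℤ.*-cancelˡ-≤-pos μ 0ℤ (+ 2) (2μ≤0
        (balanced-indivisible G 4≤n (Q≡0 eN≤2m) e
          (trans degrees (trans (ℤ.≤-antisym 2m≤eN eN≤2m) (ℤ.*-comm e N)))))) 0≤μ
        where
        2μ≤0 : degreeSum G ≡ 0ℤ ⊎ degreeSum (complement G) ≡ 0ℤ → + 2 * μ ≤ 0ℤ
        2μ≤0 (inj₁ eq) = subst (+ 2 * μ ≤_) eq 2μ≤M
        2μ≤0 (inj₂ eq) = subst (+ 2 * μ ≤_) eq 2μ≤M̄
      62500≤2scale : + 250 * + 250 ≤ + 2 * scale
      62500≤2scale = ℤ.≤-trans (+≤+ (ℕ.m≤m+n 62500 37500)) (ℤ.*-monoˡ-≤-nonNeg (+ 2) (scale-≥ 50000 ℕ.≤-refl))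
      halve : + 2 * μ ≤ + 500 * N → μ ≤ + 250 * N
      halve le = ℤ.*-cancelˡ-≤-pos μ (+ 250 * N) (+ 2) (ℤ.≤-trans le (ℤ.≤-reflexive (trans (cong (_* N) 500≡) (ℤ.*-assoc (+ 2) (+ 250) N))))
        where
        500≡ : + 500 ≡ + 2 * + 250
        500≡ = refl
      smallCases : + 2 * μ ≤ + 500 * N → Dec (e * N ≤ + 2 * m) → Goal e
      smallCases small (yes eN≤2m) = average-arithmetic scale N D m μ e (scale-≥ 0 ℕ.z≤n) (inj₂ (vanishing eN≤2m)) averaged
      smallCases small (no eN≰2m)  = integral-arithmetic scale (+ 250) N D m μ e (scale-≥ 0 ℕ.z≤n) 62500≤2scale (0≤ℕ 250) 0≤N (0≤ℕ _) 0≤μ (halve small)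
        (ℤ.i<j⇒suc[i]≤j (ℤ.≰⇒> eN≰2m))
      cases : + 500 * N ≤ + 2 * μ ⊎ + 2 * μ ≤ + 500 * N → Goal e
      cases (inj₁ large) = many-discrepancy-arithmetic scale (+ 4000) N D m μ k Q e (scale-≥ 0 ℕ.z≤n) (scale-≥ 24000 (ℕ.m≤m+n 24000 26000)) 0≤k Q-nonneg gadgets (large-discrepancy large) embedded
      cases (inj₂ small) = smallCases small (e * N ℤ.≤? + 2 * m)

    tree-embedding : ∃ λ ρ → Injective _≡_ _≡_ ρ × (∀ e → agreement A G ρ ≡ + 2 * e → Goal e)
    tree-embedding with 2 ℕ.+ maxDegree A ℕ.≤? n
    -- Here n ≤ 1 + Δ, so the correction is not positive and the plain average, without gadgets, is
    -- enough.
    ... | no star = let ρ , inj , embedded = good-embedding A G (connected-degreeSum A tree) [] [] in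
      ρ , inj , λ e eq → average-arithmetic scale N D m μ e (scale-≥ 0 ℕ.z≤n) (inj₁ (+≤+ (ℕ.s≤s⁻¹ (ℕ.≰⇒> star))))
        (subst₂ _≤_ (trans (lem (degreeSum G) (N * N * N) Q) (cong (λ M → + 2 * M * (N * N * N)) degrees))
          (cong (λ z → N * (N * (N * (N * z)))) eq) embedded)
      where
      lem : ∀ M c q → + 2 * M * c + 0ℤ * q ≡ + 2 * M * c
      lem = solve-∀
    ... | yes notStar = finish (many-gadgets A tree notStar)
      where
      finish : ∃ (Enough A tree notStar) → ∃ λ ρ → Injective _≡_ _≡_ ρ × (∀ e → agreement A G ρ ≡ + 2 * e → Goal e)
      -- An empty list of gadgets would mean n ≤ 1 + Δ.
      finish ([] , _ , few) = contradiction notStar (ℕ.<⇒≱ (ℕ.s≤s few))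
      finish (gs@(g ∷ _) , ap , enough) = let ρ , inj , embedded = good-embedding A G (connected-degreeSum A tree) gs ap in
        ρ , inj , λ e eq → embedded⇒goal (+ length gs) e 4≤n (+≤+ (ℕ.s≤s ℕ.z≤n)) gadgets
          (subst₂ (λ M a → + 2 * M * (N * N * N) + + length gs * Q ≤ N * (N * (N * (N * a)))) degrees eq embedded)
        where
        gadgets : N ≤ + 6 * + length gs + 1ℤ + D
        gadgets = ℤ.≤-trans (+≤+ enough) (ℤ.≤-reflexive (cong (λ z → z + 1ℤ + D) (ℤ.pos-* 6 (length gs))))
        open Gadget g
        4≤n : 4 ℕ.≤ n
        4≤n with distinct
        ... | x≢p , x≢q , y≢p , y≢q , p≢q = subst (4 ℕ.≤_) (Subset.∣⊤∣≡n n)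
          (unique⇒length≤ Subset.⊤ (x ∷ y ∷ p ∷ q ∷ [])
            ((x≢y ∷ x≢p ∷ x≢q ∷ []) ∷ (y≢p ∷ y≢q ∷ []) ∷ (p≢q ∷ []) ∷ [] ∷ [])
            (All.tabulate λ _ → Subset.∈⊤))

-- Colour classes and copies

listSum : {X : Set} → (X → ℤ) → List X → ℤ
listSum f []       = 0ℤ
listSum f (x ∷ xs) = f x + listSum f xs

listSum-++ : ∀ {X : Set} (f : X → ℤ) xs ys → listSum f (xs ++ ys) ≡ listSum f xs + listSum f ys
listSum-++ f []       ys = sym (ℤ.+-identityˡ (listSum f ys))
listSum-++ f (x ∷ xs) ys = trans (cong (λ z → f x + z) (listSum-++ f xs ys)) (sym (ℤ.+-assoc (f x) (listSum f xs) (listSum f ys)))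

listSum-map : ∀ {X Y : Set} (f : Y → ℤ) (g : X → Y) xs → listSum f (map g xs) ≡ listSum (f ∘ g) xs
listSum-map f g []       = refl
listSum-map f g (x ∷ xs) = cong (λ z → f (g x) + z) (listSum-map f g xs)

listSum-cartesianProduct : ∀ {X Y : Set} (f : X × Y → ℤ) xs ys →
  listSum f (cartesianProduct xs ys) ≡ listSum (λ x → listSum (λ y → f (x , y)) ys) xs
listSum-cartesianProduct f []       ys = refl
listSum-cartesianProduct f (x ∷ xs) ys = trans (listSum-++ f (map (x ,_) ys) (cartesianProduct xs ys))
  (cong₂ _+_ (listSum-map f (x ,_) ys) (listSum-cartesianProduct f xs ys))

listSum-tabulate : ∀ {X : Set} (f : X → ℤ) (g : Fin n → X) → listSum f (tabulate g) ≡ ∑ (λ i → f (g i))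
listSum-tabulate {ℕ.zero}  f g = refl
listSum-tabulate {ℕ.suc n} f g = cong (λ z → f (g zero) + z) (listSum-tabulate f (g ∘ suc))

listSum-allFin² : (f : Fin n × Fin n → ℤ) →
  listSum f (cartesianProduct (allFin n) (allFin n)) ≡ ∑² (λ u v → f (u , v))
listSum-allFin² {n} f = trans (listSum-cartesianProduct f (allFin n) (allFin n))
  (trans (listSum-tabulate (λ u → listSum (λ v → f (u , v)) (allFin n)) id)
    (sum-cong-≗ λ u → listSum-tabulate (λ v → f (u , v)) id))

holds : {X : Set} {P : X → Set} → (∀ x → Dec (P x)) → Maybe X → ℤ
holds P? nothing  = 0ℤ
holds P? (just x) = ⟦ does (P? x) ⟧

length-filter-mapMaybe : ∀ {X Y : Set} {P : Y → Set} (P? : ∀ y → Dec (P y)) (f : X → Maybe Y) xs →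
  + length (filter P? (mapMaybe f xs)) ≡ listSum (holds P? ∘ f) xs
length-filter-mapMaybe P? f []       = refl
length-filter-mapMaybe P? f (x ∷ xs) with f x
... | nothing = trans (length-filter-mapMaybe P? f xs) (sym (ℤ.+-identityˡ (listSum (holds P? ∘ f) xs)))
... | just y with does (P? y)
...   | true  = trans (ℤ.pos-+ 1 (length (filter P? (mapMaybe f xs)))) (cong (λ z → 1ℤ + z) (length-filter-mapMaybe P? f xs))
...   | false = trans (length-filter-mapMaybe P? f xs) (sym (ℤ.+-identityˡ (listSum (holds P? ∘ f) xs)))

module _ (G : Graph (Fin n)) {r : ℕ} (χ : Colouring G r) (i : Fin r) where

  ascending? : ∀ u v → Dec (u Fin.< v × Adj G u v)
  ascending? u v = (u Fin.<? v) ×-dec T? (adj G u v)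

  -- The decision is a separate argument so that proofs can split on it: `χ` consumes the evidence
  -- it carries.
  hasColour′ : ∀ u v → Dec (u Fin.< v × Adj G u v) → Bool
  hasColour′ u v (yes e) = does (χ (u , v , e) Fin.≟ i)
  hasColour′ u v (no _)  = false

  -- Only ascending pairs carry an edge, so every coloured edge is seen from one side.
  hasColour : Fin n → Fin n → Bool
  hasColour u v = hasColour′ u v (ascending? u v)

  edgesInColour-∑² : + edgesInColour G χ i ≡ ∑² λ u v → ⟦ hasColour u v ⟧
  edgesInColour-∑² = overPairs
    (length-filter-mapMaybe (λ e → χ e Fin.≟ i) _ (cartesianProduct (allFin n) (allFin n)))
    (λ u v → pointwise u v (ascending? u v))
    where
    overPairs : ∀ {k : ℤ} {f : Fin n × Fin n → ℤ} {g : Fin n → Fin n → ℤ} →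
                k ≡ listSum f (cartesianProduct (allFin n) (allFin n)) → (∀ u v → f (u , v) ≡ g u v) → k ≡ ∑² g
    overPairs {f = f} k≡ f≡g = trans k≡ (trans (listSum-allFin² f) (∑²-cong f≡g))
    pointwise : ∀ u v (d : Dec (u Fin.< v × Adj G u v)) →
      holds (λ e → χ e Fin.≟ i) (Maybe.map (λ p → u , v , p) (dec⇒maybe d)) ≡ ⟦ hasColour′ u v d ⟧
    pointwise u v (yes _) = refl
    pointwise u v (no _)  = refl

  hasColour-asym : ∀ u v → hasColour u v ≡ true → hasColour v u ≡ false
  hasColour-asym u v uv = go (ascending? u v) (ascending? v u) uv
    where
    go : ∀ d d′ → hasColour′ u v d ≡ true → hasColour′ v u d′ ≡ false
    go _             (no _)          _ = refl
    go (yes (u<v , _)) (yes (v<u , _)) _ = contradiction v<u (ℕ.<-asym u<v)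

  hasColour-irrefl : ∀ u → hasColour u u ≡ false
  hasColour-irrefl u with hasColour u u in uu
  ... | true  = trans (sym uu) (hasColour-asym u u uu)
  ... | false = refl

  colourClass : Graph (Fin n)
  colourClass = record
    { adj        = λ u v → hasColour u v Bool.∨ hasColour v u
    ; adj-sym    = λ u v → Bool.∨-comm (hasColour u v) (hasColour v u)
    ; adj-irrefl = λ v → cong₂ Bool._∨_ (hasColour-irrefl v) (hasColour-irrefl v)
    }

  ι-colourClass : ∀ u v → ι colourClass u v ≡ ⟦ hasColour u v ⟧ + ⟦ hasColour v u ⟧
  ι-colourClass u v with hasColour u v in uv | hasColour v u in vu
  ... | true  | true  = contradiction (trans (sym vu) (hasColour-asym u v uv)) λ ()
  ... | true  | false = refl
  ... | false | true  = refl
  ... | false | false = refl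

  degreeSum-colourClass : degreeSum colourClass ≡ + 2 * + edgesInColour G χ i
  degreeSum-colourClass = begin
    ∑² (ι colourClass)
      ≡⟨ ∑²-cong ι-colourClass ⟩
    ∑² (λ u v → ⟦ hasColour u v ⟧ + ⟦ hasColour v u ⟧)
      ≡⟨ ∑²-+ (λ u v → ⟦ hasColour u v ⟧) (λ u v → ⟦ hasColour v u ⟧) ⟩
    S + ∑² (λ u v → ⟦ hasColour v u ⟧)
      ≡⟨ cong (λ z → S + z) (∑-comm (λ u v → ⟦ hasColour v u ⟧)) ⟩
    S + S
      ≡⟨ double S ⟩
    + 2 * S
      ≡⟨ cong (+ 2 *_) edgesInColour-∑² ⟨
    + 2 * + edgesInColour G χ i ∎
    where
    open ≡-Reasoning
    S = ∑² λ u v → ⟦ hasColour u v ⟧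
    double : ∀ s → s + s ≡ + 2 * s
    double = solve-∀

module _ (A : Graph (Fin n)) {ρ : Fin n → Fin n} (inj : Injective _≡_ _≡_ ρ) where

  private
    π : Permutation′ n
    π = injective⇒permutation inj

  image : Graph (Fin n)
  image = record
    { adj        = λ u v → adj A (π ⟨$⟩ˡ u) (π ⟨$⟩ˡ v)
    ; adj-sym    = λ u v → adj-sym A (π ⟨$⟩ˡ u) (π ⟨$⟩ˡ v)
    ; adj-irrefl = λ v → adj-irrefl A (π ⟨$⟩ˡ v)
    }

  embeddedCopy : Copy A (complete n)
  embeddedCopy = record
    { subgraph = record
      { vertices  = Subset.⊤
      ; edgeSet   = image
      ; edgeSet⊆  = λ uv → ≡true⇒T (complete-adj⁺ (adj⇒≢ image (T⇒≡true uv)))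
      ; endpoints = λ _ → Subset.∈⊤
      }
    ; isomorphic = record
      { bijection = mk↔ₛ′ (λ (v , _) → π ⟨$⟩ˡ v) (λ u → π ⟨$⟩ʳ u , Subset.∈⊤)
                      (λ u → Perm.inverseˡ π) (λ (v , v∈⊤) → sameVertex (Perm.inverseʳ π))
      ; preserves = λ u v → refl
      }
    }
    where
    sameVertex : ∀ {u v} {p : u Subset.∈ Subset.⊤} {q : v Subset.∈ Subset.⊤} → u ≡ v → (u , p) ≡ (v , q)
    sameVertex {p = p} {q} refl = cong (_ ,_) ([]=-irrelevant p q)

  module _ {r : ℕ} (χ : Colouring (complete n) r) (i : Fin r) where

    private
      G = colourClass (complete n) χ i
      χ′ : Colouring image r
      χ′ = χ ∘ Subgraph.inclusion (Copy.subgraph embeddedCopy)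

    -- An edge contains proofs of order and adjacency, on which `χ` could depend; both are
    -- irrelevant, so an edge of the image keeps the colour it has in the complete graph.
    hasColour-image : ∀ u v → hasColour image χ′ i u v ≡ hasColour (complete n) χ i u v Bool.∧ adj image u v
    hasColour-image u v = go (ascending? image χ′ i u v) (ascending? (complete n) χ i u v)
      where
      go : ∀ d d′ → hasColour′ image χ′ i u v d ≡ hasColour′ (complete n) χ i u v d′ Bool.∧ adj image u v
      go (yes (u<v , uv)) (yes (u<v′ , uv′)) = trans
        (cong₂ (λ p q → does (χ (u , v , p , q) Fin.≟ i)) (ℕ.<-irrelevant u<v u<v′) (Bool.T-irrelevant _ uv′))
        (trans (sym (Bool.∧-identityʳ c)) (cong (c Bool.∧_) (sym (T⇒≡true uv))))
        where c = does (χ (u , v , u<v′ , uv′) Fin.≟ i)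
      go (yes (u<v , uv)) (no ¬uv) = contradiction (u<v , Subgraph.edgeSet⊆ (Copy.subgraph embeddedCopy) uv) ¬uv
      go (no ¬uv) (no _) = refl
      go (no ¬uv) (yes e@(u<v , _)) = sym (trans
        (cong (does (χ (u , v , e) Fin.≟ i) Bool.∧_) (≢true⇒false λ uv → ¬uv (u<v , ≡true⇒T uv)))
        (Bool.∧-zeroʳ (does (χ (u , v , e) Fin.≟ i))))

    -- Reindexing by `ρ` carries `A` to its image. Adjacency in both `G` and the image is adjacency
    -- in the copy's colour class, whose degree sum counts each edge twice.
    agreement-copy : agreement A G ρ ≡ + 2 * + copyEdgesInColour χ embeddedCopy i
    agreement-copy = begin
      ∑² (λ u v → ι G (ρ u) (ρ v) * ι A u v)
        ≡⟨ ∑²-cong (λ u v → cong (ι G (ρ u) (ρ v) *_) (cong₂ (ι A) (sym (Perm.inverseˡ π)) (sym (Perm.inverseˡ π)))) ⟩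
      ∑² (λ u v → ι G (ρ u) (ρ v) * ι image (ρ u) (ρ v))
        ≡⟨ ∑²-injective (λ u v → ι G u v * ι image u v) inj ⟩
      ∑² (λ u v → ι G u v * ι image u v)
        ≡⟨ ∑²-cong pointwise ⟩
      degreeSum (colourClass image χ′ i)
        ≡⟨ degreeSum-colourClass image χ′ i ⟩
      + 2 * + copyEdgesInColour χ embeddedCopy i ∎
      where
      open ≡-Reasoning
      pointwise : ∀ u v → ι G u v * ι image u v ≡ ι (colourClass image χ′ i) u v
      pointwise u v = trans (sym (⟦∧⟧ (adj G u v) (adj image u v))) (cong ⟦_⟧ (trans
        (Bool.∧-distribʳ-∨ (adj image u v) (hasColour (complete n) χ i u v) (hasColour (complete n) χ i v u))
        (cong₂ Bool._∨_ (sym (hasColour-image u v))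
          (trans (cong (hasColour (complete n) χ i v u Bool.∧_) (adj-sym image u v)) (sym (hasColour-image v u))))))

-- The inequality over the rationals

2*nC2 : ∀ k → + 2 * + (k ℕ.C 2) ≡ + k * (+ k - 1ℤ)
2*nC2 ℕ.zero    = refl
2*nC2 (ℕ.suc k) = begin
  + 2 * + (ℕ.suc k ℕ.C 2)            ≡⟨ cong (λ c → + 2 * + c) (ℕ.nCk+nC[k+1]≡[n+1]C[k+1] k 1) ⟨
  + 2 * + (k ℕ.C 1 ℕ.+ k ℕ.C 2)        ≡⟨ cong (λ c → + 2 * + (c ℕ.+ k ℕ.C 2)) (ℕ.nC1≡n k) ⟩
  + 2 * + (k ℕ.+ k ℕ.C 2)            ≡⟨ cong (+ 2 *_) (ℤ.pos-+ k (k ℕ.C 2)) ⟩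
  + 2 * (+ k + + (k ℕ.C 2))          ≡⟨ ℤ.*-distribˡ-+ (+ 2) (+ k) (+ (k ℕ.C 2)) ⟩
  + 2 * + k + + 2 * + (k ℕ.C 2)      ≡⟨ cong (λ z → + 2 * + k + z) (2*nC2 k) ⟩
  + 2 * + k + + k * (+ k - 1ℤ)     ≡⟨ lem (+ k) ⟩
  (1ℤ + + k) * (1ℤ + + k - 1ℤ)     ∎
  where
  open ≡-Reasoning
  lem : ∀ k → + 2 * k + k * (k - 1ℤ) ≡ (1ℤ + k) * (1ℤ + k - 1ℤ)
  lem = solve-∀

toℚᵘ-/ : ∀ i d .{{_ : NonZero d}} → ℚ.toℚᵘ (i / d) ℚᵘ.≃ i ℚᵘ./ d
toℚᵘ-/ i (ℕ.suc d) = ℚ.toℚᵘ-fromℚᵘ (mkℚᵘ i d)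

-- Unnormalised fractions keep their denominators visible: the sum on the left has denominator N
-- times 2 c N⁴, so cross-multiplication yields `Target` multiplied by one further N.
bound-≤ᵘ : ∀ c g p q (D m μ e : ℤ) → + 2 * c ≡ + ℕ.suc g → ℕ.suc q ≡ ℕ.suc p ℕ.* ℕ.suc p →
  Target c (+ ℕ.suc p) D m μ e →
  mkℚᵘ (+ 2 * m) p ℚᵘ.+ mkℚᵘ 1ℤ g ℚᵘ.* mkℚᵘ (+ ℕ.suc p - 1ℤ - D) 0 ℚᵘ.* (mkℚᵘ μ q ℚᵘ.* mkℚᵘ μ q) ℚᵘ.≤ mkℚᵘ e 0
bound-≤ᵘ c g p q D m μ e 2c≡ qq target = *≤* (subst₂ _≤_
  (cong (λ z → (+ 2 * m * z + 1ℤ * (N - 1ℤ - D) * (μ * μ) * N) * 1ℤ) (sym denominator))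
  (cong (e *_) (trans (cong (N *_) (sym denominator)) (sym (ℤ.pos-* (ℕ.suc p) d))))
  (≤-by (0≤* (0≤ℕ (ℕ.suc p)) (0≤- target)) (lem c N D m μ e)))
  where
  N = + ℕ.suc p
  d : ℕ
  d = ℕ.suc g ℕ.* 1 ℕ.* (ℕ.suc q ℕ.* ℕ.suc q)
  denominator : + d ≡ + 2 * c * 1ℤ * ((N * N) * (N * N))
  denominator = trans (ℤ.pos-* (ℕ.suc g ℕ.* 1) (ℕ.suc q ℕ.* ℕ.suc q))
    (cong₂ _*_ (trans (ℤ.pos-* (ℕ.suc g) 1) (cong (_* 1ℤ) (sym 2c≡)))
      (trans (ℤ.pos-* (ℕ.suc q) (ℕ.suc q)) (cong (λ z → z * z) (trans (cong +_ qq) (ℤ.pos-* (ℕ.suc p) (ℕ.suc p))))))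
  lem : ∀ c N D m μ e →
    e * (N * (+ 2 * c * 1ℤ * ((N * N) * (N * N))))
      - (+ 2 * m * (+ 2 * c * 1ℤ * ((N * N) * (N * N))) + 1ℤ * (N - 1ℤ - D) * (μ * μ) * N) * 1ℤ ≡
    N * (+ 2 * c * e * (N * N * N * N) - (+ 4 * c * m * (N * N * N) + (N - 1ℤ - D) * (μ * μ)))
  lem = solve-∀

bound-≤ : ∀ c γ .{{_ : NonZero γ}} k .{{_ : NonZero k}} Δ m e → + 2 * c ≡ + γ →
          Target c (+ k) (+ Δ) (+ m) (m ⋆[ k ]) (+ e) → bound (+ 1 / γ) k Δ m ℚ.≤ (+ e) / 1
bound-≤ c γ ℕ.zero Δ m e _ _ = contradiction refl (ℕ.≢-nonZero⁻¹ 0)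
bound-≤ c (ℕ.suc g) k@(ℕ.suc p) Δ m e 2c≡γ target = ℚ.toℚᵘ-cancel-≤ (begin
  ℚ.toℚᵘ (bound C k Δ m)
    ≃⟨ ℚ.toℚᵘ-homo-+ (+ (2 ℕ.* m) / k) (C ℚ.* b ℚ.* (q ℚ.* q)) ⟩
  ℚ.toℚᵘ (+ (2 ℕ.* m) / k) ℚᵘ.+ ℚ.toℚᵘ (C ℚ.* b ℚ.* (q ℚ.* q))
    ≃⟨ ℚᵘ.+-cong (toℚᵘ-/ (+ (2 ℕ.* m)) k) (ℚᵘ.≃-trans (ℚ.toℚᵘ-homo-* (C ℚ.* b) (q ℚ.* q))
         (ℚᵘ.*-cong (ℚᵘ.≃-trans (ℚ.toℚᵘ-homo-* C b) (ℚᵘ.*-cong (toℚᵘ-/ (+ 1) (ℕ.suc g)) (toℚᵘ-/ (+ k - 1ℤ - + Δ) 1)))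
                    (ℚᵘ.≃-trans (ℚ.toℚᵘ-homo-* q q) (ℚᵘ.*-cong q≃ q≃)))) ⟩
  mkℚᵘ (+ (2 ℕ.* m)) p ℚᵘ.+ mkℚᵘ 1ℤ g ℚᵘ.* mkℚᵘ (+ k - 1ℤ - + Δ) 0 ℚᵘ.* (mkℚᵘ μ k²-1 ℚᵘ.* mkℚᵘ μ k²-1)
    ≤⟨ subst (λ z → mkℚᵘ z p ℚᵘ.+ mkℚᵘ 1ℤ g ℚᵘ.* mkℚᵘ (+ k - 1ℤ - + Δ) 0 ℚᵘ.* (mkℚᵘ μ k²-1 ℚᵘ.* mkℚᵘ μ k²-1) ℚᵘ.≤ mkℚᵘ (+ e) 0)
         (sym (ℤ.pos-* 2 m)) (bound-≤ᵘ c g p k²-1 (+ Δ) (+ m) μ (+ e) 2c≡γ (cong (k ℕ.*_) (ℕ.*-identityʳ k)) target) ⟩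
  mkℚᵘ (+ e) 0
    ≃⟨ toℚᵘ-/ (+ e) 1 ⟨
  ℚ.toℚᵘ ((+ e) / 1) ∎)
  where
  open ℚᵘ.≤-Reasoning
  μ = m ⋆[ k ]
  C b q : ℚ
  C = + 1 / ℕ.suc g
  b = (+ k - 1ℤ - + Δ) / 1
  q = _/_ μ (k ℕ.^ 2) {{ℕ.m^n≢0 k 2}}
  -- `mkℚᵘ` stores the denominator minus one.
  k²-1 : ℕ
  k²-1 = ℕ.pred (k ℕ.^ 2)
  q≃ : ℚ.toℚᵘ q ℚᵘ.≃ mkℚᵘ μ k²-1
  q≃ = toℚᵘ-/ μ (k ℕ.^ 2) {{ℕ.m^n≢0 k 2}}

module _ {r : ℕ} (χ : Colouring (complete n) r) (i : Fin r) where

  private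
    G = colourClass (complete n) χ i
    m = edgesInColour (complete n) χ i

  degreeSum-otherColours : degreeSum (complement G) ≡ + 2 * (+ (n ℕ.C 2) - + m)
  degreeSum-otherColours = begin
    degreeSum (complement G)          ≡⟨ degreeSum-complement G ⟩
    + n * (+ n - 1ℤ) - degreeSum G    ≡⟨ cong₂ _-_ (sym (2*nC2 n)) (degreeSum-colourClass (complete n) χ i) ⟩
    + 2 * + (n ℕ.C 2) - + 2 * + m       ≡⟨ lem (+ (n ℕ.C 2)) (+ m) ⟩
    + 2 * (+ (n ℕ.C 2) - + m)           ∎
    where
    open ≡-Reasoning
    lem : ∀ a b → + 2 * a - + 2 * b ≡ + 2 * (a - b)
    lem = solve-∀

  minority-nonneg : 0ℤ ≤ m ⋆[ n ]
  minority-nonneg = ℤ.⊓-glb (0≤ℕ m) (ℤ.*-cancelˡ-≤-pos 0ℤ (+ (n ℕ.C 2) - + m) (+ 2)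
    (subst (0ℤ ≤_) degreeSum-otherColours (degreeSum-nonneg (complement G))))

  minority-sel : + 2 * (m ⋆[ n ]) ≡ degreeSum G ⊎ + 2 * (m ⋆[ n ]) ≡ degreeSum (complement G)
  minority-sel with ℤ.⊓-sel (+ m) (+ (n ℕ.C 2) - + m)
  ... | inj₁ eq = inj₁ (trans (cong (+ 2 *_) eq) (sym (degreeSum-colourClass (complete n) χ i)))
  ... | inj₂ eq = inj₂ (trans (cong (+ 2 *_) eq) (sym degreeSum-otherColours))

  minority≤ : + 2 * (m ⋆[ n ]) ≤ degreeSum G
  minority≤ = subst (+ 2 * (m ⋆[ n ]) ≤_) (sym (degreeSum-colourClass (complete n) χ i))
    (ℤ.*-monoˡ-≤-nonNeg (+ 2) (ℤ.i⊓j≤i (+ m) (+ (n ℕ.C 2) - + m)))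

  minority≤′ : + 2 * (m ⋆[ n ]) ≤ degreeSum (complement G)
  minority≤′ = subst (+ 2 * (m ⋆[ n ]) ≤_) (sym degreeSum-otherColours)
    (ℤ.*-monoˡ-≤-nonNeg (+ 2) (ℤ.i⊓j≤j (+ m) (+ (n ℕ.C 2) - + m)))

instance
  _ = inverseC-nonZero

colour-rich-copy : .{{_ : NonZero n}} → ∀ {r} (χ : Colouring (complete n) r) (i : Fin r) (A : Graph (Fin n)) → IsTree A →
  ∃ λ (H : Copy A (complete n)) →
    bound (+ 1 / inverseC) n (maxDegree A) (edgesInColour (complete n) χ i) ℚ.≤ (+ copyEdgesInColour χ H i) / 1
colour-rich-copy {n} χ i A tree = finish (tree-embedding A G tree {+ m} {m ⋆[ n ]}
  (degreeSum-colourClass (complete n) χ i) (minority-nonneg χ i) (minority-sel χ i) (minority≤ χ i) (minority≤′ χ i))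
  where
  G = colourClass (complete n) χ i
  m = edgesInColour (complete n) χ i
  finish : (∃ λ ρ → Injective _≡_ _≡_ ρ ×
             (∀ e → agreement A G ρ ≡ + 2 * e → Target scale (+ n) (+ maxDegree A) (+ m) (m ⋆[ n ]) e)) →
           ∃ λ (H : Copy A (complete n)) →
             bound (+ 1 / inverseC) n (maxDegree A) m ℚ.≤ (+ copyEdgesInColour χ H i) / 1
  finish (ρ , inj , target) = H ,
    bound-≤ scale inverseC n (maxDegree A) m (copyEdgesInColour χ H i) 2*scale
      (target (+ copyEdgesInColour χ H i) (agreement-copy A inj χ i))
    where H = embeddedCopy A inj

theorem1p2 : ∃ λ (C : ℚ) → 0ℚ ℚ.< C ×
    ((r : ℕ) → 2 ℕ.≤ r →
    (n : ℕ) .{{_ : NonZero n}} (χ : Colouring (complete n) r) (i : Fin r)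
    (T : Graph (Fin n)) → IsTree T →
    (Δ : ℕ) → maxDegree T ≡ Δ →
    ∃ λ (H : Copy T (complete n)) →
    bound C n Δ (edgesInColour (complete n) χ i) ℚ.≤ (+ copyEdgesInColour χ H i) / 1)
theorem1p2 = + 1 / inverseC , ℚ.positive⁻¹ (+ 1 / inverseC) {{ℚ.normalize-pos 1 inverseC}} ,
  λ { r _ n χ i T tree _ refl → colour-rich-copy χ i T tree }
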